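{- Let $p$ range over primes $p>3$. (i) For $n\in\{4,-3,9,-8,\tfrac14,\tfrac34,\tfrac43,-\tfrac13\}$, the functions $p\mapsto F_p(0,1,n)\bmod 16$ are pairwise equivalent. (ii) The function $p\mapsto F_p(0,1,4)\bmod 16$ is equivalent to $p\mapsto\prod_{0<i<j<p/2,\ p\nmid f(i,j)}\big(\frac{f(i,j)}{p}\big)$ for each of the forms $f(i,j)=i^2+ij+j^2,\ i^2-ij+j^2,\ 2i^2+5ij+2j^2,\ 2i^2-5ij+2j^2,\ 4i^2-j^2,\ 9i^2-j^2,\ 3i^2+j^2,\ 8i^2+j^2$. (iii) $p\mapsto F_p(0,1,4)\bmod 16$ and all the products in (ii) are periodic functions of $p$.
   Context: $\big(\frac{\cdot}{p}\big)$ is the Legendre symbol; products are over integers $i,j$. For a rational $n$ whose denominator is prime to $p$, $F_p(0,1,n)=\sum_{y=1}^{p}\big(\frac{y(y+1)(y+w)}{p}\big)$ where $w$ is an integer with $w\equiv n\pmod p$; "$\bmod 16$" denotes the least nonnegative residue modulo $16$. A function $g$ on a set of primes is periodic if there is $m\in\mathbb Z_{>0}$ with $g(p_1)=g(p_2)$ whenever $p_1\equiv p_2\pmod m$ lie in its domain. Two functions $g,h$ on sets of primes are equivalent if there is $m\in\mathbb Z_{>0}$ such that for each $r$ with $1\le r<m$, $\gcd(r,m)=1$, there is a degree-one polynomial $f_r$ with rational coefficients such that $g(p)=f_r(h(p))$ for all primes $p$ in the common domain with $p\equiv r\pmod m$. -}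

module Defs where

open import Data.Bool using (Bool; true; false; if_then_else_; not)
open import Data.Nat as ℕ using (ℕ; zero; suc; _≡ᵇ_; _<ᵇ_)
open import Data.Nat.Primality using (Prime)
open import Data.Nat.GCD using (gcd)
open import Data.Integer as ℤ using (ℤ; +_; -[1+_]; _%ℕ_)
open import Data.Rational as ℚ using (ℚ; 0ℚ)
open import Data.List using (List; []; _∷_; map; foldr; upTo; concatMap; filterᵇ)
open import Data.Bool.ListAction using (any)
open import Data.Product using (_×_; _,_; Σ; ∃; ∃-syntax)
open import Relation.Binary.PropositionalEquality using (_≡_; _≢_)

sumℤ : List ℤ → ℤ
sumℤ = foldr ℤ._+_ (+ 0)

productℤ : List ℤ → ℤ
productℤ = foldr ℤ._*_ (+ 1)

range1 : ℕ → List ℕ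
range1 k = map suc (upTo k)

legendre : ℤ → ℕ → ℤ
legendre a zero = + 0
legendre a (suc k) =
  if (a %ℕ suc k) ≡ᵇ 0 then + 0
  else if any (λ x → ((+ x ℤ.* + x) %ℕ suc k) ≡ᵇ (a %ℕ suc k)) (range1 k)
       then + 1 else ℤ.- (+ 1)

-- least w in [0, p) with den * w ≡ num (mod p); i.e. an integer w ≡ num/den (mod p)
-- (unique when p is prime and p ∤ den); default 0 if none exists.
findW : ℤ → ℕ → ℕ → List ℕ → ℕ
findW num den p [] = 0
findW num den zero (w ∷ ws) = 0
findW num den (suc k) (w ∷ ws) =
  if ((+ den ℤ.* + w ℤ.- num) %ℕ suc k) ≡ᵇ 0 then w else findW num den (suc k) ws

residueOf : ℚ → ℕ → ℤ
residueOf n p = + findW (ℚ.numerator n) (ℚ.denominatorℕ n) p (upTo p)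

F01 : ℕ → ℚ → ℤ
F01 p n = sumℤ (map (λ y → legendre (+ y ℤ.* (+ y ℤ.+ + 1) ℤ.* (+ y ℤ.+ w)) p) (range1 p))
  where w = residueOf n p

Fmod16 : ℚ → ℕ → ℤ
Fmod16 n p = + (F01 p n %ℕ 16)

-- does p divide a? (p = 0 never occurs for primes)
dvdᵇ : ℕ → ℤ → Bool
dvdᵇ zero a = false
dvdᵇ (suc k) a = (a %ℕ suc k) ≡ᵇ 0

pairs : ℕ → List (ℕ × ℕ)
pairs p = concatMap (λ j → map (λ i → i , j) (range1 (ℕ.pred j)))
            (filterᵇ (λ j → (2 ℕ.* j) <ᵇ p) (range1 p))

formProduct : (ℤ → ℤ → ℤ) → ℕ → ℤ
formProduct f p =
  productℤ (map (λ ij → legendre (fij ij) p)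
    (filterᵇ (λ ij → not (dvdᵇ p (fij ij))) (pairs p)))
  where
  fij : ℕ × ℕ → ℤ
  fij (i , j) = f (+ i) (+ j)

PrimeGt3 : ℕ → Set
PrimeGt3 p = Prime p × 3 ℕ.< p

toℚ : ℤ → ℚ
toℚ z = z ℚ./ 1

Periodic : (ℕ → ℤ) → Set
Periodic g = ∃[ m ] (0 ℕ.< m × (∀ p₁ p₂ → PrimeGt3 p₁ → PrimeGt3 p₂ →
  p₁ ℕ.% suc (ℕ.pred m) ≡ p₂ ℕ.% suc (ℕ.pred m) → g p₁ ≡ g p₂))

Equivalent : (ℕ → ℤ) → (ℕ → ℤ) → Set
Equivalent g h = ∃[ m ] (0 ℕ.< m × (∀ r → r ℕ.< m → gcd r m ≡ 1 →
  ∃[ a ] ∃[ b ] (a ≢ 0ℚ × (∀ p → PrimeGt3 p → p ℕ.% suc (ℕ.pred m) ≡ r →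
     toℚ (g p) ≡ a ℚ.* toℚ (h p) ℚ.+ b))))

nList : List ℚ
nList = (+ 4 ℚ./ 1) ∷ (ℤ.- (+ 3) ℚ./ 1) ∷ (+ 9 ℚ./ 1) ∷ (ℤ.- (+ 8) ℚ./ 1)
      ∷ (+ 1 ℚ./ 4) ∷ (+ 3 ℚ./ 4) ∷ (+ 4 ℚ./ 3) ∷ (ℤ.- (+ 1) ℚ./ 3) ∷ []

formList : List (ℤ → ℤ → ℤ)
formList =
    (λ i j → i ℤ.* i ℤ.+ i ℤ.* j ℤ.+ j ℤ.* j)
  ∷ (λ i j → i ℤ.* i ℤ.- i ℤ.* j ℤ.+ j ℤ.* j)
  ∷ (λ i j → + 2 ℤ.* i ℤ.* i ℤ.+ + 5 ℤ.* i ℤ.* j ℤ.+ + 2 ℤ.* j ℤ.* j)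
  ∷ (λ i j → + 2 ℤ.* i ℤ.* i ℤ.- + 5 ℤ.* i ℤ.* j ℤ.+ + 2 ℤ.* j ℤ.* j)
  ∷ (λ i j → + 4 ℤ.* i ℤ.* i ℤ.- j ℤ.* j)
  ∷ (λ i j → + 9 ℤ.* i ℤ.* i ℤ.- j ℤ.* j)
  ∷ (λ i j → + 3 ℤ.* i ℤ.* i ℤ.+ j ℤ.* j)
  ∷ (λ i j → + 8 ℤ.* i ℤ.* i ℤ.+ j ℤ.* j)
  ∷ []

four : ℚ
four = + 4 ℚ./ 1

{-# OPTIONS --safe #-}

-- Let χ be the Legendre symbol mod p, u = χ (-1), v = χ 2 and w = χ 3.  Every function in the
-- theorem is a function of p mod 16 and u, v, w alone; by Gauss's lemma u, v, w depend on p
-- mod 24 only, so everything has period 48, and periodic functions are equivalent through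
-- polynomials x + b_r.
--
-- Put G (a, b, c) = ∑ χ ((x + a) (x + b) (x + c)).  Affine substitutions express each F_p (0, 1, n)
-- through G (0, 1, m²) with m = 2 or 3.  Expanding (1 + χ x) (1 + χ (x + 1)) (1 + χ (x + m²)) gives
-- G (0, 1, m²) as eight times the number of x with x, x + 1, x + m² all nonzero squares, plus
-- elementary terms.  This number is only needed mod 2, and x ↦ m² / x is an involution of the
-- set counted, so it suffices to look at the fixed points ± m.
--
-- Each form is, up to a square constant, a X² + b Y² with (X, Y) = (i, j) or (j - i, j + i), so its
-- product over i < j < p/2 is ∏ χ (a s + b) ^ M s, where M s is the number of pairs with
-- X² = s Y².  Gauss's lemma, applied to r or to (1 ± r) / 2 where s = r², shows that M s is odd
-- exactly when χ s = 1 and χ (1 - s) = - u.  Hence the product is the parity of another count of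
-- sign patterns of three linear forms, and the same expansion expresses it by G mod 16.
module Submission where

open import Defs
open import Data.Product using (_×_)
open import Data.Rational using (ℚ)
open import Data.Integer using (ℤ)
open import Data.List.Membership.Propositional using (_∈_)

open import Algebra.Bundles using (module AbelianGroup)
import Algebra.Properties.CommutativeMonoid.Sum as MonoidSum
import Algebra.Properties.Group as GroupProperties
import Algebra.Properties.Semiring.Sum as SemiringSum
open import Data.Bool using (Bool; true; false; if_then_else_; not; T)
open import Data.Bool.ListAction using (any)
open import Data.Empty using (⊥; ⊥-elim)
open import Data.Fin using (Fin; toℕ; fromℕ<)
open import Data.Fin.Permutation using (permutation)
open import Data.Fin.Properties using (toℕ<n; toℕ-fromℕ<; toℕ-injective)
open import Data.Integer as ℤ using (+_; -_; _+_; _*_; _-_; 0ℤ; 1ℤ; -1ℤ; _%ℕ_; _/ℕ_)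
open import Data.Integer.DivMod using (a≡a%ℕn+[a/ℕn]*n; n%ℕd<d)
open import Data.Integer.Divisibility.Signed using (_∣_; divides; _∣?_; ∣ᵤ⇒∣; ∣⇒∣ᵤ)
open import Data.Integer.Properties as ℤ using (+-*-semiring; *-1-commutativeMonoid; +-identityʳ; +-identityˡ; *-identityˡ; *-identityʳ; +-assoc; abs-*)
open import Data.Integer.Tactic.RingSolver using (solve-∀)
open import Data.List using (List; []; _∷_; _++_; length; replicate; map; concatMap; filterᵇ; applyUpTo; upTo)
open import Data.List.Membership.Propositional using (lose)
open import Data.List.Membership.Propositional.Properties using (∈-map⁺; ∈-upTo⁺)
open import Data.List.Properties using (length-replicate; map-++; map-∘; map-upTo)
open import Data.List.Relation.Unary.Any as Any using (here; there)
open import Data.List.Relation.Unary.Any.Properties using (any⁺; any⁻)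
open import Data.Nat as ℕ using (ℕ; zero; suc; NonZero)
open import Data.Nat.Coprimality using (prime⇒coprime; coprime-Bézout)
open import Data.Nat.DivMod as ℕ using ()
open import Data.Nat.Divisibility as ℕ using (∣⇒≤) renaming (divides to ℕ-divides)
open import Data.Nat.GCD using (module Bézout)
open import Data.Nat.Primality using (Prime; euclidsLemma; prime⇒irreducible)
open import Data.Nat.Properties as ℕ using ()
open import Data.Nat.Tactic.RingSolver using () renaming (solve-∀ to ℕ-solve-∀)
open import Data.Product using (_,_; proj₁; proj₂; ∃; Σ)
open import Data.Rational as ℚ using (1ℚ)
open import Data.Rational.Properties as ℚ using ()
open import Data.Rational.Unnormalised as ℚᵘ using (mkℚᵘ; *≡*)
open import Data.Rational.Unnormalised.Properties as ℚᵘ using ()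
open import Data.Sum as Sum using (_⊎_; inj₁; inj₂)
open import Data.Unit using (tt)
open import Function using (_∘_; id)
open import Relation.Binary.Definitions using (tri<; tri≈; tri>)
open import Relation.Binary.PropositionalEquality hiding (J)
open import Relation.Nullary using (¬_; yes; no; Dec; contradiction)
import Relation.Nullary.Decidable as Dec

open GroupProperties (AbelianGroup.group ℤ.+-0-abelianGroup) using (∙-cancelˡ)
open SemiringSum +-*-semiring using (sum; sum-cong-≗; ∑-distrib-+; *-distribˡ-sum) renaming (∑-comm to sum-comm)
open MonoidSum *-1-commutativeMonoid using () renaming (sum to prod; sum-cong-≗ to prod-cong-≗; ∑-distrib-+ to prod-distrib-*; sum-permute to prod-permute)

-- Congruences, finite sums and parity

-- Up to sign, G (0, 1, m²) is the Frobenius trace of the elliptic curve y² = x (x + 1) (x + m²),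
-- which no residue class of p determines. Only its residue mod 16 is elementary: the factor 8 in
-- the expansion leaves a single unknown parity. The choices m = 2 and m = 3 keep the fixed-point
-- terms simple: they involve χ at -1, m, m - 1 and m + 1 only, hence no primes beyond 2 and 3. The
-- period is 48 = lcm (16, 24), where 16 is needed because p itself occurs in G mod 16. The numbers
-- n are the orbit of 4 under n ↦ 1 - n and n ↦ 1 / n, together with 9 and -8. For each form the
-- points 0, -a, b are, up to order, translation and reflection, the points 0, 1, 4 or 0, 1, 9. The
-- two families of pairs (X, Y) are not matched with each other; each reaches the same parity law
-- for M by its own use of Gauss's lemma.

infix 4 _≡_mod_
record _≡_mod_ (x y n : ℤ) : Set where
  constructor mk
  field n∣x-y : n ∣ x - y

module _ {n : ℤ} where

  mod-by : ∀ {x y} q → x - y ≡ q * n → x ≡ y mod n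
  mod-by q eq = mk (divides q eq)

  mod-refl : ∀ {x} → x ≡ x mod n
  mod-refl {x} = mod-by 0ℤ (lem x n)
    where lem : ∀ x n → x - x ≡ 0ℤ * n
          lem = solve-∀

  ≡⇒mod : ∀ {x y} → x ≡ y → x ≡ y mod n
  ≡⇒mod refl = mod-refl

  -- The pattern for nearly every congruence below: the ring solver knows no hypotheses, so x - y is
  -- written as a multiple of a difference already known to vanish, and a plain polynomial identity
  -- remains for `solve-∀`.
  mod-lin : ∀ {a b x y} k → a ≡ b mod n → x - y ≡ k * (a - b) → x ≡ y mod n
  mod-lin k (mk (divides q e)) eq = mod-by (k * q) (trans eq (trans (cong (k *_) e) (lem k q n)))
    where lem : ∀ k q n → k * (q * n) ≡ k * q * n
          lem = solve-∀

  mod-lin₂ : ∀ {a b c d x y} k l → a ≡ b mod n → c ≡ d mod n →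
             x - y ≡ k * (a - b) + l * (c - d) → x ≡ y mod n
  mod-lin₂ k l (mk (divides q e)) (mk (divides r f)) eq =
    mod-by (k * q + l * r) (trans eq (trans (cong₂ (λ u v → k * u + l * v) e f) (lem k q l r n)))
    where lem : ∀ k q l r n → k * (q * n) + l * (r * n) ≡ (k * q + l * r) * n
          lem = solve-∀

  mod-sym : ∀ {x y} → x ≡ y mod n → y ≡ x mod n
  mod-sym {x} {y} e = mod-lin -1ℤ e (lem x y)
    where lem : ∀ x y → y - x ≡ -1ℤ * (x - y)
          lem = solve-∀

  mod-trans : ∀ {x y z} → x ≡ y mod n → y ≡ z mod n → x ≡ z mod n
  mod-trans {x} {y} {z} e f = mod-lin₂ 1ℤ 1ℤ e f (lem x y z)
    where lem : ∀ x y z → x - z ≡ 1ℤ * (x - y) + 1ℤ * (y - z)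
          lem = solve-∀

  mod-+ : ∀ {x y z w} → x ≡ y mod n → z ≡ w mod n → x + z ≡ y + w mod n
  mod-+ {x} {y} {z} {w} e f = mod-lin₂ 1ℤ 1ℤ e f (lem x y z w)
    where lem : ∀ x y z w → (x + z) - (y + w) ≡ 1ℤ * (x - y) + 1ℤ * (z - w)
          lem = solve-∀

  mod-* : ∀ {x y z w} → x ≡ y mod n → z ≡ w mod n → x * z ≡ y * w mod n
  mod-* {x} {y} {z} {w} e f = mod-lin₂ z y e f (lem x y z w)
    where lem : ∀ x y z w → x * z - y * w ≡ z * (x - y) + y * (z - w)
          lem = solve-∀

  mod-neg : ∀ {x y} → x ≡ y mod n → - x ≡ - y mod n
  mod-neg {x} {y} e = mod-lin -1ℤ e (lem x y)
    where lem : ∀ x y → - x - - y ≡ -1ℤ * (x - y)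
          lem = solve-∀

  mod-- : ∀ {x y z w} → x ≡ y mod n → z ≡ w mod n → x - z ≡ y - w mod n
  mod-- e f = mod-+ e (mod-neg f)

  -- The rule that changes the modulus: through it a count known mod 2 determines a character sum
  -- mod 16.
  mod-scale : ∀ {x y} k → x ≡ y mod n → k * x ≡ k * y mod (k * n)
  mod-scale {x} {y} k (mk (divides q e)) = mk (divides q (trans (lem₁ k x y) (trans (cong (k *_) e) (lem₂ k q n))))
    where lem₁ : ∀ k x y → k * x - k * y ≡ k * (x - y)
          lem₁ = solve-∀
          lem₂ : ∀ k q n → k * (q * n) ≡ q * (k * n)
          lem₂ = solve-∀

≡%ℕ-mod : ∀ x n → x ≡ + (x %ℕ suc n) mod (+ suc n)
≡%ℕ-mod x n = mod-by (x /ℕ suc n)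
  (trans (cong (_- + (x %ℕ suc n)) (a≡a%ℕn+[a/ℕn]*n x (suc n))) (lem (+ (x %ℕ suc n)) _))
  where lem : ∀ r q → (r + q) - r ≡ q
        lem = solve-∀

small-mod-unique : ∀ {n i j} → i ℕ.< n → j ℕ.< n → + i ≡ + j mod (+ n) → i ≡ j
small-mod-unique {n} {i} {j} i<n j<n (mk d) =
  ℤ.+-injective (ℤ.i-j≡0⇒i≡j (+ i) (+ j) (ℤ.∣i∣≡0⇒i≡0 (∣-<⇒≡0 (∣⇒∣ᵤ d) bound)))
  where
  bound : ℤ.∣ + i - + j ∣ ℕ.< n
  bound = ℕ.≤-<-trans (subst (λ z → ℤ.∣ z ∣ ℕ.≤ i ℕ.⊔ j) (sym (ℤ.[+m]-[+n]≡m⊖n i j)) (ℤ.∣m⊝n∣≤m⊔n i j))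
                      (ℕ.⊔-pres-<m i<n j<n)
  ∣-<⇒≡0 : ∀ {a} → n ℕ.∣ a → a ℕ.< n → a ≡ 0
  ∣-<⇒≡0 {zero} _ _ = refl
  ∣-<⇒≡0 {suc a} d a<n = contradiction (∣⇒≤ d) (ℕ.<⇒≱ a<n)

mod⇒%ℕ≡ : ∀ {x y} n → x ≡ y mod (+ suc n) → x %ℕ suc n ≡ y %ℕ suc n
mod⇒%ℕ≡ {x} {y} n e = small-mod-unique (n%ℕd<d x (suc n)) (n%ℕd<d y (suc n))
  (mod-trans (mod-sym (≡%ℕ-mod x n)) (mod-trans e (≡%ℕ-mod y n)))

infix 4 _~_
-- The relation z = (-1)^n, with an integer exponent that matters only mod 2. Products of signs
-- thereby become sums of counts, which can be rearranged with the rules for sums.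
data _~_ : ℤ → ℤ → Set where
  even : ∀ {n} → n ≡ 0ℤ mod (+ 2) → 1ℤ ~ n
  odd  : ∀ {n} → n ≡ 1ℤ mod (+ 2) → -1ℤ ~ n

~-resp : ∀ {z m n} → z ~ m → m ≡ n mod (+ 2) → z ~ n
~-resp (even e) f = even (mod-trans (mod-sym f) e)
~-resp (odd e) f = odd (mod-trans (mod-sym f) e)

~-* : ∀ {z w m n} → z ~ m → w ~ n → z * w ~ m + n
~-* (even e) (even f) = even (mod-+ e f)
~-* (even e) (odd f) = odd (mod-+ e f)
~-* (odd e) (even f) = odd (mod-+ e f)
~-* (odd e) (odd f) = even (mod-trans (mod-+ e f) (mod-by 1ℤ refl))

¬0≡1mod2 : ¬ (0ℤ ≡ 1ℤ mod (+ 2))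
¬0≡1mod2 e with small-mod-unique {2} {0} {1} (ℕ.s≤s ℕ.z≤n) (ℕ.s≤s (ℕ.s≤s ℕ.z≤n)) e
... | ()

~-unique : ∀ {z w n} → z ~ n → w ~ n → z ≡ w
~-unique (even _) (even _) = refl
~-unique (even e) (odd f) = ⊥-elim (¬0≡1mod2 (mod-trans (mod-sym e) f))
~-unique (odd e) (even f) = ⊥-elim (¬0≡1mod2 (mod-trans (mod-sym f) e))
~-unique (odd _) (odd _) = refl

-- The way back from a sign to a polynomial expression: (-1)^n ≡ 1 - 2 n mod 4.
~-double : ∀ {z n} → z ~ n → + 2 * n ≡ 1ℤ - z mod (+ 4)
~-double (even e) = mod-scale (+ 2) e
~-double (odd e) = mod-scale (+ 2) e

opaque
  ∑ ∏ : ℕ → (ℕ → ℤ) → ℤ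
  ∑ n f = sum {n} (f ∘ toℕ)
  ∏ n f = prod {n} (f ∘ toℕ)

  ∑-cong : ∀ n {f g : ℕ → ℤ} → (∀ k → k ℕ.< n → f k ≡ g k) → ∑ n f ≡ ∑ n g
  ∑-cong n e = sum-cong-≗ (λ i → e (toℕ i) (toℕ<n i))

  ∑-ext : ∀ n {f g : ℕ → ℤ} → (∀ k → f k ≡ g k) → ∑ n f ≡ ∑ n g
  ∑-ext n e = ∑-cong n (λ k _ → e k)

  ∑-+ : ∀ n f g → ∑ n (λ k → f k + g k) ≡ ∑ n f + ∑ n g
  ∑-+ n f g = ∑-distrib-+ {n} (f ∘ toℕ) (g ∘ toℕ)

  ∑-*ˡ : ∀ n c f → ∑ n (λ k → c * f k) ≡ c * ∑ n f
  ∑-*ˡ n c f = sym (*-distribˡ-sum {n} c (f ∘ toℕ))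

  ∑-comm : ∀ m n (f : ℕ → ℕ → ℤ) → ∑ m (λ i → ∑ n (f i)) ≡ ∑ n (λ j → ∑ m (λ i → f i j))
  ∑-comm m n f = sum-comm {m} {n} (λ i j → f (toℕ i) (toℕ j))

  ∑-zero : ∀ n {f : ℕ → ℤ} → (∀ k → k ℕ.< n → f k ≡ 0ℤ) → ∑ n f ≡ 0ℤ
  ∑-zero zero e = refl
  ∑-zero (suc n) e = cong₂ _+_ (e 0 (ℕ.s≤s ℕ.z≤n)) (∑-zero n (λ k k<n → e (suc k) (ℕ.s≤s k<n)))

  ∑-const : ∀ n c → ∑ n (λ _ → c) ≡ + n * c
  ∑-const zero c = refl
  ∑-const (suc n) c = trans (cong (_+_ c) (∑-const n c)) (lem c (+ n))
    where lem : ∀ c m → c + m * c ≡ (1ℤ + m) * c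
          lem = solve-∀

  ∑-split : ∀ m n f → ∑ (m ℕ.+ n) f ≡ ∑ m f + ∑ n (λ k → f (m ℕ.+ k))
  ∑-split zero n f = sym (+-identityˡ _)
  ∑-split (suc m) n f = trans (cong (_+_ (f 0)) (∑-split m n (f ∘ suc))) (sym (+-assoc (f 0) _ _))

  ∑-last : ∀ n f → ∑ (suc n) f ≡ ∑ n f + f n
  ∑-last zero f = trans (+-identityʳ (f 0)) (sym (+-identityˡ (f 0)))
  ∑-last (suc n) f = trans (cong (_+_ (f 0)) (∑-last n (f ∘ suc))) (sym (+-assoc (f 0) _ _))

  ∑-pick : ∀ n {f : ℕ → ℤ} j → j ℕ.< n → (∀ k → k ℕ.< n → k ≢ j → f k ≡ 0ℤ) → ∑ n f ≡ f j
  ∑-pick (suc n) {f} zero _ e =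
    trans (cong (_+_ (f 0)) (∑-zero n (λ k k<n → e (suc k) (ℕ.s≤s k<n) λ ()))) (+-identityʳ (f 0))
  ∑-pick (suc n) {f} (suc j) (ℕ.s≤s j<n) e =
    trans (cong₂ _+_ (e 0 (ℕ.s≤s ℕ.z≤n) λ ())
                     (∑-pick n j j<n (λ k k<n k≢j → e (suc k) (ℕ.s≤s k<n) (k≢j ∘ ℕ.suc-injective))))
          (+-identityˡ _)

  ∑-mod : ∀ {m} n {f g : ℕ → ℤ} → (∀ k → k ℕ.< n → f k ≡ g k mod m) → ∑ n f ≡ ∑ n g mod m
  ∑-mod zero e = mod-refl
  ∑-mod (suc n) e = mod-+ (e 0 (ℕ.s≤s ℕ.z≤n)) (∑-mod n (λ k k<n → e (suc k) (ℕ.s≤s k<n)))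

  ∑-≥0-zero : ∀ n {f : ℕ → ℤ} → (∀ k → ∃ λ a → f k ≡ + a) → ∑ n f ≡ 0ℤ → ∀ k → k ℕ.< n → f k ≡ 0ℤ
  ∑-≥0-zero (suc n) {f} nn e k k<n = go k k<n
    where
    ∑≥0 : ∀ n {f : ℕ → ℤ} → (∀ k → ∃ λ a → f k ≡ + a) → ∃ λ a → ∑ n f ≡ + a
    ∑≥0 zero _ = 0 , refl
    ∑≥0 (suc n) nn = proj₁ (nn 0) ℕ.+ proj₁ (∑≥0 n (nn ∘ suc)) , cong₂ _+_ (proj₂ (nn 0)) (proj₂ (∑≥0 n (nn ∘ suc)))
    both : ∀ {x y} → (∃ λ a → x ≡ + a) → (∃ λ b → y ≡ + b) → x + y ≡ 0ℤ → x ≡ 0ℤ × y ≡ 0ℤ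
    both (zero , refl) (zero , refl) _ = refl , refl
    both (zero , refl) (suc b , refl) ()
    both (suc a , refl) (b , refl) ()
    split : f 0 ≡ 0ℤ × ∑ n (f ∘ suc) ≡ 0ℤ
    split = both (nn 0) (∑≥0 n (nn ∘ suc)) e
    go : ∀ k → k ℕ.< suc n → f k ≡ 0ℤ
    go zero _ = proj₁ split
    go (suc k) (ℕ.s≤s k<n) = ∑-≥0-zero n (nn ∘ suc) (proj₂ split) k k<n

  ∑-list : ∀ n f → ∑ n f ≡ sumℤ (applyUpTo f n)
  ∑-list zero f = refl
  ∑-list (suc n) f = cong (_+_ (f 0)) (∑-list n (f ∘ suc))

  ∑-empty : ∀ f → ∑ 0 f ≡ 0ℤ
  ∑-empty f = refl

  ∏-mod : ∀ {m} n {f g : ℕ → ℤ} → (∀ k → k ℕ.< n → f k ≡ g k mod m) → ∏ n f ≡ ∏ n g mod m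
  ∏-mod zero e = mod-refl
  ∏-mod (suc n) e = mod-* (e 0 (ℕ.s≤s ℕ.z≤n)) (∏-mod n (λ k k<n → e (suc k) (ℕ.s≤s k<n)))

  ∏-* : ∀ n f g → ∏ n (λ k → f k * g k) ≡ ∏ n f * ∏ n g
  ∏-* n f g = prod-distrib-* {n} (f ∘ toℕ) (g ∘ toℕ)

  ∏-const : ∀ n c → ∏ n (λ _ → c) ≡ c ℤ.^ n
  ∏-const zero c = refl
  ∏-const (suc n) c = cong (c *_) (∏-const n c)

  ∏-preserves : (A : ℤ → Set) → A 1ℤ → (∀ {x y} → A x → A y → A (x * y)) →
                ∀ n {f} → (∀ k → k ℕ.< n → A (f k)) → A (∏ n f)
  ∏-preserves A a1 a* zero e = a1
  ∏-preserves A a1 a* (suc n) e = a* (e 0 (ℕ.s≤s ℕ.z≤n)) (∏-preserves A a1 a* n (λ k k<n → e (suc k) (ℕ.s≤s k<n)))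

  ∏-permute : ∀ n f (σ τ : ℕ → ℕ) → (∀ i → i ℕ.< n → σ i ℕ.< n) → (∀ i → i ℕ.< n → τ i ℕ.< n) →
              (∀ i → i ℕ.< n → σ (τ i) ≡ i) → (∀ i → i ℕ.< n → τ (σ i) ≡ i) → ∏ n (f ∘ σ) ≡ ∏ n f
  ∏-permute n f σ τ σ< τ< στ τσ = trans
    (prod-cong-≗ (λ i → cong f (sym (toℕ-fromℕ< (σ< (toℕ i) (toℕ<n i))))))
    (sym (prod-permute {n} {n} (f ∘ toℕ) (permutation (fin σ σ<) (fin τ τ<) (inv σ τ σ< τ< στ) (inv τ σ τ< σ< τσ))))
    where
    fin : ∀ (σ : ℕ → ℕ) → (∀ i → i ℕ.< n → σ i ℕ.< n) → Fin n → Fin n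
    fin σ σ< i = fromℕ< (σ< (toℕ i) (toℕ<n i))
    inv : ∀ σ τ σ< τ< → (∀ i → i ℕ.< n → σ (τ i) ≡ i) → ∀ i → fin σ σ< (fin τ τ< i) ≡ i
    inv σ τ σ< τ< στ i = toℕ-injective (trans (toℕ-fromℕ< _) (trans (cong σ (toℕ-fromℕ< _)) (στ (toℕ i) (toℕ<n i))))

  ∏~∑ : ∀ n {f g : ℕ → ℤ} → (∀ k → k ℕ.< n → f k ~ g k) → ∏ n f ~ ∑ n g
  ∏~∑ zero e = even mod-refl
  ∏~∑ (suc n) e = ~-* (e 0 (ℕ.s≤s ℕ.z≤n)) (∏~∑ n (λ k k<n → e (suc k) (ℕ.s≤s k<n)))

-- Induction on the side of the square: the new row and the new column together form the last column
-- of the triangle, and the corner extends the diagonal.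
∑-square : ∀ n (W : ℕ → ℕ → ℤ) →
  ∑ n (λ i → ∑ n (W i)) ≡ ∑ n (λ j → ∑ j (λ i → W i j + W j i)) + ∑ n (λ i → W i i)
∑-square zero W = trans (∑-empty _) (sym (trans (cong₂ _+_ (∑-empty _) (∑-empty _)) refl))
∑-square (suc n) W = begin
  ∑ (suc n) (λ i → ∑ (suc n) (W i))
    ≡⟨ ∑-last n _ ⟩
  ∑ n (λ i → ∑ (suc n) (W i)) + ∑ (suc n) (W n)
    ≡⟨ cong₂ _+_ (trans (∑-ext n (λ i → ∑-last n (W i))) (∑-+ n _ _)) (∑-last n (W n)) ⟩
  (∑ n (λ i → ∑ n (W i)) + ∑ n (λ i → W i n)) + (∑ n (W n) + W n n)
    ≡⟨ cong (λ z → (z + C) + D) (∑-square n W) ⟩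
  ((A + B) + ∑ n (λ i → W i n)) + (∑ n (W n) + W n n)
    ≡⟨ lem A B _ _ _ ⟩
  (A + (∑ n (λ i → W i n) + ∑ n (W n))) + (B + W n n)
    ≡⟨ cong₂ _+_ (trans (∑-last n _) (cong (_+_ A) (∑-+ n _ _))) (∑-last n _) ⟨
  ∑ (suc n) (λ j → ∑ j (λ i → W i j + W j i)) + ∑ (suc n) (λ i → W i i) ∎
  where
  open ≡-Reasoning
  A = ∑ n (λ j → ∑ j (λ i → W i j + W j i))
  B = ∑ n (λ i → W i i)
  C = ∑ n (λ i → W i n)
  D = ∑ n (W n) + W n n
  lem : ∀ a b c d e → ((a + b) + c) + (d + e) ≡ (a + (c + d)) + (b + e)
  lem = solve-∀

-- The principle behind counting with an involution: off the diagonal the terms cancel in pairs mod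
-- 2.
∑-symmetric : ∀ n (W : ℕ → ℕ → ℤ) → (∀ i j → W i j ≡ W j i) →
  ∑ n (λ i → ∑ n (W i)) ≡ ∑ n (λ i → W i i) mod (+ 2)
∑-symmetric n W sy = mod-by Δ (begin
  ∑ n (λ i → ∑ n (W i)) - D                              ≡⟨ cong (_- D) (∑-square n W) ⟩
  ∑ n (λ j → ∑ j (λ i → W i j + W j i)) + D - D          ≡⟨ cong (λ z → z + D - D) twice ⟩
  + 2 * Δ + D - D                                        ≡⟨ lem Δ D ⟩
  Δ * + 2                                                ∎)
  where
  open ≡-Reasoning
  D = ∑ n (λ i → W i i)
  Δ = ∑ n (λ j → ∑ j (λ i → W i j))
  dbl : ∀ x → x + x ≡ + 2 * x
  dbl = solve-∀
  twice : ∑ n (λ j → ∑ j (λ i → W i j + W j i)) ≡ + 2 * Δ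
  twice = trans (∑-ext n (λ j → trans (∑-ext j (λ i → trans (cong (_+_ (W i j)) (sy j i)) (dbl (W i j)))) (∑-*ˡ j (+ 2) _)))
                (∑-*ˡ n (+ 2) _)
  lem : ∀ t d → + 2 * t + d - d ≡ t * + 2
  lem = solve-∀

half-split : ∀ n → ∃ λ e → n ≡ e ℕ.+ e ⊎ n ≡ suc (e ℕ.+ e)
half-split zero = 0 , inj₁ refl
half-split (suc n) with half-split n
... | e , inj₁ refl = e , inj₂ refl
... | e , inj₂ refl = suc e , inj₁ (cong suc (sym (ℕ.+-suc e e)))

double-≤ : ∀ {m n} → m ℕ.+ m ℕ.≤ n ℕ.+ n → m ℕ.≤ n
double-≤ {m} {n} le = ℕ.≮⇒≥ (λ n<m → ℕ.<⇒≱ (ℕ.+-mono-< n<m n<m) le)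

-- Functions of period 48

third-split : ∀ n → ∃ λ k → n ≡ k ℕ.+ (k ℕ.+ k) ⊎ n ≡ suc (k ℕ.+ (k ℕ.+ k)) ⊎ n ≡ suc (suc (k ℕ.+ (k ℕ.+ k)))
third-split zero = 0 , inj₁ refl
third-split (suc n) with third-split n
... | k , inj₁ refl = k , inj₂ (inj₁ refl)
... | k , inj₂ (inj₁ refl) = k , inj₂ (inj₂ refl)
... | k , inj₂ (inj₂ refl) = suc k , inj₁ (lem k)
  where lem : ∀ k → suc (suc (suc (k ℕ.+ (k ℕ.+ k)))) ≡ suc k ℕ.+ (suc k ℕ.+ suc k)
        lem = ℕ-solve-∀

/-quotient : ∀ r q d .{{_ : NonZero d}} → r ℕ.< d → (r ℕ.+ q ℕ.* d) ℕ./ d ≡ q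
/-quotient r q d r<d = trans (ℕ.+-distrib-/-∣ʳ r (ℕ-divides q refl)) (cong₂ ℕ._+_ (ℕ.m<n⇒m/n≡0 r<d) (ℕ.m*n/n≡m q d))

sgn : ℕ → ℤ
sgn n = -1ℤ ℤ.^ n

sgn~ : ∀ n → sgn n ~ + n
sgn~ zero = even mod-refl
sgn~ (suc n) = ~-* (odd mod-refl) (sgn~ n)

sgn-even-shift : ∀ n k → sgn (n ℕ.+ (k ℕ.+ k)) ≡ sgn n
sgn-even-shift n k = ~-unique (sgn~ (n ℕ.+ (k ℕ.+ k))) (~-resp (sgn~ n) (mod-sym (mod-by (+ k) (lem (+ n) (+ k)))))
  where lem : ∀ n k → n + (k + k) - n ≡ k * + 2
        lem = solve-∀

-- Raising n by 48 raises the quotient by 2 k, which is even. This works for d = 2, 4, 6 because 48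
-- is a multiple of 2 d each time.
sgn-/-periodic : ∀ c d .{{_ : NonZero d}} k → (∀ q → q ℕ.* 48 ≡ (q ℕ.* k ℕ.+ q ℕ.* k) ℕ.* d) →
  ∀ n → sgn ((n ℕ.+ c) ℕ./ d) ≡ sgn ((n ℕ.% 48 ℕ.+ c) ℕ./ d)
sgn-/-periodic c d k period n = trans (cong sgn quotient) (sgn-even-shift ((r ℕ.+ c) ℕ./ d) (q ℕ.* k))
  where
  r = n ℕ.% 48
  q = n ℕ./ 48
  lem : ∀ r x c → r ℕ.+ x ℕ.+ c ≡ r ℕ.+ c ℕ.+ x
  lem = ℕ-solve-∀
  quotient : (n ℕ.+ c) ℕ./ d ≡ (r ℕ.+ c) ℕ./ d ℕ.+ (q ℕ.* k ℕ.+ q ℕ.* k)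
  quotient = trans (cong (λ m → (m ℕ.+ c) ℕ./ d) (ℕ.m≡m%n+[m/n]*n n 48))
    (trans (cong (ℕ._/ d) (trans (lem r (q ℕ.* 48) c) (cong (r ℕ.+ c ℕ.+_) (period q))))
    (trans (ℕ.+-distrib-/-∣ʳ (r ℕ.+ c) (ℕ-divides (q ℕ.* k ℕ.+ q ℕ.* k) refl))
           (cong ((r ℕ.+ c) ℕ./ d ℕ.+_) (ℕ.m*n/n≡m (q ℕ.* k ℕ.+ q ℕ.* k) d))))

-- G (0, 1, 4) and G (0, 1, 9) mod 16, where r ≡ p mod 16, u = χ (-1), v = χ 2 and w = χ 3; the
-- factors 1ℤ are the values χ 1 and χ 4.
γ₄ γ₉ : ℤ → ℤ → ℤ → ℤ → ℤ
γ₄ r u v w = + 7 - r + + 2 * ((1ℤ + v) * (1ℤ + w)) + + 2 * ((1ℤ + u * v) * (1ℤ + u * 1ℤ)) + + 2 * ((1ℤ + u) * (1ℤ + 1ℤ * w))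
γ₉ r u v w = + 7 - r + + 2 * ((1ℤ + w) * (1ℤ + 1ℤ)) + + 2 * ((1ℤ + u * w) * (1ℤ + u * v)) + + 2 * ((1ℤ + u) * (1ℤ + v * 1ℤ))

-- Mod 16, eight times the number of nonresidues a s + b that occur with odd multiplicity, in terms
-- of g = G (0, - a, b), α = χ a, β = χ b and σ = χ (a + b).
countE : ℤ → ℤ → ℤ → ℤ → ℤ → ℤ → ℤ
countE r u g α β σ = r + 1ℤ + g - (1ℤ - u) * (1ℤ - β) - + 2 * (1ℤ - σ) - (1ℤ + u * α * β) * (1ℤ - u * α * σ)

-- Decodes (-1)^n from e ≡ 8 n mod 16; the meaningful residues are 0 and 8.
sign₁₆ : ℤ → ℤ
sign₁₆ e = if (e %ℕ 16) ℕ.≡ᵇ 0 then 1ℤ else -1ℤ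

sign₁₆-correct : ∀ {z n e} → z ~ n → + 8 * n ≡ e mod (+ 16) → z ≡ sign₁₆ e
sign₁₆-correct (even f) g = cong (λ k → if k ℕ.≡ᵇ 0 then 1ℤ else -1ℤ) (mod⇒%ℕ≡ {0ℤ} 15 (mod-trans (mod-sym (mod-scale (+ 8) f)) g))
sign₁₆-correct (odd f) g = cong (λ k → if k ℕ.≡ᵇ 0 then 1ℤ else -1ℤ) (mod⇒%ℕ≡ {+ 8} 15 (mod-trans (mod-sym (mod-scale (+ 8) f)) g))

-- For a = -1, 2, 3 the quotients p / 2, (p + 1) / 4 and (p + 1) / 6 count the multiples a, 2 a,
-- ..., a (p - 1) / 2 whose residue exceeds p / 2. By Gauss's lemma the three signs are therefore χ
-- (-1), χ 2 and χ 3.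
Explicit : (ℕ → ℤ) → Set
Explicit g = Σ (ℤ → ℤ → ℤ → ℤ → ℤ) λ Φ → ∀ p → PrimeGt3 p → g p ≡ Φ (+ (p ℕ.% 16)) (sgn (p ℕ./ 2)) (sgn ((p ℕ.+ 1) ℕ./ 4)) (sgn ((p ℕ.+ 1) ℕ./ 6))

period-48 : ∀ {g} → Explicit g → Σ (ℕ → ℤ) λ V → ∀ p → PrimeGt3 p → g p ≡ V (p ℕ.% 48)
period-48 {g} (Φ , eq) = V , λ p pp → trans (eq p pp) (reduce p)
  where
  V : ℕ → ℤ
  V p = Φ (+ (p ℕ.% 16)) (sgn (p ℕ./ 2)) (sgn ((p ℕ.+ 1) ℕ./ 4)) (sgn ((p ℕ.+ 1) ℕ./ 6))
  24* : ∀ q → q ℕ.* 48 ≡ (q ℕ.* 12 ℕ.+ q ℕ.* 12) ℕ.* 2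
  24* = ℕ-solve-∀
  6* : ∀ q → q ℕ.* 48 ≡ (q ℕ.* 6 ℕ.+ q ℕ.* 6) ℕ.* 4
  6* = ℕ-solve-∀
  4* : ∀ q → q ℕ.* 48 ≡ (q ℕ.* 4 ℕ.+ q ℕ.* 4) ℕ.* 6
  4* = ℕ-solve-∀
  half : ∀ p → sgn (p ℕ./ 2) ≡ sgn (p ℕ.% 48 ℕ./ 2)
  half p = subst₂ (λ m n → sgn (m ℕ./ 2) ≡ sgn (n ℕ./ 2)) (ℕ.+-identityʳ p) (ℕ.+-identityʳ (p ℕ.% 48)) (sgn-/-periodic 0 2 12 24* p)
  reduce : ∀ p → V p ≡ V (p ℕ.% 48)
  reduce p = trans (cong₂ (λ r x → Φ (+ r) x (sgn ((p ℕ.+ 1) ℕ./ 4)) (sgn ((p ℕ.+ 1) ℕ./ 6))) (sym (ℕ.m∣n⇒o%n%m≡o%m 16 48 p (ℕ-divides 3 refl))) (half p))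
                   (cong₂ (Φ (+ (p ℕ.% 48 ℕ.% 16)) (sgn (p ℕ.% 48 ℕ./ 2))) (sgn-/-periodic 1 4 6 6* p) (sgn-/-periodic 1 6 4 4* p))

explicit⇒periodic : ∀ {g} → Explicit g → Periodic g
explicit⇒periodic E = let (V , eq) = period-48 E in
  48 , ℕ.s≤s ℕ.z≤n , λ p₁ p₂ pp₁ pp₂ e → trans (eq p₁ pp₁) (trans (cong V e) (sym (eq p₂ pp₂)))

toℚ-+ : ∀ x y → toℚ (x + y) ≡ toℚ x ℚ.+ toℚ y
toℚ-+ x y = ℚ.toℚᵘ-injective (ℚᵘ.≃-trans (ℚ.toℚᵘ-fromℚᵘ (mkℚᵘ (x + y) 0))
  (ℚᵘ.≃-sym (ℚᵘ.≃-trans (ℚ.toℚᵘ-homo-+ (toℚ x) (toℚ y))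
    (ℚᵘ.≃-trans (ℚᵘ.+-cong (ℚ.toℚᵘ-fromℚᵘ (mkℚᵘ x 0)) (ℚ.toℚᵘ-fromℚᵘ (mkℚᵘ y 0))) (*≡* (lem x y))))))
  where lem : ∀ x y → (x * + 1 + y * + 1) * + 1 ≡ (x + y) * + 1
        lem = solve-∀

explicit⇒equivalent : ∀ {g k} → Explicit g → Explicit k → Equivalent g k
explicit⇒equivalent {g} {k} E F = let (V , eq) = period-48 E; (W , eq′) = period-48 F in
  48 , ℕ.s≤s ℕ.z≤n , λ r _ _ → 1ℚ , toℚ (V r - W r) , (λ ()) , λ p pp e → begin
    toℚ (g p)                              ≡⟨ cong toℚ (trans (eq p pp) (cong V e)) ⟩
    toℚ (V r)                              ≡⟨ cong toℚ (lem (V r) (W r)) ⟩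
    toℚ (W r + (V r - W r))                ≡⟨ toℚ-+ (W r) (V r - W r) ⟩
    toℚ (W r) ℚ.+ toℚ (V r - W r)          ≡⟨ cong (λ z → toℚ z ℚ.+ toℚ (V r - W r)) (trans (eq′ p pp) (cong W e)) ⟨
    toℚ (k p) ℚ.+ toℚ (V r - W r)          ≡⟨ cong (ℚ._+ toℚ (V r - W r)) (ℚ.*-identityˡ (toℚ (k p))) ⟨
    1ℚ ℚ.* toℚ (k p) ℚ.+ toℚ (V r - W r)   ∎
  where
  open ≡-Reasoning
  lem : ∀ x y → x ≡ y + (x - y)
  lem = solve-∀

form₁ form₂ form₃ form₄ form₅ form₆ form₇ form₈ : ℤ → ℤ → ℤ
form₁ i j = i * i + i * j + j * j
form₂ i j = i * i - i * j + j * j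
form₃ i j = + 2 * i * i + + 5 * i * j + + 2 * j * j
form₄ i j = + 2 * i * i - + 5 * i * j + + 2 * j * j
form₅ i j = + 4 * i * i - j * j
form₆ i j = + 9 * i * i - j * j
form₇ i j = + 3 * i * i + j * j
form₈ i j = + 8 * i * i + j * j

-- With p = 2 h + 1 the condition 0 < i < p/2 becomes an index below h, shifted by one.
module OddPrime (h : ℕ) (pr : Prime (suc (h ℕ.+ h))) (p>3 : 3 ℕ.< suc (h ℕ.+ h)) where

  -- The Legendre symbol

  p : ℕ
  p = suc (h ℕ.+ h)

  P : ℤ
  P = + p

  infix 4 _≋_ _≋?_
  _≋_ : ℤ → ℤ → Set
  x ≋ y = x ≡ y mod P

  _≋?_ : ∀ x y → Dec (x ≋ y)
  x ≋? y = Dec.map′ mk _≡_mod_.n∣x-y (P ∣? (x - y))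

  rep : ℤ → ℕ
  rep x = x %ℕ p

  rep<p : ∀ x → rep x ℕ.< p
  rep<p x = n%ℕd<d x p

  ≋rep : ∀ x → x ≋ + rep x
  ≋rep x = ≡%ℕ-mod x (h ℕ.+ h)

  ≋0⇒∣ : ∀ {x} → x ≋ 0ℤ → P ∣ x
  ≋0⇒∣ {x} (mk d) = subst (P ∣_) (+-identityʳ x) d

  ∣⇒≋0 : ∀ {x} → P ∣ x → x ≋ 0ℤ
  ∣⇒≋0 {x} d = mk (subst (P ∣_) (sym (+-identityʳ x)) d)

  *≋0 : ∀ x y → x * y ≋ 0ℤ → x ≋ 0ℤ ⊎ y ≋ 0ℤ
  *≋0 x y e = Sum.map (∣⇒≋0 ∘ ∣ᵤ⇒∣) (∣⇒≋0 ∘ ∣ᵤ⇒∣)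
    (euclidsLemma ℤ.∣ x ∣ ℤ.∣ y ∣ pr (subst (p ℕ.∣_) (abs-* x y) (∣⇒∣ᵤ (≋0⇒∣ e))))

  *≋0ʳ : ∀ x y → y ≋ 0ℤ → x * y ≋ 0ℤ
  *≋0ʳ x y e = mod-lin x e (lem x y)
    where lem : ∀ x y → x * y - 0ℤ ≡ x * (y - 0ℤ)
          lem = solve-∀

  *≋0ˡ : ∀ x y → x ≋ 0ℤ → x * y ≋ 0ℤ
  *≋0ˡ x y e = mod-lin y e (lem x y)
    where lem : ∀ x y → x * y - 0ℤ ≡ y * (x - 0ℤ)
          lem = solve-∀

  *≉0 : ∀ {x y} → ¬ x ≋ 0ℤ → ¬ y ≋ 0ℤ → ¬ x * y ≋ 0ℤ
  *≉0 {x} {y} nx ny e = Sum.[ nx , ny ]′ (*≋0 x y e)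

  -≋0⇒≋ : ∀ {x y} → x - y ≋ 0ℤ → x ≋ y
  -≋0⇒≋ {x} {y} z = mod-lin 1ℤ z (lem x y)
    where lem : ∀ x y → x - y ≡ 1ℤ * ((x - y) - 0ℤ)
          lem = solve-∀

  *-cancelˡ-≋ : ∀ {a x y} → ¬ a ≋ 0ℤ → a * x ≋ a * y → x ≋ y
  *-cancelˡ-≋ {a} {x} {y} na e =
    Sum.[ (λ z → contradiction z na) , -≋0⇒≋ ]′ (*≋0 a (x - y) (mod-lin 1ℤ e (lem a x y)))
    where lem : ∀ a x y → a * (x - y) - 0ℤ ≡ 1ℤ * (a * x - a * y)
          lem = solve-∀

  small≉0 : ∀ {k} → k ≢ 0 → k ℕ.< p → ¬ + k ≋ 0ℤ
  small≉0 k≢0 k<p e = k≢0 (small-mod-unique k<p (ℕ.s≤s ℕ.z≤n) e)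

  1≉0 : ¬ 1ℤ ≋ 0ℤ
  1≉0 = small≉0 (λ ()) (ℕ.<-trans (ℕ.s≤s (ℕ.s≤s ℕ.z≤n)) p>3)

  2≉0 : ¬ + 2 ≋ 0ℤ
  2≉0 = small≉0 (λ ()) (ℕ.<-trans (ℕ.s≤s (ℕ.s≤s (ℕ.s≤s ℕ.z≤n))) p>3)

  3≉0 : ¬ + 3 ≋ 0ℤ
  3≉0 = small≉0 (λ ()) p>3

  neg≋0 : ∀ x → - x ≋ 0ℤ → x ≋ 0ℤ
  neg≋0 x e = mod-lin -1ℤ e (lem x)
    where lem : ∀ x → x - 0ℤ ≡ -1ℤ * (- x - 0ℤ)
          lem = solve-∀

  inverse : ∀ x → ¬ x ≋ 0ℤ → ∃ λ y → x * y ≋ 1ℤ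
  inverse x nx with rep x | rep<p x | ≋rep x
  ... | zero | _ | e = contradiction e nx
  ... | r@(suc _) | r<p | e with coprime-Bézout (prime⇒coprime pr r<p)
  ... | Bézout.+- a b eq = - + b , mod-lin₂ (- + b) -1ℤ e (lem₀ a b eq) (lem x (+ r) (+ b))
    where
    lem₀ : ∀ a b → 1 ℕ.+ b ℕ.* r ≡ a ℕ.* p → 1ℤ + + b * + r ≋ 0ℤ
    lem₀ a b eq = mod-by (+ a) (trans (+-identityʳ _) (trans (cong (_+_ 1ℤ) (sym (ℤ.pos-* b r))) (trans (cong (ℤ.+_) eq) (ℤ.pos-* a p))))
    lem : ∀ x r b → x * (- b) - 1ℤ ≡ (- b) * (x - r) + -1ℤ * ((1ℤ + b * r) - 0ℤ)
    lem = solve-∀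
  ... | Bézout.-+ a b eq = + b , mod-lin₂ (+ b) 1ℤ e (lem₀ a b eq) (lem x (+ r) (+ b))
    where
    lem₁ : ∀ x → (1ℤ + x) - 1ℤ ≡ x
    lem₁ = solve-∀
    lem₀ : ∀ a b → 1 ℕ.+ a ℕ.* p ≡ b ℕ.* r → + b * + r ≋ 1ℤ
    lem₀ a b eq = mod-by (+ a) (trans (cong (_- 1ℤ) (trans (sym (ℤ.pos-* b r)) (sym (cong (ℤ.+_) eq))))
                        (trans (lem₁ (+ (a ℕ.* p))) (ℤ.pos-* a p)))
    lem : ∀ x r b → x * b - 1ℤ ≡ b * (x - r) + 1ℤ * (b * r - 1ℤ)
    lem = solve-∀

  -- Indicators and sums over the residues mod p

  opaque
    δ : ℤ → ℤ
    δ x with x ≋? 0ℤ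
    ... | yes _ = 1ℤ
    ... | no _ = 0ℤ

    δ-yes : ∀ {x} → x ≋ 0ℤ → δ x ≡ 1ℤ
    δ-yes {x} e with x ≋? 0ℤ
    ... | yes _ = refl
    ... | no n = contradiction e n

    δ-no : ∀ {x} → ¬ x ≋ 0ℤ → δ x ≡ 0ℤ
    δ-no {x} n with x ≋? 0ℤ
    ... | yes e = contradiction e n
    ... | no _ = refl

  δ-iff : ∀ {x y} → (x ≋ 0ℤ → y ≋ 0ℤ) → (y ≋ 0ℤ → x ≋ 0ℤ) → δ x ≡ δ y
  δ-iff {x} {y} f g with x ≋? 0ℤ
  ... | yes e = trans (δ-yes e) (sym (δ-yes (f e)))
  ... | no n = trans (δ-no n) (sym (δ-no (n ∘ g)))

  δ-resp : ∀ {x y} → x ≋ y → δ x ≡ δ y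
  δ-resp e = δ-iff (mod-trans (mod-sym e)) (mod-trans e)

  δ-unit : ∀ a x → ¬ a ≋ 0ℤ → δ (a * x) ≡ δ x
  δ-unit a x na = δ-iff (λ e → Sum.[ (λ z → contradiction z na) , id ]′ (*≋0 a x e)) (*≋0ʳ a x)

  δ-sep : ∀ x y → ¬ (x ≋ 0ℤ × y ≋ 0ℤ) → δ (x * y) ≡ δ x + δ y
  δ-sep x y n with x ≋? 0ℤ
  ... | yes e = trans (δ-yes (*≋0ˡ x y e)) (sym (cong₂ _+_ (δ-yes e) (δ-no (λ f → n (e , f)))))
  ... | no nx = trans (δ-unit x y nx) (sym (trans (cong (λ z → z + δ y) (δ-no nx)) (ℤ.+-identityˡ _)))

  δ-neg : ∀ x y → x ≡ - y → δ x ≡ δ y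
  δ-neg x y refl = δ-iff (neg≋0 y) (λ e → mod-neg e)

  Resp : (ℤ → ℤ) → Set
  Resp φ = ∀ {x y} → x ≋ y → φ x ≡ φ y

  opaque
    S : (ℤ → ℤ) → ℤ
    S φ = ∑ p (λ k → φ (+ k))

    S-ext : ∀ {φ ψ} → (∀ x → φ x ≡ ψ x) → S φ ≡ S ψ
    S-ext e = ∑-ext p (λ k → e (+ k))

    S-+ : ∀ φ ψ → S (λ x → φ x + ψ x) ≡ S φ + S ψ
    S-+ φ ψ = ∑-+ p _ _

    S-* : ∀ c φ → S (λ x → c * φ x) ≡ c * S φ
    S-* c φ = ∑-*ˡ p c _

    S-comm : ∀ (φ : ℤ → ℤ → ℤ) → S (λ x → S (φ x)) ≡ S (λ y → S (λ x → φ x y))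
    S-comm φ = ∑-comm p p (λ i j → φ (+ i) (+ j))

    S-zero : ∀ {φ} → (∀ x → φ x ≡ 0ℤ) → S φ ≡ 0ℤ
    S-zero e = ∑-zero p (λ k _ → e (+ k))

    S-≥0-zero : ∀ {φ} → Resp φ → (∀ x → ∃ λ a → φ x ≡ + a) → S φ ≡ 0ℤ → ∀ x → φ x ≡ 0ℤ
    S-≥0-zero φ-resp nn e x = trans (φ-resp (≋rep x)) (∑-≥0-zero p (λ k → nn (+ k)) e (rep x) (rep<p x))

    S-const : ∀ c → S (λ _ → c) ≡ P * c
    S-const = ∑-const p

    S-mod : ∀ {m φ ψ} → (∀ x → φ x ≡ ψ x mod m) → S φ ≡ S ψ mod m
    S-mod e = ∑-mod p (λ k _ → e (+ k))

    S-∑-comm : ∀ n (f : ℕ → ℤ → ℤ) → ∑ n (λ i → S (f i)) ≡ S (λ x → ∑ n (λ i → f i x))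
    S-∑-comm n f = ∑-comm n p (λ i j → f i (+ j))

    S-symmetric : ∀ (W : ℤ → ℤ → ℤ) → (∀ x y → W x y ≡ W y x) → S (λ x → S (W x)) ≡ S (λ x → W x x) mod (+ 2)
    S-symmetric W sy = ∑-symmetric p (λ i j → W (+ i) (+ j)) (λ i j → sy (+ i) (+ j))

    S-def : ∀ φ → S φ ≡ ∑ p (λ k → φ (+ k))
    S-def φ = refl

    S-pick : ∀ c {φ} → Resp φ → S (λ x → δ (x - c) * φ x) ≡ φ c
    S-pick c {φ} φ-resp = trans
      (∑-pick p (rep c) (rep<p c) (λ k k<p k≢r → cong (λ z → z * φ (+ k)) (δ-no (λ e → k≢r (small-mod-unique k<p (rep<p c)
          (mod-trans (mod-lin 1ℤ e (lem (+ k) c)) (≋rep c)))))))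
      (trans (cong₂ _*_ (δ-yes (mod-lin -1ℤ (≋rep c) (lem′ (+ rep c) c))) (φ-resp (mod-sym (≋rep c)))) (*-identityˡ _))
      where
      lem : ∀ k c → k - c ≡ 1ℤ * ((k - c) - 0ℤ)
      lem = solve-∀
      lem′ : ∀ r c → (r - c) - 0ℤ ≡ -1ℤ * (c - r)
      lem′ = solve-∀

  S-δ : ∀ c → S (λ x → δ (x - c)) ≡ 1ℤ
  S-δ c = trans (S-ext (λ x → sym (*-identityʳ _))) (S-pick c {λ _ → 1ℤ} (λ _ → refl))

  S-δ-linear : ∀ {a} c → ¬ a ≋ 0ℤ → S (λ x → δ (a * x + c)) ≡ 1ℤ
  S-δ-linear {a} c na with inverse a na
  ... | b , ab = trans (S-ext (λ x → δ-iff (to x) (from x))) (S-δ (- (b * c)))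
    where
    to : ∀ x → a * x + c ≋ 0ℤ → x - - (b * c) ≋ 0ℤ
    to x e = mod-lin₂ b (- x) e ab (lem a b c x)
      where lem : ∀ a b c x → (x - - (b * c)) - 0ℤ ≡ b * ((a * x + c) - 0ℤ) + (- x) * (a * b - 1ℤ)
            lem = solve-∀
    from : ∀ x → x - - (b * c) ≋ 0ℤ → a * x + c ≋ 0ℤ
    from x e = mod-lin₂ a (- c) e ab (lem a b c x)
      where lem : ∀ a b c x → (a * x + c) - 0ℤ ≡ a * ((x - - (b * c)) - 0ℤ) + (- c) * (a * b - 1ℤ)
            lem = solve-∀

  -- A change of variables without constructing a permutation: φ (a x + c) is spread over all y by
  -- an indicator, the sums are exchanged, and each y is then met by exactly one x.
  S-affine : ∀ {a φ} c → ¬ a ≋ 0ℤ → Resp φ → S (λ x → φ (a * x + c)) ≡ S φ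
  S-affine {a} {φ} c na φ-resp = begin
    S (λ x → φ (a * x + c))                              ≡⟨ S-ext (λ x → S-pick (a * x + c) φ-resp) ⟨
    S (λ x → S (λ y → δ (y - (a * x + c)) * φ y))        ≡⟨ S-comm _ ⟩
    S (λ y → S (λ x → δ (y - (a * x + c)) * φ y))        ≡⟨ S-ext inner ⟩
    S φ                                                  ∎
    where
    open ≡-Reasoning
    lem : ∀ a c x y → y - (a * x + c) ≡ - (a * x + (c - y))
    lem = solve-∀
    inner : ∀ y → S (λ x → δ (y - (a * x + c)) * φ y) ≡ φ y
    inner y = begin
      S (λ x → δ (y - (a * x + c)) * φ y)    ≡⟨ S-ext (λ x → trans (ℤ.*-comm _ (φ y)) (cong (_*_ (φ y)) (δ-neg _ _ (lem a c x y)))) ⟩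
      S (λ x → φ y * δ (a * x + (c - y)))    ≡⟨ S-* (φ y) _ ⟩
      φ y * S (λ x → δ (a * x + (c - y)))    ≡⟨ cong (_*_ (φ y)) (S-δ-linear (c - y) na) ⟩
      φ y * 1ℤ                               ≡⟨ *-identityʳ (φ y) ⟩
      φ y                                    ∎

  opaque
    χ : ℤ → ℤ
    χ x = legendre x p

    χ-def : ∀ x → legendre x p ≡ χ x
    χ-def x = refl

  -- Indexed by the value of χ, so that one case distinction replaces the symbol by 0, 1 or -1 and
  -- at the same time yields a root or its absence.
  data QR (x : ℤ) : ℤ → Set where
    zer : x ≋ 0ℤ → QR x 0ℤ
    res : ∀ r → ¬ x ≋ 0ℤ → r * r ≋ x → QR x 1ℤ
    non : ¬ x ≋ 0ℤ → (∀ r → ¬ r * r ≋ x) → QR x -1ℤ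

  opaque
    unfolding χ
    qr : ∀ x → QR x (χ x)
    qr x = go _ _ refl refl
      where
      is-root : ℕ → Bool
      is-root y = ((+ y * + y) %ℕ p) ℕ.≡ᵇ (x %ℕ p)
      go : ∀ b c → (x %ℕ p ℕ.≡ᵇ 0) ≡ b → any is-root (range1 (h ℕ.+ h)) ≡ c →
           QR x (if b then + 0 else if c then + 1 else - (+ 1))
      go true c e _ = zer (subst (λ r → x ≋ + r) (ℕ.≡ᵇ⇒≡ (rep x) 0 (subst T (sym e) tt)) (≋rep x))
      go false true e f with Any.satisfied (any⁻ is-root (range1 (h ℕ.+ h)) (subst T (sym f) tt))
      ... | y , t = res (+ y) (λ z → subst T e (ℕ.≡⇒≡ᵇ _ _ (mod⇒%ℕ≡ (h ℕ.+ h) z)))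
                        (mod-trans (≋rep _) (mod-trans (≡⇒mod (cong (ℤ.+_) (ℕ.≡ᵇ⇒≡ _ _ t))) (mod-sym (≋rep x))))
      go false false e f = non nx noroot
        where
        nx : ¬ x ≋ 0ℤ
        nx z = subst T e (ℕ.≡⇒≡ᵇ _ _ (mod⇒%ℕ≡ (h ℕ.+ h) z))
        -- The search in `legendre` covers 1, ..., p - 1, so a root is reduced mod p first; the
        -- residue 0 would give x ≡ 0.
        noroot : ∀ r → ¬ r * r ≋ x
        noroot r rr with rep r | rep<p r | ≋rep r
        ... | zero | _ | z = nx (mod-trans (mod-sym rr) (*≋0ˡ r r z))
        ... | suc y | ℕ.s≤s y<p | z = subst T f (any⁺ is-root (lose (∈-map⁺ suc (∈-upTo⁺ y<p))
                (ℕ.≡⇒≡ᵇ _ _ (mod⇒%ℕ≡ (h ℕ.+ h) (mod-trans (mod-sym (mod-* z z)) rr)))))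

  QR-unique : ∀ {x y v w} → QR x v → QR y w → x ≋ y → v ≡ w
  QR-unique (zer _) (zer _) e = refl
  QR-unique (zer z) (res _ n _) e = contradiction (mod-trans (mod-sym e) z) n
  QR-unique (zer z) (non n _) e = contradiction (mod-trans (mod-sym e) z) n
  QR-unique (res _ n _) (zer z) e = contradiction (mod-trans e z) n
  QR-unique (res _ _ _) (res _ _ _) e = refl
  QR-unique (res r _ q) (non _ n) e = contradiction (mod-trans q e) (n r)
  QR-unique (non n _) (zer z) e = contradiction (mod-trans e z) n
  QR-unique (non _ n) (res r _ q) e = contradiction (mod-trans q (mod-sym e)) (n r)
  QR-unique (non _ _) (non _ _) e = refl

  χ-unique : ∀ {x v} → QR x v → χ x ≡ v
  χ-unique q = QR-unique (qr _) q mod-refl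

  χ-resp : Resp χ
  χ-resp e = QR-unique (qr _) (qr _) e

  χ-zero : ∀ {x} → x ≋ 0ℤ → χ x ≡ 0ℤ
  χ-zero z = χ-unique (zer z)

  χ-square : ∀ r → ¬ r ≋ 0ℤ → χ (r * r) ≡ 1ℤ
  χ-square r nr = χ-unique (res r (*≉0 nr nr) mod-refl)

  δ-square : ∀ x r → ¬ r ≋ 0ℤ → δ (x * x - r * r) ≡ δ (x - r) + δ (x + r)
  δ-square x r nr = trans (cong δ (lem x r)) (δ-sep _ _ apart)
    where
    lem : ∀ x r → x * x - r * r ≡ (x - r) * (x + r)
    lem = solve-∀
    lem₂ : ∀ r x → + 2 * r - 0ℤ ≡ -1ℤ * ((x - r) - 0ℤ) + 1ℤ * ((x + r) - 0ℤ)
    lem₂ = solve-∀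
    apart : ¬ (x - r ≋ 0ℤ × x + r ≋ 0ℤ)
    apart (e , f) = Sum.[ 2≉0 , nr ]′ (*≋0 (+ 2) r (mod-lin₂ -1ℤ 1ℤ e f (lem₂ r x)))

  -- This ties χ to counting: 0 has one root, a residue has the two roots ± r, a nonresidue has
  -- none.
  S-square-roots : ∀ x → S (λ y → δ (y * y - x)) ≡ 1ℤ + χ x
  S-square-roots x with χ x | qr x
  ... | _ | zer z = trans (S-ext (λ y → δ-iff (to y) (from y))) (S-δ 0ℤ)
    where
    to : ∀ y → y * y - x ≋ 0ℤ → y - 0ℤ ≋ 0ℤ
    to y e = mod-lin 1ℤ (Sum.[ id , id ]′ (*≋0 y y (mod-lin₂ 1ℤ 1ℤ e z (lem x y)))) (lem′ y)
      where lem : ∀ x y → y * y - 0ℤ ≡ 1ℤ * ((y * y - x) - 0ℤ) + 1ℤ * (x - 0ℤ)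
            lem = solve-∀
            lem′ : ∀ y → (y - 0ℤ) - 0ℤ ≡ 1ℤ * (y - 0ℤ)
            lem′ = solve-∀
    from : ∀ y → y - 0ℤ ≋ 0ℤ → y * y - x ≋ 0ℤ
    from y e = mod-lin₂ y -1ℤ e z (lem x y)
      where lem : ∀ x y → (y * y - x) - 0ℤ ≡ y * ((y - 0ℤ) - 0ℤ) + -1ℤ * (x - 0ℤ)
            lem = solve-∀
  ... | _ | res r nx q = trans (S-ext factor) (trans (S-+ _ _) (cong₂ _+_ (S-δ r) (S-δ (- r))))
    where
    lem : ∀ x y r → (y * y - x) - (y * y - r * r) ≡ 1ℤ * (r * r - x)
    lem = solve-∀
    factor : ∀ y → δ (y * y - x) ≡ δ (y - r) + δ (y - - r)
    factor y = trans (δ-resp (mod-lin 1ℤ q (lem x y r)))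
      (trans (δ-square y r (λ z → nx (mod-trans (mod-sym q) (*≋0ˡ r r z))))
             (cong (λ z → δ (y - r) + δ (y + z)) (sym (ℤ.neg-involutive r))))
  ... | _ | non nx n = S-zero (λ y → δ-no (λ e → n y (mod-lin 1ℤ e (lem x y))))
    where lem : ∀ x k → k * k - x ≡ 1ℤ * ((k * k - x) - 0ℤ)
          lem = solve-∀

  -- Each y is a square root of exactly one x, so the numbers 1 + χ x add up to p.
  S-χ : S χ ≡ 0ℤ
  S-χ = ∙-cancelˡ (S (λ _ → 1ℤ)) (S χ) 0ℤ (begin
    S (λ _ → 1ℤ) + S χ                     ≡⟨ S-+ _ _ ⟨
    S (λ x → 1ℤ + χ x)                     ≡⟨ S-ext S-square-roots ⟨
    S (λ x → S (λ y → δ (y * y - x)))      ≡⟨ S-comm _ ⟩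
    S (λ y → S (λ x → δ (y * y - x)))      ≡⟨ S-ext (λ y → trans (S-ext (λ x → δ-neg _ _ (lem (y * y) x))) (S-δ (y * y))) ⟩
    S (λ _ → 1ℤ)                           ≡⟨ +-identityʳ _ ⟨
    S (λ _ → 1ℤ) + 0ℤ                      ∎)
    where
    open ≡-Reasoning
    lem : ∀ a x → a - x ≡ - (x - a)
    lem = solve-∀

  χ-square-* : ∀ r x → ¬ r ≋ 0ℤ → χ (r * r * x) ≡ χ x
  χ-square-* r x nr with χ x | qr x
  ... | _ | zer z = χ-zero (*≋0ʳ (r * r) x z)
  ... | _ | res s nx q = χ-unique (res (r * s) (*≉0 (*≉0 nr nr) nx) (mod-lin (r * r) q (lem r s x)))
    where lem : ∀ r s x → r * s * (r * s) - r * r * x ≡ r * r * (s * s - x)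
          lem = solve-∀
  ... | _ | non nx n with inverse r nr
  ... | b , rb = χ-unique (non (*≉0 (*≉0 nr nr) nx) (λ t e → n (b * t) (mod-lin₂ (b * b) (x * (r * b + 1ℤ)) e rb (lem r b t x))))
    where lem : ∀ r b t x → b * t * (b * t) - x ≡ b * b * (t * t - r * r * x) + x * (r * b + 1ℤ) * (r * b - 1ℤ)
          lem = solve-∀

  -- A nonresidue a satisfies χ x + χ (a x) ≤ 0 for every x, because a times a residue is a
  -- nonresidue; the sum over x vanishes, so every term does.
  χ-* : ∀ a x → χ (a * x) ≡ χ a * χ x
  χ-* a x with χ a in χa | qr a
  ... | _ | zer z = χ-zero (*≋0ˡ a x z)
  ... | _ | res r na q = trans (trans (χ-resp (mod-* (mod-sym q) (mod-refl {x = x}))) (χ-square-* r x nr)) (sym (*-identityˡ _))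
    where
    nr : ¬ r ≋ 0ℤ
    nr z = na (mod-trans (mod-sym q) (*≋0ˡ r r z))
  ... | _ | non na n = trans (flip (χ x) (χ (a * x)) (vanish x)) (sym (ℤ.-1*i≡-i (χ x)))
    where
    open ≡-Reasoning
    flip : ∀ u v → - (u + v) ≡ 0ℤ → v ≡ - u
    flip u v e = trans (lem u v) (trans (cong (λ z → - z - u) e) (ℤ.+-identityˡ (- u)))
      where lem : ∀ u v → v ≡ - (- (u + v)) - u
            lem = solve-∀
    g : ℤ → ℤ
    g y = - (χ y + χ (a * y))
    total : S g ≡ 0ℤ
    total = begin
      S g                                          ≡⟨ S-ext (λ y → sym (ℤ.-1*i≡-i (χ y + χ (a * y)))) ⟩
      S (λ y → -1ℤ * (χ y + χ (a * y)))            ≡⟨ S-* -1ℤ _ ⟩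
      -1ℤ * S (λ y → χ y + χ (a * y))              ≡⟨ cong (_*_ -1ℤ) (S-+ _ _) ⟩
      -1ℤ * (S χ + S (λ y → χ (a * y)))            ≡⟨ cong (λ z → -1ℤ * (S χ + z)) (S-ext (λ y → cong χ (sym (+-identityʳ (a * y))))) ⟩
      -1ℤ * (S χ + S (λ y → χ (a * y + 0ℤ)))       ≡⟨ cong (λ z → -1ℤ * (S χ + z)) (S-affine 0ℤ na χ-resp) ⟩
      -1ℤ * (S χ + S χ)                            ≡⟨ cong (λ z → -1ℤ * (z + z)) S-χ ⟩
      0ℤ                                           ∎
    nonneg : ∀ y → ∃ λ m → g y ≡ + m
    nonneg y with χ y | qr y
    ... | _ | zer z = 0 , cong (λ v → - (0ℤ + v)) (χ-zero (*≋0ʳ a y z))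
    ... | _ | res s ny q = 0 , cong (λ v → - (1ℤ + v)) (trans (χ-resp eq) (trans (χ-square-* s a ns) χa))
      where
      ns : ¬ s ≋ 0ℤ
      ns z = ny (mod-trans (mod-sym q) (*≋0ˡ s s z))
      eq : a * y ≋ s * s * a
      eq = mod-lin (- a) q (lem a s y)
        where lem : ∀ a s y → a * y - s * s * a ≡ (- a) * (s * s - y)
              lem = solve-∀
    ... | _ | non ny _ with χ (a * y) | qr (a * y)
    ... | _ | zer _ = 1 , refl
    ... | _ | res _ _ _ = 0 , refl
    ... | _ | non _ _ = 2 , refl
    g-resp : Resp g
    g-resp {y} {z} e = cong₂ (λ u v → - (u + v)) (χ-resp e) (χ-resp (mod-* (mod-refl {x = a}) e))
    vanish : ∀ y → g y ≡ 0ℤ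
    vanish y = S-≥0-zero g-resp nonneg total y

  -- Character sums

  S-shift : ∀ {φ} c → Resp φ → S (λ x → φ (x + c)) ≡ S φ
  S-shift {φ} c r = trans (S-ext (λ x → cong (λ z → φ (z + c)) (sym (*-identityˡ x)))) (S-affine c 1≉0 r)

  S-scale : ∀ {φ a} → ¬ a ≋ 0ℤ → Resp φ → S (λ x → φ (a * x)) ≡ S φ
  S-scale {φ} {a} na r = trans (S-ext (λ x → cong φ (sym (+-identityʳ (a * x))))) (S-affine 0ℤ na r)

  -1≉0 : ¬ -1ℤ ≋ 0ℤ
  -1≉0 e = 1≉0 (neg≋0 1ℤ e)

  S-neg : ∀ {φ} → Resp φ → S (λ x → φ (- x)) ≡ S φ
  S-neg {φ} r = trans (S-ext (λ x → cong φ (sym (ℤ.-1*i≡-i x)))) (S-scale -1≉0 r)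

  -- Linear combinations as data: an expansion with many terms is summed by one use of `S-comb`
  -- rather than by nested uses of `S-+` and `S-*`.
  comb : List (ℤ × (ℤ → ℤ)) → ℤ → ℤ
  comb [] x = 0ℤ
  comb ((c , f) ∷ L) x = c * f x + comb L x

  combS : List (ℤ × (ℤ → ℤ)) → ℤ
  combS [] = 0ℤ
  combS ((c , f) ∷ L) = c * S f + combS L

  S-comb : ∀ L → S (comb L) ≡ combS L
  S-comb [] = S-zero (λ _ → refl)
  S-comb ((c , f) ∷ L) = trans (S-+ _ _) (cong₂ _+_ (S-* c f) (S-comb L))

  S-pick⁻ : ∀ c {φ} → Resp φ → S (λ x → δ (x + c) * φ x) ≡ φ (- c)
  S-pick⁻ c {φ} r = trans (S-ext (λ x → cong (λ z → δ (x + z) * φ x) (sym (ℤ.neg-involutive c)))) (S-pick (- c) r)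

  +-resp : ∀ {x y} c → x ≋ y → x + c ≋ y + c
  +-resp c e = mod-+ e mod-refl

  χ1 : χ 1ℤ ≡ 1ℤ
  χ1 = χ-square 1ℤ 1≉0

  S-χ-shift : ∀ c → S (λ x → χ (x + c)) ≡ 0ℤ
  S-χ-shift c = trans (S-shift c χ-resp) S-χ

  -- For x ≠ 0 with inverse y, χ (x (x + c)) = χ (1 + c y).
  S-χ-quadratic : ∀ c → ¬ c ≋ 0ℤ → S (λ x → χ (x * (x + c))) ≡ -1ℤ
  S-χ-quadratic c nc = begin
    S (λ x → χ (x * (x + c)))                              ≡⟨ S-ext inverted ⟩
    S (λ x → S (λ y → δ (x * y - 1ℤ) * χ (c * y + 1ℤ)))    ≡⟨ S-comm _ ⟩
    S (λ y → S (λ x → δ (x * y - 1ℤ) * χ (c * y + 1ℤ)))    ≡⟨ S-ext count ⟩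
    S (λ y → χ (c * y + 1ℤ) + -1ℤ * (δ (y - 0ℤ) * χ (c * y + 1ℤ)))
      ≡⟨ trans (S-+ _ _) (cong₂ _+_ (trans (S-affine 1ℤ nc χ-resp) S-χ) (S-* -1ℤ _)) ⟩
    0ℤ + -1ℤ * S (λ y → δ (y - 0ℤ) * χ (c * y + 1ℤ))
      ≡⟨ cong (λ z → 0ℤ + -1ℤ * z) (trans (S-pick 0ℤ r) (trans (cong (λ z → χ (z + 1ℤ)) (ℤ.*-zeroʳ c)) χ1)) ⟩
    -1ℤ ∎
    where
    open ≡-Reasoning
    r : Resp (λ y → χ (c * y + 1ℤ))
    r e = χ-resp (+-resp 1ℤ (mod-* (mod-refl {x = c}) e))
    inverted : ∀ x → χ (x * (x + c)) ≡ S (λ y → δ (x * y - 1ℤ) * χ (c * y + 1ℤ))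
    inverted x with x ≋? 0ℤ
    ... | yes z = trans (χ-zero (*≋0ˡ x (x + c) z)) (sym (S-zero (λ y → cong (_* χ (c * y + 1ℤ)) (δ-no (no-inv y)))))
      where
      lem : ∀ x y → 1ℤ - 0ℤ ≡ -1ℤ * ((x * y - 1ℤ) - 0ℤ) + y * (x - 0ℤ)
      lem = solve-∀
      no-inv : ∀ y → ¬ x * y - 1ℤ ≋ 0ℤ
      no-inv y e = 1≉0 (mod-lin₂ -1ℤ y e z (lem x y))
    ... | no nx with inverse x nx
    ... | b , xb = sym (begin
      S (λ y → δ (x * y - 1ℤ) * χ (c * y + 1ℤ))   ≡⟨ S-ext (λ y → cong (_* χ (c * y + 1ℤ)) (trans (δ-resp (mod-lin 1ℤ xb (lem₁ x b y))) (δ-unit x (y - b) nx))) ⟩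
      S (λ y → δ (y - b) * χ (c * y + 1ℤ))        ≡⟨ S-pick b r ⟩
      χ (c * b + 1ℤ)                              ≡⟨ χ-square-* x (c * b + 1ℤ) nx ⟨
      χ (x * x * (c * b + 1ℤ))                    ≡⟨ χ-resp (mod-lin (x * c) xb (lem₂ x b c)) ⟩
      χ (x * (x + c))                             ∎)
      where
      lem₁ : ∀ x b y → (x * y - 1ℤ) - x * (y - b) ≡ 1ℤ * (x * b - 1ℤ)
      lem₁ = solve-∀
      lem₂ : ∀ x b c → x * x * (c * b + 1ℤ) - x * (x + c) ≡ x * c * (x * b - 1ℤ)
      lem₂ = solve-∀
    -- Every y other than 0 is the inverse of exactly one x. The missing term at y = 0 is χ 1 = 1,
    -- and it turns the full sum 0 into -1.
    count : ∀ y → S (λ x → δ (x * y - 1ℤ) * χ (c * y + 1ℤ)) ≡ χ (c * y + 1ℤ) + -1ℤ * (δ (y - 0ℤ) * χ (c * y + 1ℤ))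
    count y = trans (S-ext (λ x → ℤ.*-comm _ (χ (c * y + 1ℤ)))) (trans (S-* (χ (c * y + 1ℤ)) _)
                    (trans (cong (_*_ (χ (c * y + 1ℤ))) inner) (lem (χ (c * y + 1ℤ)) (δ (y - 0ℤ)))))
      where
      lem : ∀ a d → a * (1ℤ - d) ≡ a + -1ℤ * (d * a)
      lem = solve-∀
      lem₁ : ∀ x y → 1ℤ - 0ℤ ≡ -1ℤ * ((x * y - 1ℤ) - 0ℤ) + x * (y - 0ℤ)
      lem₁ = solve-∀
      inner : S (λ x → δ (x * y - 1ℤ)) ≡ 1ℤ - δ (y - 0ℤ)
      inner with y ≋? 0ℤ
      ... | yes z = trans (S-zero (λ x → δ-no (λ e → 1≉0 (mod-lin₂ -1ℤ x e z (lem₁ x y)))))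
                          (sym (cong (_-_ 1ℤ) (δ-yes (mod-trans (≡⇒mod (+-identityʳ y)) z))))
      ... | no ny = trans (S-ext (λ x → cong (λ z → δ (z - 1ℤ)) (ℤ.*-comm x y)))
                          (trans (S-δ-linear -1ℤ ny) (sym (cong (_-_ 1ℤ) (δ-no (λ e → ny (mod-trans (≡⇒mod (sym (+-identityʳ y))) e))))))

  S-χχ : ∀ a b → ¬ b - a ≋ 0ℤ → S (λ x → χ (x + a) * χ (x + b)) ≡ -1ℤ
  S-χχ a b n = begin
    S (λ x → χ (x + a) * χ (x + b))                     ≡⟨ S-ext (λ x → trans (sym (χ-* (x + a) (x + b))) (cong (λ z → χ ((x + a) * z)) (lem a b x))) ⟩
    S (λ x → χ ((x + a) * ((x + a) + (b - a))))         ≡⟨ S-shift a (λ e → χ-resp (mod-* e (+-resp (b - a) e))) ⟩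
    S (λ x → χ (x * (x + (b - a))))                     ≡⟨ S-χ-quadratic (b - a) n ⟩
    -1ℤ                                                 ∎
    where
    open ≡-Reasoning
    lem : ∀ a b x → x + b ≡ (x + a) + (b - a)
    lem = solve-∀

  G : ℤ → ℤ → ℤ → ℤ
  G a b c = S (λ x → χ (x + a) * χ (x + b) * χ (x + c))

  -- Equal to 1 + ε χ y for y ≢ 0 and to 0 for y ≡ 0. For a sign ε this is twice the indicator of χ
  -- y = ε.
  Q : ℤ → ℤ → ℤ
  Q ε y = χ y * χ y + ε * χ y

  Q-resp : ∀ ε → Resp (Q ε)
  Q-resp ε e = cong (λ v → v * v + ε * v) (χ-resp e)

  Q-δ : ∀ ε y → Q ε y ≡ (1ℤ + ε * χ y) - δ y
  Q-δ ε y with χ y | qr y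
  ... | _ | zer z = trans (lem ε) (cong (_-_ (1ℤ + ε * 0ℤ)) (sym (δ-yes z)))
    where lem : ∀ ε → 0ℤ * 0ℤ + ε * 0ℤ ≡ (1ℤ + ε * 0ℤ) - 1ℤ
          lem = solve-∀
  ... | _ | res _ n _ = trans (lem ε) (cong (_-_ (1ℤ + ε * 1ℤ)) (sym (δ-no n)))
    where lem : ∀ ε → 1ℤ * 1ℤ + ε * 1ℤ ≡ (1ℤ + ε * 1ℤ) - 0ℤ
          lem = solve-∀
  ... | _ | non n _ = trans (lem ε) (cong (_-_ (1ℤ + ε * -1ℤ)) (sym (δ-no n)))
    where lem : ∀ ε → -1ℤ * -1ℤ + ε * -1ℤ ≡ (1ℤ + ε * -1ℤ) - 0ℤ
          lem = solve-∀

  δδ : ∀ x a b → ¬ b - a ≋ 0ℤ → δ (x + a) * δ (x + b) ≡ 0ℤ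
  δδ x a b n with (x + a) ≋? 0ℤ
  ... | no na = cong (_* δ (x + b)) (δ-no na)
  ... | yes z = trans (cong (_*_ (δ (x + a))) (δ-no (λ e → n (mod-lin₂ 1ℤ -1ℤ e z (lem x a b))))) (ℤ.*-zeroʳ (δ (x + a)))
    where lem : ∀ x a b → (b - a) - 0ℤ ≡ 1ℤ * ((x + b) - 0ℤ) + -1ℤ * ((x + a) - 0ℤ)
          lem = solve-∀

  -- Up to the points where a factor vanishes, the summand is ∏ (1 + εᵢ χ (x + aᵢ)).
  S-QQQ : ∀ e₁ e₂ e₃ a b c → ¬ b - a ≋ 0ℤ → ¬ c - a ≋ 0ℤ → ¬ c - b ≋ 0ℤ →
    S (λ x → Q e₁ (x + a) * Q e₂ (x + b) * Q e₃ (x + c)) ≡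
    P - (e₁ * e₂ + e₁ * e₃ + e₂ * e₃) + e₁ * e₂ * e₃ * G a b c
      - (1ℤ + e₂ * χ (- a + b)) * (1ℤ + e₃ * χ (- a + c))
      - (1ℤ + e₁ * χ (- b + a)) * (1ℤ + e₃ * χ (- b + c))
      - (1ℤ + e₁ * χ (- c + a)) * (1ℤ + e₂ * χ (- c + b))
  S-QQQ e₁ e₂ e₃ a b c nba nca ncb = begin
    S (λ x → Q e₁ (x + a) * Q e₂ (x + b) * Q e₃ (x + c))  ≡⟨ S-ext pointwise ⟩
    S (comb terms)                                        ≡⟨ S-comb terms ⟩
    combS terms                                           ≡⟨ sums ⟩
    _ ∎
    where
    open ≡-Reasoning
    L : ℤ → ℤ → ℤ → ℤ
    L e d x = 1ℤ + e * χ (x + d)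
    L-resp : ∀ e d → Resp (L e d)
    L-resp e d z = cong (λ v → 1ℤ + e * v) (χ-resp (+-resp d z))
    terms : List (ℤ × (ℤ → ℤ))
    terms = (1ℤ , λ _ → 1ℤ)
          ∷ (e₁ , λ x → χ (x + a)) ∷ (e₂ , λ x → χ (x + b)) ∷ (e₃ , λ x → χ (x + c))
          ∷ (e₁ * e₂ , λ x → χ (x + a) * χ (x + b)) ∷ (e₁ * e₃ , λ x → χ (x + a) * χ (x + c))
          ∷ (e₂ * e₃ , λ x → χ (x + b) * χ (x + c)) ∷ (e₁ * e₂ * e₃ , λ x → χ (x + a) * χ (x + b) * χ (x + c))
          ∷ (-1ℤ , λ x → δ (x + a) * (L e₂ b x * L e₃ c x)) ∷ (-1ℤ , λ x → δ (x + b) * (L e₁ a x * L e₃ c x))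
          ∷ (-1ℤ , λ x → δ (x + c) * (L e₁ a x * L e₂ b x)) ∷ []
    -- Each term of the last line contains two of the indicators d₁, d₂, d₃ of the distinct points
    -- -a, -b, -c, so `vanish` can drop that line.
    ring : ∀ e₁ e₂ e₃ x y z d₁ d₂ d₃ →
      ((1ℤ + e₁ * x) - d₁) * ((1ℤ + e₂ * y) - d₂) * ((1ℤ + e₃ * z) - d₃) ≡
      (1ℤ * 1ℤ + (e₁ * x + (e₂ * y + (e₃ * z + (e₁ * e₂ * (x * y) + (e₁ * e₃ * (x * z) + (e₂ * e₃ * (y * z)
        + (e₁ * e₂ * e₃ * (x * y * z) + (-1ℤ * (d₁ * ((1ℤ + e₂ * y) * (1ℤ + e₃ * z)))
        + (-1ℤ * (d₂ * ((1ℤ + e₁ * x) * (1ℤ + e₃ * z))) + (-1ℤ * (d₃ * ((1ℤ + e₁ * x) * (1ℤ + e₂ * y))) + 0ℤ)))))))))))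
      + ((d₁ * d₂) * ((1ℤ + e₃ * z) - d₃) + (d₁ * d₃) * (1ℤ + e₂ * y) + (d₂ * d₃) * (1ℤ + e₁ * x))
    ring = solve-∀
    vanish : ∀ {r s t} k l m w → r ≡ 0ℤ → s ≡ 0ℤ → t ≡ 0ℤ → w + (r * k + s * l + t * m) ≡ w
    vanish k l m w refl refl refl = +-identityʳ w
    pointwise : ∀ x → Q e₁ (x + a) * Q e₂ (x + b) * Q e₃ (x + c) ≡ comb terms x
    pointwise x = trans (cong₂ _*_ (cong₂ _*_ (Q-δ e₁ (x + a)) (Q-δ e₂ (x + b))) (Q-δ e₃ (x + c)))
      (trans (ring e₁ e₂ e₃ (χ (x + a)) (χ (x + b)) (χ (x + c)) (δ (x + a)) (δ (x + b)) (δ (x + c)))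
             (vanish _ _ _ _ (δδ x a b nba) (δδ x a c nca) (δδ x b c ncb)))
    collect : ∀ p e₁ e₂ e₃ g k l m →
      1ℤ * (p * 1ℤ) + (e₁ * 0ℤ + (e₂ * 0ℤ + (e₃ * 0ℤ + (e₁ * e₂ * -1ℤ + (e₁ * e₃ * -1ℤ + (e₂ * e₃ * -1ℤ
        + (e₁ * e₂ * e₃ * g + (-1ℤ * k + (-1ℤ * l + (-1ℤ * m + 0ℤ))))))))))
      ≡ p - (e₁ * e₂ + e₁ * e₃ + e₂ * e₃) + e₁ * e₂ * e₃ * g - k - l - m
    collect = solve-∀
    infixr 5 _·_⊕_
    _·_⊕_ : ∀ {x y r s} k → x ≡ y → r ≡ s → k * x + r ≡ k * y + s
    k · refl ⊕ refl = refl
    sums : combS terms ≡ _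
    sums = trans
      (1ℤ · S-const 1ℤ ⊕ e₁ · S-χ-shift a ⊕ e₂ · S-χ-shift b ⊕ e₃ · S-χ-shift c
       ⊕ e₁ * e₂ · S-χχ a b nba ⊕ e₁ * e₃ · S-χχ a c nca ⊕ e₂ * e₃ · S-χχ b c ncb ⊕ e₁ * e₂ * e₃ · refl
       ⊕ -1ℤ · S-pick⁻ a (λ z → cong₂ _*_ (L-resp e₂ b z) (L-resp e₃ c z))
       ⊕ -1ℤ · S-pick⁻ b (λ z → cong₂ _*_ (L-resp e₁ a z) (L-resp e₃ c z))
       ⊕ -1ℤ · S-pick⁻ c (λ z → cong₂ _*_ (L-resp e₁ a z) (L-resp e₂ b z)) ⊕ refl)
      (collect P e₁ e₂ e₃ (G a b c) _ _ _)

  G-swap₁₂ : ∀ a b c → G a b c ≡ G b a c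
  G-swap₁₂ a b c = S-ext (λ x → cong (_* χ (x + c)) (ℤ.*-comm (χ (x + a)) (χ (x + b))))

  G-swap₂₃ : ∀ a b c → G a b c ≡ G a c b
  G-swap₂₃ a b c = S-ext (λ x → lem (χ (x + a)) (χ (x + b)) (χ (x + c)))
    where lem : ∀ x y z → x * y * z ≡ x * z * y
          lem = solve-∀

  G-resp : ∀ a b c → Resp (λ x → χ (x + a) * χ (x + b) * χ (x + c))
  G-resp a b c e = cong₂ _*_ (cong₂ _*_ (χ-resp (+-resp a e)) (χ-resp (+-resp b e))) (χ-resp (+-resp c e))

  G-shift : ∀ d a b c → G (a + d) (b + d) (c + d) ≡ G a b c
  G-shift d a b c = trans
    (S-ext (λ x → cong₂ _*_ (cong₂ _*_ (cong χ (lem x a d)) (cong χ (lem x b d))) (cong χ (lem x c d))))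
    (S-shift d (G-resp a b c))
    where lem : ∀ x a d → x + (a + d) ≡ (x + d) + a
          lem = solve-∀

  χ-neg : ∀ x → χ (- x) ≡ χ -1ℤ * χ x
  χ-neg x = trans (cong χ (sym (ℤ.-1*i≡-i x))) (χ-* -1ℤ x)

  χ-sign : ∀ {x} → ¬ x ≋ 0ℤ → χ x ≡ 1ℤ ⊎ χ x ≡ -1ℤ
  χ-sign {x} n with χ x | qr x
  ... | _ | zer z = contradiction z n
  ... | _ | res _ _ _ = inj₁ refl
  ... | _ | non _ _ = inj₂ refl

  -- Substituting - x extracts χ (-1) from each of the three factors, and the cube of a sign is the
  -- sign itself.
  G-neg : ∀ a b c → G (- a) (- b) (- c) ≡ χ -1ℤ * G a b c
  G-neg a b c = begin
    G (- a) (- b) (- c)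
      ≡⟨ S-neg (G-resp (- a) (- b) (- c)) ⟨
    S (λ x → χ (- x - a) * χ (- x - b) * χ (- x - c))
      ≡⟨ S-ext (λ x → trans (cong₂ _*_ (cong₂ _*_ (flip x a) (flip x b)) (flip x c)) (cube (χ-sign -1≉0) _ _ _)) ⟩
    S (λ x → χ -1ℤ * (χ (x + a) * χ (x + b) * χ (x + c)))
      ≡⟨ S-* (χ -1ℤ) _ ⟩
    χ -1ℤ * G a b c ∎
    where
    open ≡-Reasoning
    lem : ∀ x a → - x - a ≡ - (x + a)
    lem = solve-∀
    flip : ∀ x a → χ (- x - a) ≡ χ -1ℤ * χ (x + a)
    flip x a = trans (cong χ (lem x a)) (χ-neg (x + a))
    cube : ∀ {u} → u ≡ 1ℤ ⊎ u ≡ -1ℤ → ∀ x y z → u * x * (u * y) * (u * z) ≡ u * (x * y * z)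
    cube (inj₁ refl) = lem₁
      where lem₁ : ∀ x y z → 1ℤ * x * (1ℤ * y) * (1ℤ * z) ≡ 1ℤ * (x * y * z)
            lem₁ = solve-∀
    cube (inj₂ refl) = lem₂
      where lem₂ : ∀ x y z → -1ℤ * x * (-1ℤ * y) * (-1ℤ * z) ≡ -1ℤ * (x * y * z)
            lem₂ = solve-∀

  -- Triples of squares and G (0, 1, m²) mod 16

  pos neg : ℤ → ℤ
  pos (+ 1) = 1ℤ
  pos _ = 0ℤ
  neg ℤ.-[1+ 0 ] = 1ℤ
  neg _ = 0ℤ

  2pos : ∀ x → + 2 * pos (χ x) ≡ Q 1ℤ x
  2pos x with χ x | qr x
  ... | _ | zer _ = refl
  ... | _ | res _ _ _ = refl
  ... | _ | non _ _ = refl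

  2neg : ∀ x → + 2 * neg (χ x) ≡ Q -1ℤ x
  2neg x with χ x | qr x
  ... | _ | zer _ = refl
  ... | _ | res _ _ _ = refl
  ... | _ | non _ _ = refl

  -- The involution x ↦ m² / x preserves the set counted here, and its fixed points are ± m.
  module Triples (m : ℤ) (nm : ¬ m ≋ 0ℤ) where

    g : ℤ → ℤ
    g x = pos (χ x) * pos (χ (x + 1ℤ)) * pos (χ (x + m * m))

    g-resp : Resp g
    g-resp e = cong₂ _*_ (cong₂ _*_ (cong pos (χ-resp e)) (cong pos (χ-resp (+-resp 1ℤ e)))) (cong pos (χ-resp (+-resp (m * m) e)))

    -- If x y = m², then x (y + m²) = m² (x + 1), so χ x χ (y + m²) = χ (x + 1), and likewise with x
    -- and y exchanged. When χ x = χ y = 1, the second and third conditions merely trade places;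
    -- when both are -1, both sides vanish.
    g-invariant : ∀ x y → x * y - m * m ≋ 0ℤ → g x ≡ g y
    g-invariant x y e = compare (sym (χ-* x y)) (shifted x y e) (shifted y x (mod-trans (≡⇒mod (cong (_- m * m) (ℤ.*-comm y x))) e))
      where
      shifted : ∀ x y → x * y - m * m ≋ 0ℤ → χ x * χ (y + m * m) ≡ χ (x + 1ℤ)
      shifted x y e = trans (sym (χ-* x (y + m * m))) (trans (χ-resp (mod-lin 1ℤ e (lem m x y))) (χ-square-* m (x + 1ℤ) nm))
        where lem : ∀ m x y → x * (y + m * m) - m * m * (x + 1ℤ) ≡ 1ℤ * ((x * y - m * m) - 0ℤ)
              lem = solve-∀
      χxy : χ (x * y) ≡ 1ℤ
      χxy = trans (χ-resp (-≋0⇒≋ e)) (χ-square m nm)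
      compare : χ x * χ y ≡ χ (x * y) → χ x * χ (y + m * m) ≡ χ (x + 1ℤ) → χ y * χ (x + m * m) ≡ χ (y + 1ℤ) → g x ≡ g y
      compare with χ x | qr x | χ y | qr y
      ... | _ | zer _ | _ | _ = λ a → contradiction (trans a χxy) λ ()
      ... | _ | res _ _ _ | _ | zer _ = λ a → contradiction (trans a χxy) λ ()
      ... | _ | res _ _ _ | _ | res _ _ _ = λ _ b c →
        trans (cong₂ (λ v w → 1ℤ * pos v * pos w) (trans (sym b) (*-identityˡ _)) (trans (sym (*-identityˡ _)) c))
              (swap (pos (χ (y + m * m))) (pos (χ (y + 1ℤ))))
        where
        swap : ∀ v w → 1ℤ * v * w ≡ 1ℤ * w * v
        swap = solve-∀
      ... | _ | res _ _ _ | _ | non _ _ = λ a → contradiction (trans a χxy) λ ()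
      ... | _ | non _ _ | _ | zer _ = λ a → contradiction (trans a χxy) λ ()
      ... | _ | non _ _ | _ | res _ _ _ = λ a → contradiction (trans a χxy) λ ()
      ... | _ | non _ _ | _ | non _ _ = λ _ _ _ → refl

    -- `W` puts the weight g x on the graph of x ↦ m² / x and is symmetric by `g-invariant`, so mod
    -- 2 only the diagonal x² = m² survives. The point x = 0 has no partner, but g vanishes there.
    S-g : S g ≡ g m + g (- m) mod (+ 2)
    S-g = mod-trans (≡⇒mod (S-ext (λ x → sym (row x)))) (mod-trans (S-symmetric W W-sym) (≡⇒mod diagonal))
      where
      W : ℤ → ℤ → ℤ
      W x y = δ (x * y - m * m) * g x
      W-sym : ∀ x y → W x y ≡ W y x
      W-sym x y with (x * y - m * m) ≋? 0ℤ
      ... | yes e = cong₂ _*_ (cong (λ z → δ (z - m * m)) (ℤ.*-comm x y)) (g-invariant x y e)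
      ... | no n = trans (cong (_* g x) (δ-no n)) (sym (cong (_* g y) (trans (cong (λ z → δ (z - m * m)) (ℤ.*-comm y x)) (δ-no n))))
      row : ∀ x → S (W x) ≡ g x
      row x = trans (S-ext (λ y → ℤ.*-comm (δ (x * y - m * m)) (g x))) (trans (S-* (g x) _) inner)
        where
        inner : g x * S (λ y → δ (x * y - m * m)) ≡ g x
        inner with x ≋? 0ℤ
        ... | yes z = trans (cong (_* S (λ y → δ (x * y - m * m))) g0) (sym g0)
          where g0 : g x ≡ 0ℤ
                g0 = cong (λ v → pos v * pos (χ (x + 1ℤ)) * pos (χ (x + m * m))) (χ-zero z)
        ... | no nx = trans (cong (_*_ (g x)) (S-δ-linear (- (m * m)) nx)) (*-identityʳ (g x))
      diagonal : S (λ x → W x x) ≡ g m + g (- m)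
      diagonal = trans (S-ext (λ x → trans (cong (_* g x) (δ-square x m nm)) (ℤ.*-distribʳ-+ (g x) (δ (x - m)) (δ (x + m)))))
                       (trans (S-+ _ _) (cong₂ _+_ (S-pick m g-resp) (S-pick⁻ m g-resp)))

    8g : ∀ x → + 8 * g x ≡ Q 1ℤ x * Q 1ℤ (x + 1ℤ) * Q 1ℤ (x + m * m)
    8g x = trans (lem (pos (χ x)) (pos (χ (x + 1ℤ))) (pos (χ (x + m * m))))
                 (cong₂ _*_ (cong₂ _*_ (2pos x) (2pos (x + 1ℤ))) (2pos (x + m * m)))
      where lem : ∀ x y z → + 8 * (x * y * z) ≡ (+ 2 * x) * (+ 2 * y) * (+ 2 * z)
            lem = solve-∀

    S-QQQ-mod : S (λ x → Q 1ℤ (x + 0ℤ) * Q 1ℤ (x + 1ℤ) * Q 1ℤ (x + m * m))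
      ≡ Q 1ℤ m * Q 1ℤ (m + 1ℤ) * Q 1ℤ (m + m * m) + Q 1ℤ (- m) * Q 1ℤ (- m + 1ℤ) * Q 1ℤ (- m + m * m) mod (+ 16)
    S-QQQ-mod = mod-trans (≡⇒mod (trans (S-ext (λ x → trans (cong (λ z → Q 1ℤ z * Q 1ℤ (x + 1ℤ) * Q 1ℤ (x + m * m)) (+-identityʳ x)) (sym (8g x)))) (S-* (+ 8) g)))
      (mod-trans (mod-scale (+ 8) S-g) (≡⇒mod (trans (ℤ.*-distribˡ-+ (+ 8) (g m) (g (- m))) (cong₂ _+_ (8g m) (8g (- m))))))

  -- `S-QQQ` at the points 0, 1, m² is compared with the contribution of the fixed points ± m. In 7
  -- = 3 + 4, the 3 comes from the three quadratic sums, each -1, and the 4 is the boundary term at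
  -- x = 0. The boundary terms at -1 and -m² coincide, which gives the last summand its factor 2.
  G-square : ∀ m → ¬ m ≋ 0ℤ → ¬ m + 1ℤ ≋ 0ℤ → ¬ m - 1ℤ ≋ 0ℤ →
    G 0ℤ 1ℤ (m * m) ≡ + 7 - P + + 2 * ((1ℤ + χ m) * (1ℤ + χ (m + 1ℤ)))
      + + 2 * ((1ℤ + χ -1ℤ * χ m) * (1ℤ + χ -1ℤ * χ (m - 1ℤ)))
      + + 2 * ((1ℤ + χ -1ℤ) * (1ℤ + χ (m - 1ℤ) * χ (m + 1ℤ))) mod (+ 16)
  G-square m nm nm+1 nm-1 = mod-lin 1ℤ
      (mod-trans (≡⇒mod (sym (trans (S-QQQ 1ℤ 1ℤ 1ℤ 0ℤ 1ℤ (m * m) 1≉0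
          (λ e → *≉0 nm nm (mod-trans (≡⇒mod (sym (+-identityʳ (m * m)))) e))
          (λ e → *≉0 nm-1 nm+1 (mod-trans (≡⇒mod (sym (r4 m))) e))) left)))
        (mod-trans S-QQQ-mod (≡⇒mod right)))
      (lem (G 0ℤ 1ℤ (m * m)) P ((1ℤ + u) * (1ℤ + r * t)) _ _)
    where
    open Triples m nm
    s = χ m
    t = χ (m + 1ℤ)
    r = χ (m - 1ℤ)
    u = χ -1ℤ
    r1 : ∀ m → m + m * m ≡ m * (m + 1ℤ)
    r1 = solve-∀
    r2 : ∀ m → - m + m * m ≡ m * (m - 1ℤ)
    r2 = solve-∀
    r3 : ∀ m → - m + 1ℤ ≡ - (m - 1ℤ)
    r3 = solve-∀
    r4 : ∀ m → m * m - 1ℤ ≡ (m - 1ℤ) * (m + 1ℤ)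
    r4 = solve-∀
    r5 : ∀ m → - 1ℤ + m * m ≡ (m - 1ℤ) * (m + 1ℤ)
    r5 = solve-∀
    r6 : ∀ m → - (m * m) + 1ℤ ≡ - ((m - 1ℤ) * (m + 1ℤ))
    r6 = solve-∀
    r7 : ∀ x → - 0ℤ + x ≡ x
    r7 = solve-∀
    Sign : ℤ → Set
    Sign x = x ≡ 1ℤ ⊎ x ≡ -1ℤ
    sign-* : ∀ {x y} → Sign x → Sign y → Sign (x * y)
    sign-* (inj₁ refl) (inj₁ refl) = inj₁ refl
    sign-* (inj₁ refl) (inj₂ refl) = inj₂ refl
    sign-* (inj₂ refl) (inj₁ refl) = inj₂ refl
    sign-* (inj₂ refl) (inj₂ refl) = inj₁ refl
    us : Sign u
    us = χ-sign -1≉0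
    -- The third factor is redundant up to a 2: if x = y = 1, then also x y = 1. At x = m this
    -- reflects m + m² = m (m + 1), and at x = - m that - m + m² = m (m - 1).
    value : ∀ {x y} → Sign x → Sign y →
      (x * x + 1ℤ * x) * (y * y + 1ℤ * y) * (x * y * (x * y) + 1ℤ * (x * y)) ≡ + 2 * ((1ℤ + x) * (1ℤ + y))
    value (inj₁ refl) (inj₁ refl) = refl
    value (inj₁ refl) (inj₂ refl) = refl
    value (inj₂ refl) (inj₁ refl) = refl
    value (inj₂ refl) (inj₂ refl) = refl
    absorb : ∀ {x y} → Sign x → Sign y → (1ℤ + 1ℤ * x) * (1ℤ + 1ℤ * (x * y)) ≡ (1ℤ + x) * (1ℤ + y)
    absorb (inj₁ refl) (inj₁ refl) = refl
    absorb (inj₁ refl) (inj₂ refl) = refl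
    absorb (inj₂ refl) (inj₁ refl) = refl
    absorb (inj₂ refl) (inj₂ refl) = refl
    Q₃ : ∀ {a b c x y z} → a ≡ x → b ≡ y → c ≡ z →
      (a * a + 1ℤ * a) * (b * b + 1ℤ * b) * (c * c + 1ℤ * c) ≡ (x * x + 1ℤ * x) * (y * y + 1ℤ * y) * (z * z + 1ℤ * z)
    Q₃ refl refl refl = refl
    cancel-u : ∀ {u} → Sign u → ∀ s r → s * r ≡ u * s * (u * r)
    cancel-u (inj₁ refl) = c
      where c : ∀ s r → s * r ≡ 1ℤ * s * (1ℤ * r)
            c = solve-∀
    cancel-u (inj₂ refl) = c
      where c : ∀ s r → s * r ≡ -1ℤ * s * (-1ℤ * r)
            c = solve-∀
    right : Q 1ℤ m * Q 1ℤ (m + 1ℤ) * Q 1ℤ (m + m * m) + Q 1ℤ (- m) * Q 1ℤ (- m + 1ℤ) * Q 1ℤ (- m + m * m)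
      ≡ + 2 * ((1ℤ + s) * (1ℤ + t)) + + 2 * ((1ℤ + u * s) * (1ℤ + u * r))
    right = cong₂ _+_
      (trans (Q₃ {a = s} {b = t} refl refl (trans (cong χ (r1 m)) (χ-* m (m + 1ℤ)))) (value (χ-sign nm) (χ-sign nm+1)))
      (trans (Q₃ (χ-neg m) (trans (cong χ (r3 m)) (χ-neg (m - 1ℤ)))
                 (trans (trans (cong χ (r2 m)) (χ-* m (m - 1ℤ))) (cancel-u us s r)))
             (value (sign-* us (χ-sign nm)) (sign-* us (χ-sign nm-1))))
    L₂ : ∀ {a b x y} → a ≡ x → b ≡ y → (1ℤ + 1ℤ * a) * (1ℤ + 1ℤ * b) ≡ (1ℤ + 1ℤ * x) * (1ℤ + 1ℤ * y)
    L₂ refl refl = refl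
    rt : Sign (r * t)
    rt = sign-* (χ-sign nm-1) (χ-sign nm+1)
    base : ℤ
    base = P - (1ℤ * 1ℤ + 1ℤ * 1ℤ + 1ℤ * 1ℤ) + 1ℤ * 1ℤ * 1ℤ * G 0ℤ 1ℤ (m * m)
    same : ∀ {x y} → (1ℤ + 1ℤ * x) * (1ℤ + 1ℤ * y) ≡ (1ℤ + x) * (1ℤ + y)
    same {x} {y} = cong₂ (λ v w → (1ℤ + v) * (1ℤ + w)) (*-identityˡ x) (*-identityˡ y)
    left : _ ≡ base - + 4 - (1ℤ + u) * (1ℤ + r * t) - (1ℤ + u) * (1ℤ + r * t)
    left = cong₂ _-_ (cong₂ _-_ (cong (_-_ base)
        (L₂ (trans (cong χ (r7 1ℤ)) χ1) (trans (cong χ (r7 (m * m))) (χ-square m nm))))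
        (trans (L₂ {a = u} refl (trans (cong χ (r5 m)) (χ-* (m - 1ℤ) (m + 1ℤ)))) (same {u} {r * t})))
        (trans (L₂ (trans (cong χ (+-identityʳ (- (m * m)))) (trans (χ-neg (m * m)) (trans (cong (_*_ u) (χ-square m nm)) (*-identityʳ u))))
                   (trans (cong χ (r6 m)) (trans (χ-neg ((m - 1ℤ) * (m + 1ℤ))) (cong (_*_ u) (χ-* (m - 1ℤ) (m + 1ℤ))))))
               (absorb us rt))
    lem : ∀ g p a x y → g - (+ 7 - p + x + y + + 2 * a)
      ≡ 1ℤ * ((p - (1ℤ * 1ℤ + 1ℤ * 1ℤ + 1ℤ * 1ℤ) + 1ℤ * 1ℤ * 1ℤ * g - + 4 - a - a) - (x + y))
    lem = solve-∀

  -- Gauss's lemma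

  0<h : 0 ℕ.< h
  0<h = go h p>3
    where go : ∀ h → 3 ℕ.< suc (h ℕ.+ h) → 0 ℕ.< h
          go zero (ℕ.s≤s ())
          go (suc h) _ = ℕ.s≤s ℕ.z≤n

  <h⇒<p : ∀ {i} → i ℕ.< h → suc i ℕ.< p
  <h⇒<p i<h = ℕ.s≤s (ℕ.≤-trans i<h (ℕ.m≤m+n h h))

  suc≉0 : ∀ {i} → i ℕ.< h → ¬ + suc i ≋ 0ℤ
  suc≉0 i<h = small≉0 (λ ()) (<h⇒<p i<h)

  half-sum≉0 : ∀ {i j} → i ℕ.< h → j ℕ.< h → ¬ + suc i + + suc j ≋ 0ℤ
  half-sum≉0 i<h j<h = small≉0 (λ ()) (ℕ.s≤s (ℕ.+-mono-≤ i<h j<h))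

  half-unique : ∀ {i j} → i ℕ.< h → j ℕ.< h → + suc i ≋ + suc j → i ≡ j
  half-unique i<h j<h e = ℕ.suc-injective (small-mod-unique (<h⇒<p i<h) (<h⇒<p j<h) e)

  half-unique± : ∀ {i j} → i ℕ.< h → j ℕ.< h → + suc i ≋ + suc j ⊎ + suc i ≋ - + suc j → i ≡ j
  half-unique± i<h j<h (inj₁ e) = half-unique i<h j<h e
  half-unique± {i} {j} i<h j<h (inj₂ e) = contradiction (mod-lin 1ℤ e (lem (+ suc i) (+ suc j))) (half-sum≉0 i<h j<h)
    where lem : ∀ x y → (x + y) - 0ℤ ≡ 1ℤ * (x - - y)
          lem = solve-∀

  opaque
    -- 1 if the residue of x lies strictly between p/2 and p, and 0 otherwise.
    upper : ℤ → ℤ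
    upper x = ∑ h (λ i → δ (+ suc i + x))

    upper-def : ∀ x → upper x ≡ ∑ h (λ i → δ (+ suc i + x))
    upper-def x = refl

    upper-resp : Resp upper
    upper-resp e = ∑-ext h (λ i → δ-resp (mod-+ (mod-refl {x = + suc i}) e))

    upper-pos : ∀ {j} → j ℕ.< h → upper (+ suc j) ≡ 0ℤ
    upper-pos j<h = ∑-zero h (λ i i<h → δ-no (half-sum≉0 i<h j<h))

    upper-neg : ∀ {j} → j ℕ.< h → upper (- + suc j) ≡ 1ℤ
    upper-neg {j} j<h = trans
      (∑-pick h j j<h (λ i i<h i≢j → δ-no (λ e → i≢j (half-unique i<h j<h (-≋0⇒≋ e)))))
      (δ-yes (≡⇒mod (ℤ.+-inverseʳ (+ suc j))))

  -- Index of the representative ± (idx x + 1) of x among 1, ..., h up to sign. The value at x ≡ 0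
  -- is a default, which `idx-spec` excludes.
  idx : ℤ → ℕ
  idx x with rep x
  ... | zero = 0
  ... | suc y with y ℕ.<? h
  ...   | yes _ = y
  ...   | no _ = h ℕ.+ h ℕ.∸ suc y

  idx-spec : ∀ x → ¬ x ≋ 0ℤ → idx x ℕ.< h × (x ≋ + suc (idx x) ⊎ x ≋ - + suc (idx x))
  idx-spec x nx with rep x | rep<p x | ≋rep x
  ... | zero | _ | e = contradiction e nx
  ... | suc y | ℕ.s≤s y<2h | e with y ℕ.<? h
  ...   | yes y<h = y<h , inj₁ e
  ...   | no y≮h = smaller , inj₂ (mod-trans e (mod-by 1ℤ eq))
    where
    i = h ℕ.+ h ℕ.∸ suc y
    total : i ℕ.+ suc y ≡ h ℕ.+ h
    total = ℕ.m∸n+n≡m y<2h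
    smaller : i ℕ.< h
    smaller = ℕ.+-cancelʳ-< (suc y) i h (subst (ℕ._< h ℕ.+ suc y) (sym total) (ℕ.+-monoʳ-< h (ℕ.s≤s (ℕ.≮⇒≥ y≮h))))
    lem : ∀ y i → y - - (1ℤ + i) ≡ 1ℤ + (i + y)
    lem = solve-∀
    eq : + suc y - - + suc i ≡ 1ℤ * P
    eq = trans (lem (+ suc y) (+ i)) (trans (cong (λ z → + suc z) total) (sym (*-identityˡ P)))

  upper-sign : ∀ x → ¬ x ≋ 0ℤ → (1ℤ - + 2 * upper x) ~ upper x × (1ℤ - + 2 * upper x) * + suc (idx x) ≋ x
  upper-sign x nx with idx-spec x nx
  ... | i<h , inj₁ e = subst (λ u → (1ℤ - + 2 * u) ~ u × (1ℤ - + 2 * u) * + suc (idx x) ≋ x)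
    (sym (trans (upper-resp e) (upper-pos i<h))) (even mod-refl , mod-trans (≡⇒mod (*-identityˡ _)) (mod-sym e))
  ... | i<h , inj₂ e = subst (λ u → (1ℤ - + 2 * u) ~ u × (1ℤ - + 2 * u) * + suc (idx x) ≋ x)
    (sym (trans (upper-resp e) (upper-neg i<h))) (odd mod-refl , mod-trans (≡⇒mod (ℤ.-1*i≡-i (+ suc (idx x)))) (mod-sym e))

  -- The product of the signs with which a, 2 a, ..., h a reduce to elements of 1, ..., h.
  ψ : ℤ → ℤ
  ψ a = ∏ h (λ i → 1ℤ - + 2 * upper (a * + suc i))

  ψ~ : ∀ {a} → ¬ a ≋ 0ℤ → ψ a ~ ∑ h (λ i → upper (a * + suc i))
  ψ~ {a} na = ∏~∑ h (λ i i<h → proj₁ (upper-sign (a * + suc i) (*≉0 na (suc≉0 i<h))))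

  -- Gauss's argument: up to sign the numbers a, 2 a, ..., h a are a permutation of 1, ..., h, with
  -- inverse given by multiplication by 1/a. Comparing the products leaves a common factor h!, which
  -- is invertible.
  power≋ψ : ∀ {a} → ¬ a ≋ 0ℤ → a ℤ.^ h ≋ ψ a
  power≋ψ {a} na = *-cancelˡ-≋ {F} {a ℤ.^ h} {ψ a} nF (mod-trans (≡⇒mod lhs) (mod-trans (mod-sym signed) (≡⇒mod rhs)))
    where
    F = ∏ h (λ i → + suc i)
    nF : ¬ F ≋ 0ℤ
    nF = ∏-preserves (λ x → ¬ x ≋ 0ℤ) 1≉0 *≉0 h (λ i i<h → suc≉0 i<h)
    b = proj₁ (inverse a na)
    ab = proj₂ (inverse a na)
    nb : ¬ b ≋ 0ℤ
    nb e = 1≉0 (mod-trans (mod-sym ab) (*≋0ʳ a b e))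
    signed : ∏ h (λ i → (1ℤ - + 2 * upper (a * + suc i)) * + suc (idx (a * + suc i))) ≋ ∏ h (λ i → a * + suc i)
    signed = ∏-mod h (λ i i<h → proj₂ (upper-sign (a * + suc i) (*≉0 na (suc≉0 i<h))))
    lhs : F * a ℤ.^ h ≡ ∏ h (λ i → a * + suc i)
    lhs = sym (trans (∏-* h (λ _ → a) (λ i → + suc i)) (trans (cong (_* F) (∏-const h a)) (ℤ.*-comm (a ℤ.^ h) F)))
    scaled : ∀ c → ¬ c ≋ 0ℤ → ∀ i → i ℕ.< h → idx (c * + suc i) ℕ.< h
    scaled c nc i i<h = proj₁ (idx-spec (c * + suc i) (*≉0 nc (suc≉0 i<h)))
    -- Multiplying by d and then by c = 1/d, with reduction up to sign after each, leads back to ±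
    -- (i + 1), and i + 1 is the only representative of this class.
    undo : ∀ c d → c * d ≋ 1ℤ → ¬ c ≋ 0ℤ → ¬ d ≋ 0ℤ → ∀ i → i ℕ.< h → idx (c * + suc (idx (d * + suc i))) ≡ i
    undo c d cd nc nd i i<h = sym (half-unique± i<h (scaled c nc j (scaled d nd i i<h))
        (combine (proj₂ (idx-spec (d * + suc i) (*≉0 nd (suc≉0 i<h)))) (proj₂ (idx-spec (c * + suc j) (*≉0 nc (suc≉0 (scaled d nd i i<h)))))))
      where
      j = idx (d * + suc i)
      k = idx (c * + suc j)
      back : ∀ {y} → d * + suc i ≋ y → + suc i ≋ c * y
      back {y} e = mod-lin₂ (- + suc i) c cd e (lem c d (+ suc i) y)
        where lem : ∀ c d x y → x - c * y ≡ (- x) * (c * d - 1ℤ) + c * (d * x - y)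
              lem = solve-∀
      neg-* : ∀ c y → c * - y ≡ - (c * y)
      neg-* = solve-∀
      combine : (d * + suc i ≋ + suc j ⊎ d * + suc i ≋ - + suc j) → (c * + suc j ≋ + suc k ⊎ c * + suc j ≋ - + suc k) →
                + suc i ≋ + suc k ⊎ + suc i ≋ - + suc k
      combine (inj₁ e) (inj₁ f) = inj₁ (mod-trans (back e) f)
      combine (inj₁ e) (inj₂ f) = inj₂ (mod-trans (back e) f)
      combine (inj₂ e) (inj₁ f) = inj₂ (mod-trans (back e) (mod-trans (≡⇒mod (neg-* c (+ suc j))) (mod-neg f)))
      combine (inj₂ e) (inj₂ f) = inj₁ (mod-trans (back e) (mod-trans (≡⇒mod (neg-* c (+ suc j)))
                                    (mod-trans (mod-neg f) (≡⇒mod (ℤ.neg-involutive (+ suc k))))))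
    rhs : ∏ h (λ i → (1ℤ - + 2 * upper (a * + suc i)) * + suc (idx (a * + suc i))) ≡ F * ψ a
    rhs = trans (∏-* h _ _) (trans (cong (_*_ (ψ a)) (∏-permute h (λ i → + suc i) (λ i → idx (a * + suc i)) (λ i → idx (b * + suc i))
        (scaled a na) (scaled b nb) (undo a b ab na nb) (undo b a (mod-trans (≡⇒mod (ℤ.*-comm b a)) ab) nb na))) (ℤ.*-comm (ψ a) F))

  -- Monic polynomials, given by their non-leading coefficients from the constant term up.
  eval : List ℤ → ℤ → ℤ
  eval [] x = 1ℤ
  eval (c ∷ cs) x = c + x * eval cs x

  -- Synthetic division by x - r: the coefficients of the quotient are the Horner values at r. The
  -- empty list is the constant polynomial 1.
  quot : ℤ → ℤ → List ℤ → List ℤ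
  quot r c [] = []
  quot r c (d ∷ ds) = eval (d ∷ ds) r ∷ quot r d ds

  length-quot : ∀ r c cs → length (quot r c cs) ≡ length cs
  length-quot r c [] = refl
  length-quot r c (d ∷ ds) = cong suc (length-quot r d ds)

  eval-quot : ∀ r c cs x → eval (c ∷ cs) x - eval (c ∷ cs) r ≡ (x - r) * eval (quot r c cs) x
  eval-quot r c [] x = lem c r x
    where lem : ∀ c r x → (c + x * 1ℤ) - (c + r * 1ℤ) ≡ (x - r) * 1ℤ
          lem = solve-∀
  eval-quot r c (d ∷ ds) x = trans (lem₁ c r x (eval (d ∷ ds) x) (eval (d ∷ ds) r))
      (trans (cong (λ z → (x - r) * eval (d ∷ ds) r + x * z) (eval-quot r d ds x)) (lem₂ r x (eval (d ∷ ds) r) (eval (quot r d ds) x)))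
    where
    lem₁ : ∀ c r x e f → (c + x * e) - (c + r * f) ≡ (x - r) * f + x * (e - f)
    lem₁ = solve-∀
    lem₂ : ∀ r x f q → (x - r) * f + x * ((x - r) * q) ≡ (x - r) * (f + x * q)
    lem₂ = solve-∀

  -- Lagrange's bound by induction on the degree l: the largest root n is divided out, and the
  -- smaller ones remain roots of the quotient because they differ from n mod p.
  root-bound : ∀ l cs n → length cs ≡ l → l ℕ.< n → n ℕ.< p → ¬ (∀ k → k ℕ.< n → eval cs (+ suc k) ≋ 0ℤ)
  root-bound zero [] (suc n) _ _ _ roots = 1≉0 (roots 0 (ℕ.s≤s ℕ.z≤n))
  root-bound (suc l) (c ∷ cs) (suc n) refl (ℕ.s≤s l<n) n<p roots =
    root-bound l (quot r c cs) n (length-quot r c cs) l<n (ℕ.<-trans (ℕ.n<1+n n) n<p) roots′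
    where
    r = + suc n
    roots′ : ∀ k → k ℕ.< n → eval (quot r c cs) (+ suc k) ≋ 0ℤ
    roots′ k k<n = Sum.[ (λ e → contradiction (ℕ.suc-injective (small-mod-unique (ℕ.<-trans (ℕ.s≤s k<n) n<p) n<p (-≋0⇒≋ e))) (ℕ.<⇒≢ k<n)) , id ]′
      (*≋0 (+ suc k - r) (eval (quot r c cs) (+ suc k))
        (mod-trans (≡⇒mod (sym (eval-quot r c cs (+ suc k)))) (mod-- (roots k (ℕ.m<n⇒m<1+n k<n)) (roots n (ℕ.n<1+n n)))))

  eval-power : ∀ n x → eval (replicate n 0ℤ) x ≡ x ℤ.^ n
  eval-power zero x = refl
  eval-power (suc n) x = trans (ℤ.+-identityˡ _) (cong (x *_) (eval-power n x))

  -- Otherwise the monic polynomial x^h - 1 of degree h would vanish at 1, ..., h + 1, which are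
  -- distinct and nonzero mod p since h > 0.
  not-all-powers-1 : ¬ (∀ a → ¬ a ≋ 0ℤ → a ℤ.^ h ≋ 1ℤ)
  not-all-powers-1 all = go h 0<h refl
    where
    go : ∀ k → 0 ℕ.< k → k ≡ h → ⊥
    go (suc k) _ refl = root-bound h (-1ℤ ∷ replicate k 0ℤ) (suc h) (cong suc (length-replicate k)) (ℕ.n<1+n h)
      (ℕ.s≤s (ℕ.m<m+n h 0<h))
      (λ i i<h+1 → mod-lin 1ℤ (all (+ suc i) (small≉0 (λ ()) (ℕ.s≤s (ℕ.≤-trans i<h+1 (ℕ.m<m+n h 0<h)))))
         (trans (cong (λ z → -1ℤ + + suc i * z - 0ℤ) (eval-power k (+ suc i))) (lem (+ suc i * (+ suc i) ℤ.^ k))))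
      where lem : ∀ x → -1ℤ + x - 0ℤ ≡ 1ℤ * (x - 1ℤ)
            lem = solve-∀

  ^-resp : ∀ n {x y} → x ≋ y → x ℤ.^ n ≋ y ℤ.^ n
  ^-resp zero e = mod-refl
  ^-resp (suc n) e = mod-* e (^-resp n e)

  ^-* : ∀ n x y → (x * y) ℤ.^ n ≡ x ℤ.^ n * y ℤ.^ n
  ^-* zero x y = refl
  ^-* (suc n) x y = trans (cong (x * y *_) (^-* n x y)) (lem x y (x ℤ.^ n) (y ℤ.^ n))
    where lem : ∀ x y a b → x * y * (a * b) ≡ (x * a) * (y * b)
          lem = solve-∀

  sign-values : ∀ {z n} → z ~ n → z ≡ 1ℤ ⊎ z ≡ -1ℤ
  sign-values (even _) = inj₁ refl
  sign-values (odd _) = inj₂ refl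

  -- From a = r² follows a^h = (r^h)² = (ψ r)² = 1, so `power≋ψ` does the work of Fermat's theorem.
  residue-power : ∀ a → χ a ≡ 1ℤ → a ℤ.^ h ≋ 1ℤ
  residue-power a e with χ a | qr a
  ... | _ | res r na q = mod-trans (^-resp h (mod-sym q)) (mod-trans (≡⇒mod (^-* h r r))
      (mod-trans (mod-* (power≋ψ nr) (power≋ψ nr)) (square (sign-values (ψ~ nr)))))
    where
    nr : ¬ r ≋ 0ℤ
    nr z = na (mod-trans (mod-sym q) (*≋0ˡ r r z))
    square : ∀ {x} → x ≡ 1ℤ ⊎ x ≡ -1ℤ → x * x ≋ 1ℤ
    square (inj₁ refl) = mod-refl
    square (inj₂ refl) = mod-refl
  residue-power a () | _ | zer _
  residue-power a () | _ | non _ _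

  -- Euler's criterion without a primitive root. The hard case is a nonresidue a with a^h = 1: for
  -- any nonresidue b the product a b is a residue, so b^h = (a b)^h = 1, and all h-th powers would
  -- be 1.
  χ≡ψ : ∀ {a} → ¬ a ≋ 0ℤ → χ a ≡ ψ a
  χ≡ψ {a} na = decide (χ-sign na) (sign-values (ψ~ na))
    where
    1≉-1 : ¬ 1ℤ ≋ -1ℤ
    1≉-1 e = 2≉0 (mod-lin 1ℤ e refl)
    decide : χ a ≡ 1ℤ ⊎ χ a ≡ -1ℤ → ψ a ≡ 1ℤ ⊎ ψ a ≡ -1ℤ → χ a ≡ ψ a
    decide (inj₁ e) (inj₁ f) = trans e (sym f)
    decide (inj₂ e) (inj₂ f) = trans e (sym f)
    decide (inj₁ e) (inj₂ f) = contradiction (mod-trans (mod-sym (residue-power a e)) (mod-trans (power≋ψ na) (≡⇒mod f))) 1≉-1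
    decide (inj₂ e) (inj₁ f) = contradiction every not-all-powers-1
      where
      a^h : a ℤ.^ h ≋ 1ℤ
      a^h = mod-trans (power≋ψ na) (≡⇒mod f)
      every : ∀ b → ¬ b ≋ 0ℤ → b ℤ.^ h ≋ 1ℤ
      every b nb with χ-sign nb
      ... | inj₁ g = residue-power b g
      ... | inj₂ g = mod-trans (mod-trans (≡⇒mod (sym (*-identityˡ _))) (mod-* (mod-sym a^h) mod-refl))
          (mod-trans (≡⇒mod (sym (^-* h a b))) (residue-power (a * b) (trans (χ-* a b) (cong₂ _*_ e g))))

  gauss : ∀ {a} → ¬ a ≋ 0ℤ → χ a ~ ∑ h (λ i → upper (a * + suc i))
  gauss {a} na = subst (_~ ∑ h (λ i → upper (a * + suc i))) (sym (χ≡ψ na)) (ψ~ na)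

  upper-low : ∀ {y} → y ≢ 0 → y ℕ.≤ h → upper (+ y) ≡ 0ℤ
  upper-low {zero} 0≢0 _ = contradiction refl 0≢0
  upper-low {suc y} _ y<h = upper-pos y<h

  upper-high : ∀ {y} → h ℕ.< y → y ℕ.< p → upper (+ y) ≡ 1ℤ
  upper-high {suc y} (ℕ.s≤s h≤y) (ℕ.s≤s y<2h) = trans (upper-resp {x = + suc y} {y = - + suc i} (mod-by 1ℤ eq)) (upper-neg smaller)
    where
    i = h ℕ.+ h ℕ.∸ suc y
    total : i ℕ.+ suc y ≡ h ℕ.+ h
    total = ℕ.m∸n+n≡m y<2h
    smaller : i ℕ.< h
    smaller = ℕ.+-cancelʳ-< (suc y) i h (subst (ℕ._< h ℕ.+ suc y) (sym total) (ℕ.+-monoʳ-< h (ℕ.s≤s h≤y)))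
    lem : ∀ y i → y - - (1ℤ + i) ≡ 1ℤ + (i + y)
    lem = solve-∀
    eq : + suc y - - + suc i ≡ 1ℤ * P
    eq = trans (lem (+ suc y) (+ i)) (trans (cong (λ z → + suc z) total) (sym (*-identityˡ P)))

  ∑-upper : ∀ c m n → m ℕ.+ n ≡ h → (∀ i → i ℕ.< m → upper (+ c * + suc i) ≡ 0ℤ) →
            ∑ h (λ i → upper (+ c * + suc i)) ≡ ∑ n (λ i → upper (+ c * + suc (m ℕ.+ i)))
  ∑-upper c m n refl e = trans (∑-split m n _) (trans (cong (_+ ∑ n (λ i → upper (+ c * + suc (m ℕ.+ i)))) (∑-zero m e)) (ℤ.+-identityˡ _))

  χ-1~ : χ -1ℤ ~ + h
  χ-1~ = subst (χ -1ℤ ~_) (trans (∑-cong h (λ i i<h → trans (cong upper (ℤ.-1*i≡-i (+ suc i))) (upper-neg i<h))) (trans (∑-const h 1ℤ) (*-identityʳ (+ h)))) (gauss -1≉0)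

  -- The multiples 2, 4, ..., 2 h all stay below p, so none wraps around: the first m are at most h
  -- and the other n exceed it.
  χ2~ : ∀ m n → m ℕ.+ n ≡ h → m ℕ.≤ n → n ℕ.≤ suc m → χ (+ 2) ~ + n
  χ2~ m n e m≤n n≤1+m = subst (χ (+ 2) ~_) (begin
    ∑ h (λ i → upper (+ 2 * + suc i))                ≡⟨ ∑-upper 2 m n e low ⟩
    ∑ n (λ i → upper (+ 2 * + suc (m ℕ.+ i)))        ≡⟨ ∑-cong n high ⟩
    ∑ n (λ _ → 1ℤ)                                   ≡⟨ ∑-const n 1ℤ ⟩
    + n * 1ℤ                                         ≡⟨ *-identityʳ (+ n) ⟩
    + n                                              ∎) (gauss 2≉0)
    where
    open ≡-Reasoning
    2* : ∀ k → 2 ℕ.* k ≡ k ℕ.+ k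
    2* k = cong (k ℕ.+_) (ℕ.+-identityʳ k)
    low : ∀ i → i ℕ.< m → upper (+ 2 * + suc i) ≡ 0ℤ
    low i i<m = trans (cong upper (sym (ℤ.pos-* 2 (suc i)))) (upper-low (λ ())
      (subst₂ ℕ._≤_ (sym (2* (suc i))) e (ℕ.+-mono-≤ i<m (ℕ.≤-trans i<m m≤n))))
    high : ∀ i → i ℕ.< n → upper (+ 2 * + suc (m ℕ.+ i)) ≡ 1ℤ
    high i i<n = trans (cong upper (sym (ℤ.pos-* 2 (suc (m ℕ.+ i))))) (upper-high
      (subst₂ ℕ._<_ e (sym (2* (suc (m ℕ.+ i)))) (ℕ.+-mono-<-≤ (ℕ.s≤s (ℕ.m≤m+n m i)) (ℕ.≤-trans n≤1+m (ℕ.s≤s (ℕ.m≤m+n m i)))))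
      (ℕ.s≤s (subst (ℕ._≤ h ℕ.+ h) (sym (2* (suc (m ℕ.+ i)))) (ℕ.+-mono-≤ m+i<h m+i<h))))
      where m+i<h : m ℕ.+ i ℕ.< h
            m+i<h = subst (m ℕ.+ i ℕ.<_) e (ℕ.+-monoʳ-< m i<n)

  -- Here p = 6 m + 1 or p = 6 m + 5, and n = (p + 1) / 6.
  χ3~ : ∀ m n → m ℕ.+ (n ℕ.+ n) ≡ h → m ℕ.≤ n → n ℕ.≤ suc m → χ (+ 3) ~ + n
  χ3~ m n e m≤n n≤1+m = subst (χ (+ 3) ~_) (begin
    ∑ h (λ i → upper (+ 3 * + suc i))                                       ≡⟨ ∑-upper 3 m (n ℕ.+ n) e low ⟩
    ∑ (n ℕ.+ n) (λ i → upper (+ 3 * + suc (m ℕ.+ i)))                       ≡⟨ ∑-split n n _ ⟩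
    ∑ n (λ i → upper (+ 3 * + suc (m ℕ.+ i))) + ∑ n (λ i → upper (+ 3 * + suc (m ℕ.+ (n ℕ.+ i))))
      ≡⟨ cong₂ _+_ (trans (∑-cong n middle) (∑-const n 1ℤ)) (∑-zero n wrapped) ⟩
    + n * 1ℤ + 0ℤ                                                           ≡⟨ trans (+-identityʳ _) (*-identityʳ (+ n)) ⟩
    + n                                                                     ∎) (gauss 3≉0)
    where
    open ≡-Reasoning
    3* : ∀ k → 3 ℕ.* k ≡ k ℕ.+ (k ℕ.+ k)
    3* k = cong (λ z → k ℕ.+ (k ℕ.+ z)) (ℕ.+-identityʳ k)
    low : ∀ i → i ℕ.< m → upper (+ 3 * + suc i) ≡ 0ℤ
    low i i<m = trans (cong upper (sym (ℤ.pos-* 3 (suc i)))) (upper-low (λ ())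
      (subst₂ ℕ._≤_ (sym (3* (suc i))) e (ℕ.+-mono-≤ i<m (ℕ.+-mono-≤ i<n i<n))))
      where i<n = ℕ.≤-trans i<m m≤n
    h<3[m+1] : ∀ i → h ℕ.< 3 ℕ.* suc (m ℕ.+ i)
    h<3[m+1] i = subst₂ ℕ._<_ e (sym (3* (suc (m ℕ.+ i)))) (ℕ.s≤s (ℕ.+-mono-≤ (ℕ.m≤m+n m i) (ℕ.+-mono-≤ n≤ n≤)))
      where n≤ : n ℕ.≤ suc (m ℕ.+ i)
            n≤ = ℕ.≤-trans n≤1+m (ℕ.s≤s (ℕ.m≤m+n m i))
    middle : ∀ i → i ℕ.< n → upper (+ 3 * + suc (m ℕ.+ i)) ≡ 1ℤ
    middle i i<n = trans (cong upper (sym (ℤ.pos-* 3 (suc (m ℕ.+ i))))) (upper-high (h<3[m+1] i)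
      (ℕ.s≤s (subst₂ ℕ._≤_ (sym (3* (suc (m ℕ.+ i)))) (trans (regroup m n) (cong₂ ℕ._+_ e e))
        (ℕ.+-mono-≤ m+i<m+n (ℕ.+-mono-≤ m+i<m+n (ℕ.≤-trans m+i<m+n (ℕ.+-monoˡ-≤ n m≤n)))))))
      where m+i<m+n : suc (m ℕ.+ i) ℕ.≤ m ℕ.+ n
            m+i<m+n = ℕ.+-monoʳ-< m i<n
            regroup : ∀ m n → (m ℕ.+ n) ℕ.+ ((m ℕ.+ n) ℕ.+ (n ℕ.+ n)) ≡ (m ℕ.+ (n ℕ.+ n)) ℕ.+ (m ℕ.+ (n ℕ.+ n))
            regroup = ℕ-solve-∀
    -- This is 1 if p = 6 m + 1 and 0 if p = 6 m + 5. The last n multiples of 3 exceed p, and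
    -- subtracting p leaves 3 i + 1 + b, which is at most h.
    b = suc m ℕ.∸ n
    n+b : n ℕ.+ b ≡ suc m
    n+b = ℕ.m+[n∸m]≡n n≤1+m
    wrapped : ∀ i → i ℕ.< n → upper (+ 3 * + suc (m ℕ.+ (n ℕ.+ i))) ≡ 0ℤ
    wrapped i i<n = trans (upper-resp {+ 3 * + suc (m ℕ.+ (n ℕ.+ i))} {+ excess} (mod-by 1ℤ eq)) (upper-low (λ ()) (ℕ.≤-pred bound))
      where
      excess = suc i ℕ.+ (i ℕ.+ i) ℕ.+ b
      1+h : suc h ≡ n ℕ.+ (n ℕ.+ n) ℕ.+ b
      1+h = trans (cong suc (sym e)) (trans (cong (ℕ._+ (n ℕ.+ n)) (sym n+b)) (regroup n b))
        where regroup : ∀ n b → n ℕ.+ b ℕ.+ (n ℕ.+ n) ≡ n ℕ.+ (n ℕ.+ n) ℕ.+ b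
              regroup = ℕ-solve-∀
      bound : suc excess ℕ.≤ suc h
      bound = subst₂ ℕ._≤_ (cong (ℕ._+ b) (ℕ.+-suc (suc i) (i ℕ.+ i))) (sym 1+h)
        (ℕ.+-monoˡ-≤ b (ℕ.+-mono-≤ i<n (ℕ.≤-trans (ℕ.s≤s (ℕ.+-monoʳ-≤ i (ℕ.n≤1+n i))) (ℕ.+-mono-≤ i<n i<n))))
      lem : ∀ m n i b → + 3 * (1ℤ + (m + (n + i))) - (1ℤ + i + (i + i) + b)
          ≡ 1ℤ * (1ℤ + (m + (n + n) + (m + (n + n)))) + ((1ℤ + m) - (n + b))
      lem = solve-∀
      eq : + 3 * + suc (m ℕ.+ (n ℕ.+ i)) - + excess ≡ 1ℤ * P
      eq = trans (lem (+ m) (+ n) (+ i) (+ b))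
        (trans (cong₂ (λ k l → 1ℤ * (1ℤ + (+ k + + k)) + (+ suc m - + l)) e n+b)
               (trans (cong (_+_ (1ℤ * P)) (ℤ.+-inverseʳ (+ suc m))) (+-identityʳ (1ℤ * P))))

  -- Products over pairs

  u : ℤ
  u = χ -1ℤ

  -- Indices i < j < h stand for the integers 0 < i + 1 < j + 1 < p/2.  M s is the multiplicity of
  -- the ratio s = X² / Y², on which the symbol of a X² + b Y² depends.
  module Ratio (X Y : ℕ → ℕ → ℤ) where

    M : ℤ → ℤ
    M s = ∑ h (λ j → ∑ j (λ i → δ (X i j * X i j - s * (Y i j * Y i j))))

    M-resp : Resp M
    M-resp e = ∑-ext h (λ j → ∑-ext j (λ i → δ-resp (mod-- (mod-refl {x = X i j * X i j}) (mod-* e (mod-refl {x = Y i j * Y i j})))))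

    -- Mod 2, M is the indicator of χ s = 1 and χ (1 - s) = - χ (-1).
    MLaw : Set
    MLaw = ∀ s → + 4 * M s ≡ Q 1ℤ s * Q (- u) (1ℤ - s) mod (+ 8)

    module _ (ok : ∀ i j → i ℕ.< j → j ℕ.< h → ¬ X i j ≋ 0ℤ × ¬ Y i j ≋ 0ℤ × ¬ X i j - Y i j ≋ 0ℤ × ¬ X i j + Y i j ≋ 0ℤ) where

      M-zero : ∀ s → (∀ x y → ¬ x ≋ 0ℤ → ¬ y ≋ 0ℤ → ¬ x - y ≋ 0ℤ → ¬ x + y ≋ 0ℤ → ¬ x * x - s * (y * y) ≋ 0ℤ) → M s ≡ 0ℤ
      M-zero s f = ∑-zero h (λ j j<h → ∑-zero j (λ i i<j → let (x , y , x-y , x+y) = ok i j i<j j<h in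
                     δ-no (f (X i j) (Y i j) x y x-y x+y)))

      -- Only s = r² with r ≢ 0, ± 1 needs an argument. A nonresidue is no ratio of squares, while s
      -- = 0 and s = 1 would force X = 0 or X = ± Y, which `ok` forbids; in these cases the
      -- right-hand side vanishes as well.
      law-from : (∀ r → ¬ r ≋ 0ℤ → ¬ 1ℤ - r * r ≋ 0ℤ → u * χ (1ℤ - r * r) ~ M (r * r)) → MLaw
      law-from generic s with χ s | qr s
      ... | _ | zer z = mod-trans (≡⇒mod (cong (_*_ (+ 4)) (M-zero s (λ x y nx ny _ _ e → *≉0 nx nx (mod-lin₂ 1ℤ (y * y) e z (lem s x y))))))
                                  (≡⇒mod (sym (ℤ.*-zeroˡ (Q (- u) (1ℤ - s)))))
        where lem : ∀ s x y → x * x - 0ℤ ≡ 1ℤ * ((x * x - s * (y * y)) - 0ℤ) + y * y * (s - 0ℤ)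
              lem = solve-∀
      ... | _ | non _ n = mod-trans (≡⇒mod (cong (_*_ (+ 4)) (M-zero s (λ x y nx ny _ _ e → root x y ny e (inverse y ny)))))
                                    (≡⇒mod (sym (ℤ.*-zeroˡ (Q (- u) (1ℤ - s)))))
        where
        lem : ∀ s x y b → x * b * (x * b) - s ≡ b * b * ((x * x - s * (y * y)) - 0ℤ) + s * (y * b + 1ℤ) * (y * b - 1ℤ)
        lem = solve-∀
        root : ∀ x y → ¬ y ≋ 0ℤ → x * x - s * (y * y) ≋ 0ℤ → (∃ λ b → y * b ≋ 1ℤ) → ⊥
        root x y ny e (b , yb) = n (x * b) (mod-lin₂ (b * b) (s * (y * b + 1ℤ)) e yb (lem s x y b))
      ... | _ | res r ns q with (1ℤ - s) ≋? 0ℤ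
      ...   | yes z = mod-trans (≡⇒mod (cong (_*_ (+ 4)) (M-zero s (λ x y _ _ x-y x+y e →
                        *≉0 x-y x+y (mod-lin₂ 1ℤ (- (y * y)) e z (lem s x y))))))
                      (≡⇒mod (sym (trans (cong (λ v → (1ℤ * 1ℤ + 1ℤ * 1ℤ) * (v * v + - u * v)) (χ-zero z)) (lem′ u))))
        where lem : ∀ s x y → (x - y) * (x + y) - 0ℤ ≡ 1ℤ * ((x * x - s * (y * y)) - 0ℤ) + (- (y * y)) * ((1ℤ - s) - 0ℤ)
              lem = solve-∀
              lem′ : ∀ u → (1ℤ * 1ℤ + 1ℤ * 1ℤ) * (0ℤ * 0ℤ + - u * 0ℤ) ≡ 0ℤ
              lem′ = solve-∀
      ...   | no n1 = mod-trans (≡⇒mod (trans (cong (_*_ (+ 4)) (M-resp (mod-sym q))) (double (M (r * r)))))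
                      (mod-trans (mod-scale (+ 2) (~-double (generic r nr (λ z → n1 (mod-trans (mod-- (mod-refl {x = 1ℤ}) (mod-sym q)) z)))))
                      (≡⇒mod (trans (cong (λ v → + 2 * (1ℤ - u * v)) (χ-resp (mod-- (mod-refl {x = 1ℤ}) q))) (finish (χ-sign n1)))))
        where
        nr : ¬ r ≋ 0ℤ
        nr z = ns (mod-trans (mod-sym q) (*≋0ˡ r r z))
        double : ∀ m → + 4 * m ≡ + 2 * (+ 2 * m)
        double = solve-∀
        finish : ∀ {v} → v ≡ 1ℤ ⊎ v ≡ -1ℤ → + 2 * (1ℤ - u * v) ≡ (1ℤ * 1ℤ + 1ℤ * 1ℤ) * (v * v + - u * v)
        finish (inj₁ refl) = lem u
          where lem : ∀ u → + 2 * (1ℤ - u * 1ℤ) ≡ (1ℤ * 1ℤ + 1ℤ * 1ℤ) * (1ℤ * 1ℤ + - u * 1ℤ)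
                lem = solve-∀
        finish (inj₂ refl) = lem u
          where lem : ∀ u → + 2 * (1ℤ - u * -1ℤ) ≡ (1ℤ * 1ℤ + 1ℤ * 1ℤ) * (-1ℤ * -1ℤ + - u * -1ℤ)
                lem = solve-∀

      M-split : ∀ r → ¬ r ≋ 0ℤ → M (r * r) ≡ ∑ h (λ j → ∑ j (λ i → δ (X i j - r * Y i j) + δ (X i j + r * Y i j)))
      M-split r nr = ∑-cong h (λ j j<h → ∑-cong j (λ i i<j → trans (cong (λ z → δ (X i j * X i j - z)) (lem r (Y i j)))
                       (δ-square (X i j) (r * Y i j) (*≉0 nr (proj₁ (proj₂ (ok i j i<j j<h)))))))
        where lem : ∀ r y → r * r * (y * y) ≡ r * y * (r * y)
              lem = solve-∀

    -- With s = X² / Y² one has k f = Y² (a s + b), so χ f = χ (a s + b) and the pairs can be sorted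
    -- by s. The factor k is 1, or 4 for the forms diagonalised by j - i and j + i.
    count-by-ratio : ∀ k a b (f : ℕ → ℕ → ℤ) → χ k ≡ 1ℤ → (∀ i j → i ℕ.< j → j ℕ.< h → ¬ Y i j ≋ 0ℤ) →
      (∀ i j → k * f i j ≡ a * (X i j * X i j) + b * (Y i j * Y i j)) →
      ∑ h (λ j → ∑ j (λ i → neg (χ (f i j)))) ≡ S (λ s → neg (χ (a * s + b)) * M s)
    count-by-ratio k a b f χk nY form = begin
      ∑ h (λ j → ∑ j (λ i → neg (χ (f i j))))       ≡⟨ ∑-cong h (λ j j<h → ∑-cong j (λ i i<j → at i j (nY i j i<j j<h) (inverse _ (*≉0 (nY i j i<j j<h) (nY i j i<j j<h))))) ⟩
      ∑ h (λ j → ∑ j (λ i → S (λ s → w s * d i j s)))  ≡⟨ ∑-ext h (λ j → S-∑-comm j _) ⟩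
      ∑ h (λ j → S (λ s → ∑ j (λ i → w s * d i j s)))  ≡⟨ S-∑-comm h _ ⟩
      S (λ s → ∑ h (λ j → ∑ j (λ i → w s * d i j s)))  ≡⟨ S-ext (λ s → trans (∑-ext h (λ j → ∑-*ˡ j (w s) _)) (∑-*ˡ h (w s) _)) ⟩
      S (λ s → w s * M s)                              ∎
      where
      open ≡-Reasoning
      w : ℤ → ℤ
      w s = neg (χ (a * s + b))
      w-resp : Resp w
      w-resp e = cong neg (χ-resp (+-resp b (mod-* (mod-refl {x = a}) e)))
      d : ℕ → ℕ → ℤ → ℤ
      d i j s = δ (X i j * X i j - s * (Y i j * Y i j))
      at : ∀ i j → ¬ Y i j ≋ 0ℤ → (∃ λ c → Y i j * Y i j * c ≋ 1ℤ) → neg (χ (f i j)) ≡ S (λ s → w s * d i j s)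
      at i j ny (c , yc) = sym (begin
        S (λ s → w s * d i j s)               ≡⟨ S-ext (λ s → trans (ℤ.*-comm (w s) _) (cong (_* w s) (δ-iff (to s) (from s)))) ⟩
        S (λ s → δ (s - x * x * c) * w s)     ≡⟨ S-pick (x * x * c) w-resp ⟩
        w (x * x * c)                         ≡⟨ cong neg value ⟩
        neg (χ (f i j))                       ∎)
        where
        x = X i j
        y = Y i j
        to : ∀ s → x * x - s * (y * y) ≋ 0ℤ → s - x * x * c ≋ 0ℤ
        to s e = mod-lin₂ (- c) (- s) e yc (lem x y c s)
          where lem : ∀ x y c s → (s - x * x * c) - 0ℤ ≡ (- c) * ((x * x - s * (y * y)) - 0ℤ) + (- s) * (y * y * c - 1ℤ)
                lem = solve-∀
        from : ∀ s → s - x * x * c ≋ 0ℤ → x * x - s * (y * y) ≋ 0ℤ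
        from s e = mod-lin₂ (- (y * y)) (- (x * x)) e yc (lem x y c s)
          where lem : ∀ x y c s → (x * x - s * (y * y)) - 0ℤ ≡ (- (y * y)) * ((s - x * x * c) - 0ℤ) + (- (x * x)) * (y * y * c - 1ℤ)
                lem = solve-∀
        value : χ (a * (x * x * c) + b) ≡ χ (f i j)
        value = begin
          χ (a * (x * x * c) + b)                  ≡⟨ χ-square-* y _ ny ⟨
          χ (y * y * (a * (x * x * c) + b))        ≡⟨ χ-resp (mod-lin (a * (x * x)) yc (lem a b c x y)) ⟩
          χ (a * (x * x) + b * (y * y))            ≡⟨ cong χ (form i j) ⟨
          χ (k * f i j)                            ≡⟨ trans (χ-* k (f i j)) (trans (cong (_* χ (f i j)) χk) (*-identityˡ _)) ⟩
          χ (f i j)                                ∎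
          where lem : ∀ a b c x y → y * y * (a * (x * x * c) + b) - (a * (x * x) + b * (y * y)) ≡ a * (x * x) * (y * y * c - 1ℤ)
                lem = solve-∀

    -- Splitting 8 as 2 times 4, the 4 goes to M, where `MLaw` holds mod 8, and the 2 both raises
    -- the modulus to 16 and turns the indicator into Q (-1).
    8count-mod : ∀ a b → MLaw → + 8 * S (λ s → neg (χ (a * s + b)) * M s) ≡ S (λ s → Q 1ℤ s * Q (- u) (1ℤ - s) * Q -1ℤ (a * s + b)) mod (+ 16)
    8count-mod a b law = mod-trans (≡⇒mod (sym (S-* (+ 8) _))) (S-mod (λ s →
        mod-trans (mod-trans (≡⇒mod (lem₁ (neg (χ (a * s + b))) (M s))) (times2 (neg (χ (a * s + b))) (law s)))
                  (≡⇒mod (trans (lem₂ (neg (χ (a * s + b))) (Q 1ℤ s * Q (- u) (1ℤ - s))) (cong (_*_ (Q 1ℤ s * Q (- u) (1ℤ - s))) (2neg (a * s + b)))))))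
      where
      lem₁ : ∀ n m → + 8 * (n * m) ≡ n * (+ 2 * (+ 4 * m))
      lem₁ = solve-∀
      lem₂ : ∀ n q → n * (+ 2 * q) ≡ q * (+ 2 * n)
      lem₂ = solve-∀
      times2 : ∀ n {x y} → x ≡ y mod (+ 8) → n * (+ 2 * x) ≡ n * (+ 2 * y) mod (+ 16)
      times2 n e = mod-* (mod-refl {x = n}) (mod-scale (+ 2) e)

  -- The parity of M for the pairs (i, j)

  upper-flip : ∀ x → ¬ x ≋ 0ℤ → upper (- x) ≡ 1ℤ - upper x
  upper-flip x nx with idx-spec x nx
  ... | i<h , inj₁ e = trans (trans (upper-resp (mod-neg e)) (upper-neg i<h)) (sym (cong (_-_ 1ℤ) (trans (upper-resp e) (upper-pos i<h))))
  ... | i<h , inj₂ e = trans (trans (upper-resp (mod-trans (mod-neg e) (≡⇒mod (ℤ.neg-involutive _)))) (upper-pos i<h))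
                             (sym (cong (_-_ 1ℤ) (trans (upper-resp e) (upper-neg i<h))))

  η : ℤ
  η = + suc h

  2η≋1 : + 2 * η ≋ 1ℤ
  2η≋1 = mod-by 1ℤ (lem (+ h))
    where lem : ∀ h → + 2 * (1ℤ + h) - 1ℤ ≡ 1ℤ * (1ℤ + (h + h))
          lem = solve-∀

  η≉0 : ¬ η ≋ 0ℤ
  η≉0 z = 1≉0 (mod-trans (mod-sym 2η≋1) (*≋0ʳ (+ 2) η z))

  -- η is 1/2, so η d and η d + k are the least positive halves of d and d + 2 k when d is
  -- even, and both halves exceed p/2 when d is odd.
  upper-half : ∀ d k → d ≢ 0 → d ℕ.+ (k ℕ.+ k) ℕ.≤ h ℕ.+ h → upper (η * + d) ≡ upper (η * (+ d + + 2 * + k))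
  upper-half d k d≢0 bound with half-split d
  ... | e , inj₁ refl = trans (trans (cong (λ z → upper (η * z)) (sym (+-identityʳ (+ d)))) (trans (upper-resp (halve 0)) (upper-low (λ z → nz (ℕ.m+n≡0⇒m≡0 e z)) (ℕ.≤-trans (ℕ.≤-reflexive (ℕ.+-identityʳ e)) (ℕ.≤-trans (ℕ.m≤m+n e k) small)))))
                              (sym (trans (upper-resp (halve k)) (upper-low (λ z → nz (ℕ.m+n≡0⇒m≡0 e z)) small)))
    where
    nz : e ≢ 0
    nz refl = d≢0 refl
    regroup : ∀ e k → e ℕ.+ e ℕ.+ (k ℕ.+ k) ≡ (e ℕ.+ k) ℕ.+ (e ℕ.+ k)
    regroup = ℕ-solve-∀
    small : e ℕ.+ k ℕ.≤ h
    small = double-≤ (subst (ℕ._≤ h ℕ.+ h) (regroup e k) bound)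
    halve : ∀ k → η * (+ (e ℕ.+ e) + + 2 * + k) ≋ + (e ℕ.+ k)
    halve k = mod-lin (+ e + + k) 2η≋1 (lem η (+ e) (+ k))
      where lem : ∀ η e k → η * ((e + e) + + 2 * k) - (e + k) ≡ (e + k) * (+ 2 * η - 1ℤ)
            lem = solve-∀
  ... | e , inj₂ refl = trans (trans (cong (λ z → upper (η * z)) (sym (+-identityʳ (+ d)))) (trans (upper-resp (halve 0)) (upper-high (ℕ.s≤s (ℕ.m≤m+n h (e ℕ.+ 0))) (ℕ.s≤s (ℕ.+-monoʳ-< h (ℕ.≤-<-trans (ℕ.≤-reflexive (ℕ.+-identityʳ e)) (ℕ.≤-<-trans (ℕ.m≤m+n e k) small)))))))
                              (sym (trans (upper-resp (halve k)) (upper-high (ℕ.s≤s (ℕ.m≤m+n h (e ℕ.+ k))) (ℕ.s≤s (ℕ.+-monoʳ-< h small)))))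
    where
    regroup : ∀ e k → suc (e ℕ.+ e) ℕ.+ (k ℕ.+ k) ≡ suc ((e ℕ.+ k) ℕ.+ (e ℕ.+ k))
    regroup = ℕ-solve-∀
    small : e ℕ.+ k ℕ.< h
    small = ℕ.≰⇒> (λ h≤ → ℕ.<⇒≱ (subst (ℕ._≤ h ℕ.+ h) (regroup e k) bound) (ℕ.+-mono-≤ h≤ h≤))
    halve : ∀ k → η * (+ suc (e ℕ.+ e) + + 2 * + k) ≋ + suc (h ℕ.+ (e ℕ.+ k))
    halve k = mod-lin (+ e + + k) 2η≋1 (lem (+ h) (+ e) (+ k))
      where lem : ∀ h e k → (1ℤ + h) * ((1ℤ + (e + e)) + + 2 * k) - (1ℤ + (h + (e + k))) ≡ (e + k) * (+ 2 * (1ℤ + h) - 1ℤ)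
            lem = solve-∀

  -- For j < h and x ≢ ± (j + 1), the sum over i is 1 if |x| ≤ j and 0 otherwise.
  module Compare (j : ℕ) (j<h : j ℕ.< h) where

    J : ℤ
    J = + suc j

    -- For x = r J these are the terms at J of the Gauss counts of (1 - r)/2 and (1 + r)/2.
    halves : ℤ → ℤ
    halves x = upper (η * (J - x)) + upper (η * (J + x))

    below : ℤ → ℤ
    below x = ∑ j (λ i → δ (+ suc i - x) + δ (+ suc i + x))

    halves-resp : Resp halves
    halves-resp {x} {y} e = cong₂ _+_ (upper-resp (mod-* (mod-refl {x = η}) (mod-- (mod-refl {x = J}) e)))
                                      (upper-resp (mod-* (mod-refl {x = η}) (mod-+ (mod-refl {x = J}) e)))

    below-resp : Resp below
    below-resp e = ∑-ext j (λ i → cong₂ _+_ (δ-resp (mod-- (mod-refl {x = + suc i}) e)) (δ-resp (mod-+ (mod-refl {x = + suc i}) e)))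

    halves-neg : ∀ x → halves (- x) ≡ halves x
    halves-neg x = trans (cong (λ z → upper (η * (J + z)) + upper (η * (J - x))) (ℤ.neg-involutive x)) (ℤ.+-comm (upper (η * (J + x))) _)

    below-neg : ∀ x → below (- x) ≡ below x
    below-neg x = ∑-ext j (λ i → trans (cong (λ z → δ (+ suc i + z) + δ (+ suc i - x)) (ℤ.neg-involutive x)) (ℤ.+-comm (δ (+ suc i + x)) _))

    -- Here J - x = d > 0 and J + x = d + 2 x, so by `upper-half` both terms equal t and their sum
    -- is even; `below` is 1 because of the index i = k.
    smaller : ∀ k → k ℕ.< j → halves (+ suc k) ≡ 1ℤ + below (+ suc k) mod (+ 2)
    smaller k k<j = mod-trans (≡⇒mod (cong₂ _+_ (cong (λ z → upper (η * z)) diff) (trans (cong (λ z → upper (η * z)) total) (sym half))))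
        (mod-trans (mod-by (t - 1ℤ) (lem t)) (≡⇒mod (cong (_+_ 1ℤ) (sym one))))
      where
      d = j ℕ.∸ k
      t = upper (η * + d)
      k+d : k ℕ.+ d ≡ j
      k+d = ℕ.m+[n∸m]≡n (ℕ.<⇒≤ k<j)
      lem : ∀ t → t + t - + 2 ≡ (t - 1ℤ) * + 2
      lem = solve-∀
      ring₁ : ∀ k d → 1ℤ + (k + d) - (1ℤ + k) ≡ d
      ring₁ = solve-∀
      ring₂ : ∀ k d → 1ℤ + (k + d) + (1ℤ + k) ≡ d + + 2 * (1ℤ + k)
      ring₂ = solve-∀
      diff : J - + suc k ≡ + d
      diff = trans (cong (λ z → + suc z - + suc k) (sym k+d)) (ring₁ (+ k) (+ d))
      total : J + + suc k ≡ + d + + 2 * + suc k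
      total = trans (cong (λ z → + suc z + + suc k) (sym k+d)) (ring₂ (+ k) (+ d))
      half : t ≡ upper (η * (+ d + + 2 * + suc k))
      half = upper-half d (suc k) (ℕ.m>n⇒m∸n≢0 k<j)
        (subst (ℕ._≤ h ℕ.+ h) (trans (cong (λ z → suc z ℕ.+ suc k) (sym k+d)) (regroup k d)) (ℕ.+-mono-≤ j<h (ℕ.<-trans k<j j<h)))
        where regroup : ∀ k d → suc (k ℕ.+ d) ℕ.+ suc k ≡ d ℕ.+ (suc k ℕ.+ suc k)
              regroup = ℕ-solve-∀
      one : below (+ suc k) ≡ 1ℤ
      one = trans (∑-pick j k k<j (λ i i<j i≢k → cong₂ _+_
                (δ-no (λ e → i≢k (half-unique (ℕ.<-trans i<j j<h) (ℕ.<-trans k<j j<h) (-≋0⇒≋ e))))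
                (δ-no (half-sum≉0 (ℕ.<-trans i<j j<h) (ℕ.<-trans k<j j<h)))))
              (cong₂ _+_ (δ-yes (≡⇒mod (ℤ.+-inverseʳ (+ suc k)))) (δ-no (half-sum≉0 (ℕ.<-trans k<j j<h) (ℕ.<-trans k<j j<h))))

    -- Here J - x = - d and J + x = d + 2 J, so by `upper-flip` and `upper-half` the terms are 1 - t
    -- and t, while no index below j reaches ± x.
    larger : ∀ k → j ℕ.< k → k ℕ.< h → halves (+ suc k) ≡ 1ℤ + below (+ suc k) mod (+ 2)
    larger k j<k k<h = ≡⇒mod (trans (cong₂ _+_ (trans (cong upper diff) (upper-flip (η * + d) nd)) (trans (cong (λ z → upper (η * z)) total) (sym half)))
        (trans (lem t) (cong (_+_ 1ℤ) (sym none))))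
      where
      d = k ℕ.∸ j
      t = upper (η * + d)
      j+d : j ℕ.+ d ≡ k
      j+d = ℕ.m+[n∸m]≡n (ℕ.<⇒≤ j<k)
      d≢0 = ℕ.m>n⇒m∸n≢0 j<k
      nd : ¬ η * + d ≋ 0ℤ
      nd = *≉0 η≉0 (small≉0 d≢0 (ℕ.≤-<-trans (ℕ.m∸n≤m k j) (ℕ.<-trans (ℕ.n<1+n k) (<h⇒<p k<h))))
      lem : ∀ t → 1ℤ - t + t ≡ 1ℤ + 0ℤ
      lem = solve-∀
      ring₁ : ∀ η j d → η * ((1ℤ + j) - (1ℤ + (j + d))) ≡ - (η * d)
      ring₁ = solve-∀
      ring₂ : ∀ j d → (1ℤ + j) + (1ℤ + (j + d)) ≡ d + + 2 * (1ℤ + j)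
      ring₂ = solve-∀
      diff : η * (J - + suc k) ≡ - (η * + d)
      diff = trans (cong (λ z → η * (J - + suc z)) (sym j+d)) (ring₁ η (+ j) (+ d))
      total : J + + suc k ≡ + d + + 2 * J
      total = trans (cong (λ z → J + + suc z) (sym j+d)) (ring₂ (+ j) (+ d))
      half : t ≡ upper (η * (+ d + + 2 * J))
      half = upper-half d (suc j) d≢0
        (subst (ℕ._≤ h ℕ.+ h) (trans (cong (λ z → suc j ℕ.+ suc z) (sym j+d)) (regroup j d)) (ℕ.+-mono-≤ j<h k<h))
        where regroup : ∀ j d → suc j ℕ.+ suc (j ℕ.+ d) ≡ d ℕ.+ (suc j ℕ.+ suc j)
              regroup = ℕ-solve-∀
      none : below (+ suc k) ≡ 0ℤ
      none = ∑-zero j (λ i i<j → cong₂ _+_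
                (δ-no (λ e → ℕ.<⇒≢ (ℕ.<-trans i<j j<k) (half-unique (ℕ.<-trans i<j j<h) k<h (-≋0⇒≋ e))))
                (δ-no (half-sum≉0 (ℕ.<-trans i<j j<h) k<h)))

    compare-half : ∀ k → k ℕ.< h → j ≢ k → halves (+ suc k) ≡ 1ℤ + below (+ suc k) mod (+ 2)
    compare-half k k<h j≢k with ℕ.<-cmp k j
    ... | tri< k<j _ _ = smaller k k<j
    ... | tri≈ _ k≡j _ = contradiction (sym k≡j) j≢k
    ... | tri> _ _ j<k = larger k j<k k<h

    compare : ∀ x → ¬ x ≋ 0ℤ → ¬ J - x ≋ 0ℤ → ¬ J + x ≋ 0ℤ → halves x ≡ 1ℤ + below x mod (+ 2)
    compare x nx J-x J+x = split (idx-spec x nx)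
      where
      k = idx x
      lem : ∀ y x → (y - x) - 0ℤ ≡ -1ℤ * (x - y)
      lem = solve-∀
      lem′ : ∀ y x → (y + x) - 0ℤ ≡ 1ℤ * (x - - y)
      lem′ = solve-∀
      split : k ℕ.< h × (x ≋ + suc k ⊎ x ≋ - + suc k) → halves x ≡ 1ℤ + below x mod (+ 2)
      split (k<h , inj₁ e) = subst₂ (λ a b → a ≡ 1ℤ + b mod (+ 2)) (sym (halves-resp e)) (sym (below-resp e))
        (compare-half k k<h (λ j≡k → J-x (mod-lin -1ℤ (subst (λ t → x ≋ + suc t) (sym j≡k) e) (lem J x))))
      split (k<h , inj₂ e) = subst₂ (λ a b → a ≡ 1ℤ + b mod (+ 2))
        (sym (trans (halves-resp e) (halves-neg (+ suc k)))) (sym (trans (below-resp e) (below-neg (+ suc k))))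
        (compare-half k k<h (λ j≡k → J+x (mod-lin 1ℤ (subst (λ t → x ≋ - + suc t) (sym j≡k) e) (lem′ J x))))

  module Diagonal = Ratio (λ i j → + suc i) (λ i j → + suc j)

  pair-ok : ∀ i j → i ℕ.< j → j ℕ.< h → ¬ + suc i ≋ 0ℤ × ¬ + suc j ≋ 0ℤ × ¬ + suc i - + suc j ≋ 0ℤ × ¬ + suc i + + suc j ≋ 0ℤ
  pair-ok i j i<j j<h = suc≉0 i<h , suc≉0 j<h , (λ e → ℕ.<⇒≢ i<j (half-unique i<h j<h (-≋0⇒≋ e))) , half-sum≉0 i<h j<h
    where i<h = ℕ.<-trans i<j j<h

  -- `Compare` is summed over all j with x = r J. The halves give the Gauss counts of (1 - r)/2 and
  -- (1 + r)/2, whose symbols multiply to χ (1 - r²); `below` gives M (r²); the ones give h, the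
  -- count for χ (-1).
  diagonal-law : Diagonal.MLaw
  diagonal-law = Diagonal.law-from pair-ok step
    where
    module _ (r : ℤ) (nr : ¬ r ≋ 0ℤ) (nr² : ¬ 1ℤ - r * r ≋ 0ℤ) where
      A = λ j → upper (η * (1ℤ - r) * + suc j)
      B = λ j → upper (η * (1ℤ + r) * + suc j)
      L = λ j → ∑ j (λ i → δ (+ suc i - r * + suc j) + δ (+ suc i + r * + suc j))
      factor : ∀ r → 1ℤ - r * r ≡ (1ℤ - r) * (1ℤ + r)
      factor = solve-∀
      n- : ¬ 1ℤ - r ≋ 0ℤ
      n- e = nr² (mod-trans (≡⇒mod (factor r)) (*≋0ˡ (1ℤ - r) (1ℤ + r) e))
      n+ : ¬ 1ℤ + r ≋ 0ℤ
      n+ e = nr² (mod-trans (≡⇒mod (factor r)) (*≋0ʳ (1ℤ - r) (1ℤ + r) e))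
      pairwise : ∀ j → j ℕ.< h → A j + B j ≡ 1ℤ + L j mod (+ 2)
      pairwise j j<h = mod-trans (≡⇒mod (cong₂ _+_ (cong upper (ring₁ η r J)) (cong upper (ring₂ η r J))))
          (compare (r * J) (*≉0 nr (suc≉0 j<h))
            (λ e → *≉0 n- (suc≉0 j<h) (mod-trans (≡⇒mod (ring₃ r J)) e)) (λ e → *≉0 n+ (suc≉0 j<h) (mod-trans (≡⇒mod (ring₄ r J)) e)))
        where
        open Compare j j<h
        ring₁ : ∀ η r y → η * (1ℤ - r) * y ≡ η * (y - r * y)
        ring₁ = solve-∀
        ring₂ : ∀ η r y → η * (1ℤ + r) * y ≡ η * (y + r * y)
        ring₂ = solve-∀
        ring₃ : ∀ r y → (1ℤ - r) * y ≡ y - r * y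
        ring₃ = solve-∀
        ring₄ : ∀ r y → (1ℤ + r) * y ≡ y + r * y
        ring₄ = solve-∀
      total : ∑ h A + ∑ h B ≡ + h + ∑ h L mod (+ 2)
      total = mod-trans (≡⇒mod (sym (∑-+ h A B))) (mod-trans (∑-mod h pairwise)
        (≡⇒mod (trans (∑-+ h (λ _ → 1ℤ) L) (cong (_+ ∑ h L) (trans (∑-const h 1ℤ) (*-identityʳ (+ h)))))))
      χ-value : χ (η * (1ℤ - r)) * χ (η * (1ℤ + r)) ≡ χ (1ℤ - r * r)
      χ-value = trans (sym (χ-* _ _)) (trans (cong χ (ring₅ η r)) (χ-square-* η (1ℤ - r * r) η≉0))
        where ring₅ : ∀ η r → η * (1ℤ - r) * (η * (1ℤ + r)) ≡ η * η * (1ℤ - r * r)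
              ring₅ = solve-∀
      step : u * χ (1ℤ - r * r) ~ Diagonal.M (r * r)
      step = subst₂ _~_ (cong (_*_ u) χ-value) (sym (Diagonal.M-split pair-ok r nr))
        (~-resp (~-* χ-1~ (~-* (gauss (*≉0 η≉0 n-)) (gauss (*≉0 η≉0 n+))))
          (mod-trans (mod-+ (mod-refl {x = + h}) total) (mod-by (+ h) (ring₆ (+ h) (∑ h L)))))
        where ring₆ : ∀ h l → h + (h + l) - l ≡ h * + 2
              ring₆ = solve-∀

  -- The parity of M for the pairs (j - i, j + i)

  module Symmetric = Ratio (λ i j → + suc j - + suc i) (λ i j → + suc j + + suc i)

  symmetric-ok : ∀ i j → i ℕ.< j → j ℕ.< h → let x = + suc j - + suc i; y = + suc j + + suc i in
    ¬ x ≋ 0ℤ × ¬ y ≋ 0ℤ × ¬ x - y ≋ 0ℤ × ¬ x + y ≋ 0ℤ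
  symmetric-ok i j i<j j<h =
      (λ e → ℕ.<⇒≢ i<j (sym (half-unique j<h i<h (-≋0⇒≋ e))))
    , half-sum≉0 j<h i<h
    , (λ e → *≉0 (*≉0 -1≉0 2≉0) (suc≉0 i<h) (mod-trans (≡⇒mod (ring₁ (+ suc j) (+ suc i))) e))
    , (λ e → *≉0 2≉0 (suc≉0 j<h) (mod-trans (≡⇒mod (ring₂ (+ suc j) (+ suc i))) e))
    where
    i<h = ℕ.<-trans i<j j<h
    ring₁ : ∀ y x → -1ℤ * + 2 * x ≡ y - x - (y + x)
    ring₁ = solve-∀
    ring₂ : ∀ y x → + 2 * y ≡ y - x + (y + x)
    ring₂ = solve-∀

  -- Exchanging i and j turns X + r Y into - (X - r Y), so the two root conditions over i < j fill
  -- the whole square, whose diagonal is empty. In column j the condition X = r Y reads i = - t j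
  -- with t = - (1 - r) / (1 + r), so the column sum is a term of the Gauss count of t. Finally (1 +
  -- r)² t = - (1 - r²) gives the symbol of t.
  symmetric-law : Symmetric.MLaw
  symmetric-law = Symmetric.law-from symmetric-ok step
    where
    module _ (r : ℤ) (nr : ¬ r ≋ 0ℤ) (nr² : ¬ 1ℤ - r * r ≋ 0ℤ) where
      open ≡-Reasoning
      factor : ∀ r → 1ℤ - r * r ≡ (1ℤ - r) * (1ℤ + r)
      factor = solve-∀
      n- : ¬ 1ℤ - r ≋ 0ℤ
      n- e = nr² (mod-trans (≡⇒mod (factor r)) (*≋0ˡ (1ℤ - r) (1ℤ + r) e))
      n+ : ¬ 1ℤ + r ≋ 0ℤ
      n+ e = nr² (mod-trans (≡⇒mod (factor r)) (*≋0ʳ (1ℤ - r) (1ℤ + r) e))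
      b = proj₁ (inverse (1ℤ + r) n+)
      b-inv : (1ℤ + r) * b ≋ 1ℤ
      b-inv = proj₂ (inverse (1ℤ + r) n+)
      nb : ¬ b ≋ 0ℤ
      nb e = 1≉0 (mod-trans (mod-sym b-inv) (*≋0ʳ (1ℤ + r) b e))
      t : ℤ
      t = -1ℤ * b * (1ℤ - r)
      E : ℕ → ℕ → ℤ
      E i j = δ ((+ suc j - + suc i) - r * (+ suc j + + suc i))
      swap : ∀ i j → δ ((+ suc j - + suc i) + r * (+ suc j + + suc i)) ≡ E j i
      swap i j = δ-neg _ _ (ring r (+ suc i) (+ suc j))
        where ring : ∀ r x y → (y - x) + r * (y + x) ≡ - ((x - y) - r * (x + y))
              ring = solve-∀
      diagonal-0 : ∑ h (λ i → E i i) ≡ 0ℤ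
      diagonal-0 = ∑-zero h (λ i i<h → δ-no (λ e → *≉0 (*≉0 -1≉0 2≉0) (*≉0 nr (suc≉0 i<h)) (mod-trans (≡⇒mod (ring r (+ suc i))) e)))
        where ring : ∀ r x → -1ℤ * + 2 * (r * x) ≡ (x - x) - r * (x + x)
              ring = solve-∀
      column : ∀ j → ∑ h (λ i → E i j) ≡ upper (t * + suc j)
      column j = trans (∑-ext h (λ i → trans (δ-neg _ _ (ring₁ r (+ suc i) (+ suc j)))
          (trans (δ-resp (mod-lin ((1ℤ - r) * + suc j) b-inv (ring₂ r b (+ suc i) (+ suc j)))) (δ-unit (1ℤ + r) _ n+)))) (sym (upper-def (t * + suc j)))
        where
        ring₁ : ∀ r x y → (y - x) - r * (y + x) ≡ - ((1ℤ + r) * x - (1ℤ - r) * y)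
        ring₁ = solve-∀
        ring₂ : ∀ r b x y → (1ℤ + r) * x - (1ℤ - r) * y - (1ℤ + r) * (x + -1ℤ * b * (1ℤ - r) * y) ≡ (1ℤ - r) * y * ((1ℤ + r) * b - 1ℤ)
        ring₂ = solve-∀
      count : Symmetric.M (r * r) ≡ ∑ h (λ j → upper (t * + suc j))
      count = begin
        Symmetric.M (r * r)                                             ≡⟨ Symmetric.M-split symmetric-ok r nr ⟩
        _                                                               ≡⟨ ∑-ext h (λ j → ∑-ext j (λ i → cong (_+_ (E i j)) (swap i j))) ⟩
        ∑ h (λ j → ∑ j (λ i → E i j + E j i))                           ≡⟨ +-identityʳ _ ⟨
        ∑ h (λ j → ∑ j (λ i → E i j + E j i)) + 0ℤ                      ≡⟨ cong (_+_ (∑ h (λ j → ∑ j (λ i → E i j + E j i)))) diagonal-0 ⟨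
        ∑ h (λ j → ∑ j (λ i → E i j + E j i)) + ∑ h (λ i → E i i)       ≡⟨ ∑-square h E ⟨
        ∑ h (λ i → ∑ h (E i))                                           ≡⟨ ∑-comm h h E ⟩
        ∑ h (λ j → ∑ h (λ i → E i j))                                   ≡⟨ ∑-ext h column ⟩
        ∑ h (λ j → upper (t * + suc j))                                 ∎
      χ-value : χ t ≡ u * χ (1ℤ - r * r)
      χ-value = begin
        χ t                                   ≡⟨ χ-square-* (1ℤ + r) t n+ ⟨
        χ ((1ℤ + r) * (1ℤ + r) * t)           ≡⟨ χ-resp (mod-lin (- (1ℤ - r * r)) b-inv (ring r b)) ⟩
        χ (-1ℤ * (1ℤ - r * r))                ≡⟨ χ-* -1ℤ (1ℤ - r * r) ⟩
        u * χ (1ℤ - r * r)                    ∎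
        where ring : ∀ r b → (1ℤ + r) * (1ℤ + r) * (-1ℤ * b * (1ℤ - r)) - -1ℤ * (1ℤ - r * r) ≡ - (1ℤ - r * r) * ((1ℤ + r) * b - 1ℤ)
              ring = solve-∀
      step : u * χ (1ℤ - r * r) ~ Symmetric.M (r * r)
      step = subst₂ _~_ χ-value (sym count) (gauss (*≉0 (*≉0 -1≉0 nb) n-))

  -- Products over lists as signs of counts

  ≡ᵇ0⇒≋0 : ∀ x → (x %ℕ p ℕ.≡ᵇ 0) ≡ true → x ≋ 0ℤ
  ≡ᵇ0⇒≋0 x e = subst (λ r → x ≋ + r) (ℕ.≡ᵇ⇒≡ (rep x) 0 (subst T (sym e) tt)) (≋rep x)

  ≢ᵇ0⇒≉0 : ∀ x → (x %ℕ p ℕ.≡ᵇ 0) ≡ false → ¬ x ≋ 0ℤ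
  ≢ᵇ0⇒≉0 x e z = subst T e (ℕ.≡⇒≡ᵇ _ _ (mod⇒%ℕ≡ (h ℕ.+ h) z))

  χ~neg : ∀ {x} → ¬ x ≋ 0ℤ → χ x ~ neg (χ x)
  χ~neg {x} n with χ x | qr x
  ... | _ | zer z = contradiction z n
  ... | _ | res _ _ _ = even mod-refl
  ... | _ | non _ _ = odd mod-refl

  -- Entries divisible by p disappear on both sides: the filter removes them from the product, and
  -- `neg` is 0 at χ = 0.
  filtered-product~ : ∀ (g : ℕ × ℕ → ℤ) L →
    productℤ (map (λ ij → legendre (g ij) p) (filterᵇ (λ ij → not (dvdᵇ p (g ij))) L)) ~ sumℤ (map (λ ij → neg (χ (g ij))) L)
  filtered-product~ g [] = even mod-refl
  filtered-product~ g (x ∷ L) with g x %ℕ p ℕ.≡ᵇ 0 in e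
  ... | true = ~-resp (filtered-product~ g L) (≡⇒mod (sym (trans (cong (λ v → neg v + rest) (χ-zero (≡ᵇ0⇒≋0 (g x) e))) (ℤ.+-identityˡ rest))))
    where rest = sumℤ (map (λ ij → neg (χ (g ij))) L)
  ... | false = subst (λ z → z * productℤ (map (λ ij → legendre (g ij) p) (filterᵇ (λ ij → not (dvdᵇ p (g ij))) L)) ~ neg (χ (g x)) + sumℤ (map (λ ij → neg (χ (g ij))) L)) (sym (χ-def (g x))) (~-* (χ~neg (≢ᵇ0⇒≉0 (g x) e)) (filtered-product~ g L))

  sumℤ-++ : ∀ xs ys → sumℤ (xs ++ ys) ≡ sumℤ xs + sumℤ ys
  sumℤ-++ [] ys = sym (ℤ.+-identityˡ _)
  sumℤ-++ (x ∷ xs) ys = trans (cong (_+_ x) (sumℤ-++ xs ys)) (sym (ℤ.+-assoc x _ _))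

  sumℤ-concatMap : ∀ {A B : Set} (w : B → ℤ) (k : A → List B) xs →
    sumℤ (map w (concatMap k xs)) ≡ sumℤ (map (λ x → sumℤ (map w (k x))) xs)
  sumℤ-concatMap w k [] = refl
  sumℤ-concatMap w k (x ∷ xs) = trans (cong sumℤ (map-++ w (k x) (concatMap k xs)))
    (trans (sumℤ-++ (map w (k x)) _) (cong (_+_ (sumℤ (map w (k x)))) (sumℤ-concatMap w k xs)))

  sumℤ-range1 : ∀ n (w : ℕ → ℤ) → sumℤ (map w (range1 n)) ≡ ∑ n (w ∘ suc)
  sumℤ-range1 n w = trans (cong sumℤ (trans (sym (map-∘ (upTo n))) (map-upTo (w ∘ suc) n))) (sym (∑-list n (w ∘ suc)))

  filterᵇ-prefix : ∀ {A : Set} (q : A → Bool) (f : ℕ → A) m n → (∀ i → i ℕ.< m → q (f i) ≡ true) →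
    (∀ i → q (f (m ℕ.+ i)) ≡ false) → filterᵇ q (applyUpTo f (m ℕ.+ n)) ≡ applyUpTo f m
  filterᵇ-prefix q f zero zero t e = refl
  filterᵇ-prefix q f zero (suc n) t e rewrite e 0 = filterᵇ-prefix q (f ∘ suc) zero n (λ i ()) (λ i → e (suc i))
  filterᵇ-prefix q f (suc m) n t e rewrite t 0 (ℕ.s≤s ℕ.z≤n) =
    cong (f 0 ∷_) (filterᵇ-prefix q (f ∘ suc) m n (λ i i<m → t (suc i) (ℕ.s≤s i<m)) e)

  lower-half : filterᵇ (λ j → (2 ℕ.* j) ℕ.<ᵇ p) (range1 p) ≡ range1 h
  lower-half = begin
    filterᵇ q (map suc (upTo p))               ≡⟨ cong (filterᵇ q) (map-upTo suc p) ⟩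
    filterᵇ q (applyUpTo suc p)                ≡⟨ cong (λ n → filterᵇ q (applyUpTo suc n)) (ℕ.+-suc h h) ⟨
    filterᵇ q (applyUpTo suc (h ℕ.+ suc h))    ≡⟨ filterᵇ-prefix q suc h (suc h) low high ⟩
    applyUpTo suc h                            ≡⟨ map-upTo suc h ⟨
    map suc (upTo h)                           ∎
    where
    open ≡-Reasoning
    q : ℕ → Bool
    q j = (2 ℕ.* j) ℕ.<ᵇ p
    2* : ∀ k → 2 ℕ.* k ≡ k ℕ.+ k
    2* k = cong (k ℕ.+_) (ℕ.+-identityʳ k)
    T⇒≡ : ∀ {b} → T b → b ≡ true
    T⇒≡ {true} _ = refl
    ¬T⇒≡ : ∀ {b} → ¬ T b → b ≡ false
    ¬T⇒≡ {false} _ = refl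
    ¬T⇒≡ {true} n = contradiction tt n
    low : ∀ i → i ℕ.< h → q (suc i) ≡ true
    low i i<h = T⇒≡ (ℕ.<⇒<ᵇ (ℕ.s≤s (ℕ.≤-trans (ℕ.≤-reflexive (2* (suc i))) (ℕ.+-mono-≤ i<h i<h))))
    high : ∀ i → q (suc (h ℕ.+ i)) ≡ false
    high i = ¬T⇒≡ (λ t → ℕ.<⇒≱ (ℕ.<ᵇ⇒< (2 ℕ.* suc (h ℕ.+ i)) p t)
      (subst (p ℕ.≤_) (sym (2* (suc (h ℕ.+ i)))) (ℕ.s≤s (ℕ.+-mono-≤ (ℕ.m≤m+n h i) (ℕ.m≤n⇒m≤1+n (ℕ.m≤m+n h i))))))

  nonresidue-pairs : (ℤ → ℤ → ℤ) → ℤ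
  nonresidue-pairs f = ∑ h (λ j → ∑ j (λ i → neg (χ (f (+ suc i) (+ suc j)))))

  formProduct~ : ∀ f → formProduct f p ~ nonresidue-pairs f
  formProduct~ f = subst (formProduct f p ~_) count (filtered-product~ _ (pairs p))
    where
    w : ℕ × ℕ → ℤ
    w (i , j) = neg (χ (f (+ i) (+ j)))
    row : ∀ j → sumℤ (map w (map (λ i → i , j) (range1 (ℕ.pred j)))) ≡ ∑ (ℕ.pred j) (λ i → w (suc i , j))
    row j = trans (cong sumℤ (sym (map-∘ (range1 (ℕ.pred j))))) (sumℤ-range1 (ℕ.pred j) (λ i → w (i , j)))
    count : sumℤ (map _ (pairs p)) ≡ nonresidue-pairs f
    count = trans (sumℤ-concatMap w _ (filterᵇ (λ j → (2 ℕ.* j) ℕ.<ᵇ p) (range1 p)))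
      (trans (cong (λ js → sumℤ (map (λ j → sumℤ (map w (map (λ i → i , j) (range1 (ℕ.pred j))))) js)) lower-half)
        (trans (sumℤ-range1 h _) (∑-ext h (λ j → row (suc j)))))

  product-count : ℤ → ℤ → ℤ
  product-count a b = P + 1ℤ + G 0ℤ (- a) b - (1ℤ - u) * (1ℤ - χ b) - + 2 * (1ℤ - χ (a + b))
    - (1ℤ + u * χ a * χ b) * (1ℤ - u * χ a * χ (a + b))

  -- In the variable x = a s the factors have arguments x, x - a, x + b. Since χ s = α χ x and χ (1
  -- - s) = u α χ (x - a), the signs become α, - α, -1; their product is 1, so G enters with
  -- coefficient 1.
  S-product : ∀ {a b} → ¬ a ≋ 0ℤ → ¬ b ≋ 0ℤ → ¬ a + b ≋ 0ℤ →
    S (λ s → Q 1ℤ s * Q (- u) (1ℤ - s) * Q -1ℤ (a * s + b)) ≡ product-count a b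
  S-product {a} {b} na nb nab = begin
    S (λ s → Q 1ℤ s * Q (- u) (1ℤ - s) * Q -1ℤ (a * s + b))     ≡⟨ S-ext pointwise ⟩
    S (λ s → φ (a * s))                                         ≡⟨ S-scale na φ-resp ⟩
    S φ                                                         ≡⟨ S-QQQ α (- α) -1ℤ 0ℤ (- a) b
      (λ e → na (neg≋0 a (mod-trans (≡⇒mod (sym (+-identityʳ (- a)))) e)))
      (λ e → nb (mod-trans (≡⇒mod (sym (+-identityʳ b))) e))
      (λ e → nab (mod-trans (≡⇒mod (swap a b)) e)) ⟩
    P - (α * - α + α * -1ℤ + - α * -1ℤ) + α * - α * -1ℤ * G 0ℤ (- a) b
      - (1ℤ + - α * χ (- 0ℤ + - a)) * (1ℤ + -1ℤ * χ (- 0ℤ + b))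
      - (1ℤ + α * χ (- - a + 0ℤ)) * (1ℤ + -1ℤ * χ (- - a + b))
      - (1ℤ + α * χ (- b + 0ℤ)) * (1ℤ + - α * χ (- b + - a))
      ≡⟨ cong₂ _-_ (cong₂ _-_ (cong (_-_ (P - (α * - α + α * -1ℤ + - α * -1ℤ) + α * - α * -1ℤ * G 0ℤ (- a) b))
           (L₂ α (trans (cong χ (ℤ.+-identityˡ (- a))) (χ-neg a)) (cong χ (ℤ.+-identityˡ b))))
           (L₂′ (cong χ (trans (+-identityʳ (- - a)) (ℤ.neg-involutive a))) (cong (λ z → χ (z + b)) (ℤ.neg-involutive a))))
           (L₃ (trans (cong χ (+-identityʳ (- b))) (χ-neg b)) (trans (cong χ (both a b)) (χ-neg (a + b)))) ⟩
    P - (α * - α + α * -1ℤ + - α * -1ℤ) + α * - α * -1ℤ * G 0ℤ (- a) b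
      - (1ℤ + - α * (u * α)) * (1ℤ + -1ℤ * χ b)
      - (1ℤ + α * α) * (1ℤ + -1ℤ * χ (a + b))
      - (1ℤ + α * (u * χ b)) * (1ℤ + - α * (u * χ (a + b)))
      ≡⟨ finish (χ-sign na) P (G 0ℤ (- a) b) u (χ b) (χ (a + b)) ⟩
    product-count a b ∎
    where
    open ≡-Reasoning
    α = χ a
    φ : ℤ → ℤ
    φ x = Q α (x + 0ℤ) * Q (- α) (x + - a) * Q -1ℤ (x + b)
    φ-resp : Resp φ
    φ-resp e = cong₂ _*_ (cong₂ _*_ (Q-resp α (+-resp 0ℤ e)) (Q-resp (- α) (+-resp (- a) e))) (Q-resp -1ℤ (+-resp b e))
    swap : ∀ a b → a + b ≡ b - - a
    swap = solve-∀
    both : ∀ a b → - b + - a ≡ - (a + b)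
    both = solve-∀
    factor : ∀ a s → a * s + - a ≡ - (a * (1ℤ - s))
    factor = solve-∀
    L₂ : ∀ α {x y z w} → x ≡ z → y ≡ w → (1ℤ + - α * x) * (1ℤ + -1ℤ * y) ≡ (1ℤ + - α * z) * (1ℤ + -1ℤ * w)
    L₂ α refl refl = refl
    L₂′ : ∀ {x y z w} → x ≡ z → y ≡ w → (1ℤ + α * x) * (1ℤ + -1ℤ * y) ≡ (1ℤ + α * z) * (1ℤ + -1ℤ * w)
    L₂′ refl refl = refl
    L₃ : ∀ {x y z w} → x ≡ z → y ≡ w → (1ℤ + α * x) * (1ℤ + - α * y) ≡ (1ℤ + α * z) * (1ℤ + - α * w)
    L₃ refl refl = refl
    twist₁ : ∀ {α} → α ≡ 1ℤ ⊎ α ≡ -1ℤ → ∀ x → x * x + 1ℤ * x ≡ α * x * (α * x) + α * (α * x)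
    twist₁ (inj₁ refl) = lem
      where lem : ∀ x → x * x + 1ℤ * x ≡ 1ℤ * x * (1ℤ * x) + 1ℤ * (1ℤ * x)
            lem = solve-∀
    twist₁ (inj₂ refl) = lem
      where lem : ∀ x → x * x + 1ℤ * x ≡ -1ℤ * x * (-1ℤ * x) + -1ℤ * (-1ℤ * x)
            lem = solve-∀
    twist₂ : ∀ {u α} → u ≡ 1ℤ ⊎ u ≡ -1ℤ → α ≡ 1ℤ ⊎ α ≡ -1ℤ → ∀ x → x * x + - u * x ≡ u * (α * x) * (u * (α * x)) + - α * (u * (α * x))
    twist₂ (inj₁ refl) (inj₁ refl) = lem
      where lem : ∀ x → x * x + - 1ℤ * x ≡ 1ℤ * (1ℤ * x) * (1ℤ * (1ℤ * x)) + - 1ℤ * (1ℤ * (1ℤ * x))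
            lem = solve-∀
    twist₂ (inj₁ refl) (inj₂ refl) = lem
      where lem : ∀ x → x * x + - 1ℤ * x ≡ 1ℤ * (-1ℤ * x) * (1ℤ * (-1ℤ * x)) + - -1ℤ * (1ℤ * (-1ℤ * x))
            lem = solve-∀
    twist₂ (inj₂ refl) (inj₁ refl) = lem
      where lem : ∀ x → x * x + - -1ℤ * x ≡ -1ℤ * (1ℤ * x) * (-1ℤ * (1ℤ * x)) + - 1ℤ * (-1ℤ * (1ℤ * x))
            lem = solve-∀
    twist₂ (inj₂ refl) (inj₂ refl) = lem
      where lem : ∀ x → x * x + - -1ℤ * x ≡ -1ℤ * (-1ℤ * x) * (-1ℤ * (-1ℤ * x)) + - -1ℤ * (-1ℤ * (-1ℤ * x))
            lem = solve-∀
    pointwise : ∀ s → Q 1ℤ s * Q (- u) (1ℤ - s) * Q -1ℤ (a * s + b) ≡ φ (a * s)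
    pointwise s = cong (_* Q -1ℤ (a * s + b)) (cong₂ _*_
      (trans (twist₁ (χ-sign na) (χ s)) (cong (λ v → v * v + α * v) (sym (trans (cong χ (+-identityʳ (a * s))) (χ-* a s)))))
      (trans (twist₂ (χ-sign -1≉0) (χ-sign na) (χ (1ℤ - s)))
             (cong (λ v → v * v + - α * v) (sym (trans (cong χ (factor a s)) (trans (χ-neg (a * (1ℤ - s))) (cong (_*_ u) (χ-* a (1ℤ - s)))))))))
    finish : ∀ {α} → α ≡ 1ℤ ⊎ α ≡ -1ℤ → ∀ p g u β γ →
      p - (α * - α + α * -1ℤ + - α * -1ℤ) + α * - α * -1ℤ * g - (1ℤ + - α * (u * α)) * (1ℤ + -1ℤ * β)
        - (1ℤ + α * α) * (1ℤ + -1ℤ * γ) - (1ℤ + α * (u * β)) * (1ℤ + - α * (u * γ))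
      ≡ p + 1ℤ + g - (1ℤ - u) * (1ℤ - β) - + 2 * (1ℤ - γ) - (1ℤ + u * α * β) * (1ℤ - u * α * γ)
    finish (inj₁ refl) = lem
      where lem : ∀ p g u β γ →
              p - (1ℤ * - 1ℤ + 1ℤ * -1ℤ + - 1ℤ * -1ℤ) + 1ℤ * - 1ℤ * -1ℤ * g - (1ℤ + - 1ℤ * (u * 1ℤ)) * (1ℤ + -1ℤ * β)
                - (1ℤ + 1ℤ * 1ℤ) * (1ℤ + -1ℤ * γ) - (1ℤ + 1ℤ * (u * β)) * (1ℤ + - 1ℤ * (u * γ))
              ≡ p + 1ℤ + g - (1ℤ - u) * (1ℤ - β) - + 2 * (1ℤ - γ) - (1ℤ + u * 1ℤ * β) * (1ℤ - u * 1ℤ * γ)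
            lem = solve-∀
    finish (inj₂ refl) = lem
      where lem : ∀ p g u β γ →
              p - (-1ℤ * - -1ℤ + -1ℤ * -1ℤ + - -1ℤ * -1ℤ) + -1ℤ * - -1ℤ * -1ℤ * g - (1ℤ + - -1ℤ * (u * -1ℤ)) * (1ℤ + -1ℤ * β)
                - (1ℤ + -1ℤ * -1ℤ) * (1ℤ + -1ℤ * γ) - (1ℤ + -1ℤ * (u * β)) * (1ℤ + - -1ℤ * (u * γ))
              ≡ p + 1ℤ + g - (1ℤ - u) * (1ℤ - β) - + 2 * (1ℤ - γ) - (1ℤ + u * -1ℤ * β) * (1ℤ - u * -1ℤ * γ)
            lem = solve-∀

  module _ (f : ℤ → ℤ → ℤ) (a b : ℤ) (na : ¬ a ≋ 0ℤ) (nb : ¬ b ≋ 0ℤ) (nab : ¬ a + b ≋ 0ℤ) where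

    diagonal-product : (∀ i j → f i j ≡ a * (i * i) + b * (j * j)) →
      + 8 * nonresidue-pairs f ≡ product-count a b mod (+ 16)
    diagonal-product form = mod-trans (≡⇒mod (cong (_*_ (+ 8))
        (Diagonal.count-by-ratio 1ℤ a b (λ i j → f (+ suc i) (+ suc j)) χ1 (λ i j i<j j<h → suc≉0 j<h)
          (λ i j → trans (*-identityˡ _) (form (+ suc i) (+ suc j))))))
      (mod-trans (Diagonal.8count-mod a b diagonal-law) (≡⇒mod (S-product na nb nab)))

    symmetric-product : (∀ i j → + 4 * f i j ≡ a * ((j - i) * (j - i)) + b * ((j + i) * (j + i))) →
      + 8 * nonresidue-pairs f ≡ product-count a b mod (+ 16)
    symmetric-product form = mod-trans (≡⇒mod (cong (_*_ (+ 8))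
        (Symmetric.count-by-ratio (+ 4) a b (λ i j → f (+ suc i) (+ suc j)) (χ-square (+ 2) 2≉0)
          (λ i j i<j j<h → proj₁ (proj₂ (symmetric-ok i j i<j j<h))) (λ i j → form (+ suc i) (+ suc j)))))
      (mod-trans (Symmetric.8count-mod a b symmetric-law) (≡⇒mod (S-product na nb nab)))

  -- F_p (0, 1, n) as a value of G

  findW-solves : ∀ num den ws → (∃ λ w → w ∈ ws × + den * + w - num ≋ 0ℤ) → + den * + findW num den p ws - num ≋ 0ℤ
  findW-solves num den (w ∷ ws) (v , v∈ , e) with (+ den * + w - num) %ℕ p ℕ.≡ᵇ 0 in t
  ... | true = ≡ᵇ0⇒≋0 _ t
  findW-solves num den (w ∷ ws) (v , here refl , e) | false = contradiction e (≢ᵇ0⇒≉0 _ t)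
  findW-solves num den (w ∷ ws) (v , there v∈ , e) | false = findW-solves num den ws (v , v∈ , e)

  -- Multiplying the cubic by d³ clears the denominator; the symbol changes by χ d, and y ↦ d y
  -- permutes the residues. The range 1, ..., p differs from 0, ..., p - 1 by a shift.
  F01-value : ∀ n → ¬ + ℚ.denominatorℕ n ≋ 0ℤ → F01 p n ≡ χ (+ ℚ.denominatorℕ n) * G 0ℤ (+ ℚ.denominatorℕ n) (ℚ.numerator n)
  F01-value n nd = begin
    F01 p n                                       ≡⟨ sumℤ-range1 p (λ y → legendre (body (+ y)) p) ⟩
    ∑ p (λ k → legendre (body (+ suc k)) p)       ≡⟨ ∑-ext p (λ k → trans (χ-def (body (+ suc k))) (cong (λ z → χ (body z)) (ℤ.+-comm 1ℤ (+ k)))) ⟩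
    ∑ p (λ k → χ (body (+ k + 1ℤ)))               ≡⟨ S-def (λ x → χ (body (x + 1ℤ))) ⟨
    S (λ x → χ (body (x + 1ℤ)))                   ≡⟨ S-shift 1ℤ body-resp ⟩
    S (λ x → χ (body x))                          ≡⟨ absorb (χ-sign nd) (S (λ x → χ (body x))) ⟨
    χ d * (χ d * S (λ x → χ (body x)))            ≡⟨ cong (_*_ (χ d)) (trans (sym (S-* (χ d) _)) (trans (S-ext scaled) (S-scale nd (G-resp 0ℤ d m)))) ⟩
    χ d * G 0ℤ d m                                ∎
    where
    open ≡-Reasoning
    d = + ℚ.denominatorℕ n
    m = ℚ.numerator n
    w = residueOf n p
    body : ℤ → ℤ
    body y = y * (y + 1ℤ) * (y + w)
    body-resp : Resp (λ x → χ (body x))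
    body-resp e = χ-resp (mod-* (mod-* e (+-resp 1ℤ e)) (+-resp w e))
    absorb : ∀ {x} → x ≡ 1ℤ ⊎ x ≡ -1ℤ → ∀ y → x * (x * y) ≡ y
    absorb (inj₁ refl) = lem
      where lem : ∀ y → 1ℤ * (1ℤ * y) ≡ y
            lem = solve-∀
    absorb (inj₂ refl) = lem
      where lem : ∀ y → -1ℤ * (-1ℤ * y) ≡ y
            lem = solve-∀
    dw≋m : d * w - m ≋ 0ℤ
    dw≋m = solved (inverse d nd)
      where
      solved : (∃ λ b → d * b ≋ 1ℤ) → d * w - m ≋ 0ℤ
      -- The residue of m/d lies in the list searched, so the result is not the default of `findW`.
      solved (b , db) = findW-solves m (ℚ.denominatorℕ n) (upTo p) (rep (b * m) , ∈-upTo⁺ (rep<p (b * m)) ,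
          mod-lin₂ (- d) m (≋rep (b * m)) db (lem d b m (+ rep (b * m))))
        where lem : ∀ d b m r → (d * r - m) - 0ℤ ≡ (- d) * (b * m - r) + m * (d * b - 1ℤ)
              lem = solve-∀
    cube : ∀ {x} → x ≡ 1ℤ ⊎ x ≡ -1ℤ → ∀ a b c → x * (a * b * c) ≡ x * a * (x * b) * (x * c)
    cube (inj₁ refl) = lem
      where lem : ∀ a b c → 1ℤ * (a * b * c) ≡ 1ℤ * a * (1ℤ * b) * (1ℤ * c)
            lem = solve-∀
    cube (inj₂ refl) = lem
      where lem : ∀ a b c → -1ℤ * (a * b * c) ≡ -1ℤ * a * (-1ℤ * b) * (-1ℤ * c)
            lem = solve-∀
    scaled : ∀ y → χ d * χ (body y) ≡ χ (d * y + 0ℤ) * χ (d * y + d) * χ (d * y + m)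
    scaled y = begin
      χ d * χ (body y)
        ≡⟨ cong (_*_ (χ d)) (trans (χ-* (y * (y + 1ℤ)) (y + w)) (cong (_* χ (y + w)) (χ-* y (y + 1ℤ)))) ⟩
      χ d * (χ y * χ (y + 1ℤ) * χ (y + w))
        ≡⟨ cube (χ-sign nd) (χ y) (χ (y + 1ℤ)) (χ (y + w)) ⟩
      χ d * χ y * (χ d * χ (y + 1ℤ)) * (χ d * χ (y + w))
        ≡⟨ cong₂ _*_ (cong₂ _*_ (χ-* d y) (χ-* d (y + 1ℤ))) (χ-* d (y + w)) ⟨
      χ (d * y) * χ (d * (y + 1ℤ)) * χ (d * (y + w))
        ≡⟨ cong₂ _*_ (cong₂ _*_ (cong χ (sym (+-identityʳ (d * y)))) (cong χ (ring d y))) (χ-resp (mod-lin 1ℤ dw≋m (ring₂ d y w m))) ⟩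
      χ (d * y + 0ℤ) * χ (d * y + d) * χ (d * y + m) ∎
      where
      ring : ∀ d y → d * (y + 1ℤ) ≡ d * y + d
      ring = solve-∀
      ring₂ : ∀ d y w m → d * (y + w) - (d * y + m) ≡ 1ℤ * ((d * w - m) - 0ℤ)
      ring₂ = solve-∀

  -- Explicit values

  v w R : ℤ
  v = χ (+ 2)
  w = χ (+ 3)
  R = + (p ℕ.% 16)

  P≡R : P ≡ R mod (+ 16)
  P≡R = ≡%ℕ-mod P 15

  χ-1-value : u ≡ sgn (p ℕ./ 2)
  χ-1-value = ~-unique χ-1~ (subst (λ n → sgn n ~ + h) (sym (trans (cong (λ n → suc n ℕ./ 2) (lem h)) (/-quotient 1 h 2 (ℕ.s≤s (ℕ.s≤s ℕ.z≤n))))) (sgn~ h))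
    where lem : ∀ h → h ℕ.+ h ≡ h ℕ.* 2
          lem = ℕ-solve-∀

  χ2-value : v ≡ sgn ((p ℕ.+ 1) ℕ./ 4)
  χ2-value with half-split h
  ... | m , inj₁ e = ~-unique (χ2~ m m (sym e) ℕ.≤-refl (ℕ.n≤1+n m))
      (subst (λ n → sgn n ~ + m) (sym (trans (cong (λ h → (suc (h ℕ.+ h) ℕ.+ 1) ℕ./ 4) e) (trans (cong (ℕ._/ 4) (lem m)) (/-quotient 2 m 4 (ℕ.s≤s (ℕ.s≤s (ℕ.s≤s ℕ.z≤n))))))) (sgn~ m))
    where lem : ∀ m → suc (m ℕ.+ m ℕ.+ (m ℕ.+ m)) ℕ.+ 1 ≡ 2 ℕ.+ m ℕ.* 4
          lem = ℕ-solve-∀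
  ... | m , inj₂ e = ~-unique (χ2~ m (suc m) (trans (ℕ.+-suc m m) (sym e)) (ℕ.n≤1+n m) ℕ.≤-refl)
      (subst (λ n → sgn n ~ + suc m) (sym (trans (cong (λ h → (suc (h ℕ.+ h) ℕ.+ 1) ℕ./ 4) e) (trans (cong (ℕ._/ 4) (lem m)) (/-quotient 0 (suc m) 4 (ℕ.s≤s ℕ.z≤n))))) (sgn~ (suc m)))
    where lem : ∀ m → suc (suc (m ℕ.+ m) ℕ.+ suc (m ℕ.+ m)) ℕ.+ 1 ≡ 0 ℕ.+ suc m ℕ.* 4
          lem = ℕ-solve-∀

  χ3-value : w ≡ sgn ((p ℕ.+ 1) ℕ./ 6)
  χ3-value with third-split h
  ... | m , inj₁ e = ~-unique (χ3~ m m (sym e) ℕ.≤-refl (ℕ.n≤1+n m))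
      (subst (λ n → sgn n ~ + m) (sym (trans (cong (λ h → (suc (h ℕ.+ h) ℕ.+ 1) ℕ./ 6) e) (trans (cong (ℕ._/ 6) (lem m)) (/-quotient 2 m 6 (ℕ.s≤s (ℕ.s≤s (ℕ.s≤s ℕ.z≤n))))))) (sgn~ m))
    where lem : ∀ m → suc (m ℕ.+ (m ℕ.+ m) ℕ.+ (m ℕ.+ (m ℕ.+ m))) ℕ.+ 1 ≡ 2 ℕ.+ m ℕ.* 6
          lem = ℕ-solve-∀
  -- h = 3 m + 1 would mean p = 3 (2 m + 1), a product of two factors prime to p.
  ... | m , inj₂ (inj₁ e) = contradiction (mod-by 1ℤ (trans (+-identityʳ _) (trans (sym (ℤ.pos-* 3 (suc (m ℕ.+ m)))) (trans (cong +_ p≡) (sym (*-identityˡ P))))))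
      (*≉0 3≉0 (small≉0 (λ ()) (subst (suc (m ℕ.+ m) ℕ.<_) p≡ (ℕ.m<m+n (suc (m ℕ.+ m)) (ℕ.s≤s ℕ.z≤n)))))
    where
    lem : ∀ m → 3 ℕ.* suc (m ℕ.+ m) ≡ suc (suc (m ℕ.+ (m ℕ.+ m)) ℕ.+ suc (m ℕ.+ (m ℕ.+ m)))
    lem = ℕ-solve-∀
    p≡ : 3 ℕ.* suc (m ℕ.+ m) ≡ p
    p≡ = trans (lem m) (cong (λ h → suc (h ℕ.+ h)) (sym e))
  ... | m , inj₂ (inj₂ e) = ~-unique (χ3~ m (suc m) (trans (lem₀ m) (sym e)) (ℕ.n≤1+n m) ℕ.≤-refl)
      (subst (λ n → sgn n ~ + suc m) (sym (trans (cong (λ h → (suc (h ℕ.+ h) ℕ.+ 1) ℕ./ 6) e) (trans (cong (ℕ._/ 6) (lem m)) (/-quotient 0 (suc m) 6 (ℕ.s≤s ℕ.z≤n))))) (sgn~ (suc m)))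
    where lem₀ : ∀ m → m ℕ.+ (suc m ℕ.+ suc m) ≡ suc (suc (m ℕ.+ (m ℕ.+ m)))
          lem₀ = ℕ-solve-∀
          lem : ∀ m → suc (suc (suc (m ℕ.+ (m ℕ.+ m))) ℕ.+ suc (suc (m ℕ.+ (m ℕ.+ m)))) ℕ.+ 1 ≡ 0 ℕ.+ suc m ℕ.* 6
          lem = ℕ-solve-∀

  explicit-at : ∀ {z} (Φ : ℤ → ℤ → ℤ → ℤ → ℤ) → z ≡ Φ R u v w →
    z ≡ Φ R (sgn (p ℕ./ 2)) (sgn ((p ℕ.+ 1) ℕ./ 4)) (sgn ((p ℕ.+ 1) ℕ./ 6))
  explicit-at Φ e = trans e (trans (cong (λ x → Φ R x v w) χ-1-value)
    (cong₂ (Φ R (sgn (p ℕ./ 2))) χ2-value χ3-value))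

  χ4 : χ (+ 4) ≡ 1ℤ
  χ4 = χ-square (+ 2) 2≉0

  χ9 : χ (+ 9) ≡ 1ℤ
  χ9 = χ-square (+ 3) 3≉0

  χ8 : χ (+ 8) ≡ v
  χ8 = χ-square-* (+ 2) (+ 2) 2≉0

  4≉0 : ¬ + 4 ≋ 0ℤ
  4≉0 = *≉0 2≉0 2≉0

  8≉0 : ¬ + 8 ≋ 0ℤ
  8≉0 = *≉0 4≉0 2≉0

  9≉0 : ¬ + 9 ≋ 0ℤ
  9≉0 = *≉0 3≉0 3≉0

  γ-resp : ∀ s₁ s₂ s₃ → + 7 - P + s₁ + s₂ + s₃ ≡ + 7 - R + s₁ + s₂ + s₃ mod (+ 16)
  γ-resp s₁ s₂ s₃ = mod-lin -1ℤ P≡R (lem P R s₁ s₂ s₃)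
    where lem : ∀ p r a b c → (+ 7 - p + a + b + c) - (+ 7 - r + a + b + c) ≡ -1ℤ * (p - r)
          lem = solve-∀

  G₄ : G 0ℤ 1ℤ (+ 4) ≡ γ₄ R u v w mod (+ 16)
  G₄ = mod-trans (G-square (+ 2) 2≉0 3≉0 1≉0)
    (mod-trans (≡⇒mod (cong (λ c → + 7 - P + + 2 * ((1ℤ + v) * (1ℤ + w)) + + 2 * ((1ℤ + u * v) * (1ℤ + u * c)) + + 2 * ((1ℤ + u) * (1ℤ + c * w))) χ1))
               (γ-resp _ _ _))

  G₉ : G 0ℤ 1ℤ (+ 9) ≡ γ₉ R u v w mod (+ 16)
  G₉ = mod-trans (G-square (+ 3) 3≉0 4≉0 2≉0)
    (mod-trans (≡⇒mod (cong (λ c → + 7 - P + + 2 * ((1ℤ + w) * (1ℤ + c)) + + 2 * ((1ℤ + u * w) * (1ℤ + u * v)) + + 2 * ((1ℤ + u) * (1ℤ + v * c))) χ4))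
               (γ-resp _ _ _))

  F-explicit : ∀ n κ {G₀ γ} e → ¬ + ℚ.denominatorℕ n ≋ 0ℤ → χ (+ ℚ.denominatorℕ n) ≡ κ →
    G 0ℤ (+ ℚ.denominatorℕ n) (ℚ.numerator n) ≡ e * G₀ → G₀ ≡ γ mod (+ 16) → Fmod16 n p ≡ + ((κ * (e * γ)) %ℕ 16)
  F-explicit n κ e nd χd eq Gγ = cong +_ (mod⇒%ℕ≡ 15 (mod-trans (≡⇒mod (trans (F01-value n nd) (cong₂ _*_ χd eq)))
    (mod-* (mod-refl {x = κ}) (mod-* (mod-refl {x = e}) Gγ))))

  product-explicit : ∀ f a b {G₀ γ α β σ} e → + 8 * nonresidue-pairs f ≡ product-count a b mod (+ 16) →
    χ a ≡ α → χ b ≡ β → χ (a + b) ≡ σ → G 0ℤ (- a) b ≡ e * G₀ → G₀ ≡ γ mod (+ 16) →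
    formProduct f p ≡ sign₁₆ (countE R u (e * γ) α β σ)
  product-explicit f a b {G₀} {γ} e K refl refl refl eq Gγ = sign₁₆-correct (formProduct~ f)
    (mod-trans K (mod-trans (≡⇒mod (cong (λ g → P + 1ℤ + g - (1ℤ - u) * (1ℤ - χ b) - + 2 * (1ℤ - χ (a + b)) - (1ℤ + u * χ a * χ b) * (1ℤ - u * χ a * χ (a + b))) eq))
      (mod-lin₂ 1ℤ e P≡R Gγ (lem P R e G₀ γ ((1ℤ - u) * (1ℤ - χ b)) (+ 2 * (1ℤ - χ (a + b))) ((1ℤ + u * χ a * χ b) * (1ℤ - u * χ a * χ (a + b)))))))
    where lem : ∀ p r e g h x y z → (p + 1ℤ + e * g - x - y - z) - (r + 1ℤ + e * h - x - y - z) ≡ 1ℤ * (p - r) + e * (g - h)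
          lem = solve-∀

  -- Permuting or translating the three points leaves G unchanged and reflecting them multiplies it
  -- by u, so each triple that occurs reduces to 0, 1, c with factor 1 or u. Names spell out the
  -- arguments of G.
  module Normalise (c : ℤ) where

    G₀ : ℤ
    G₀ = G 0ℤ 1ℤ c

    G-0-1-c : G 0ℤ 1ℤ c ≡ 1ℤ * G₀
    G-0-1-c = sym (*-identityˡ G₀)

    G-0-c-1 : G 0ℤ c 1ℤ ≡ 1ℤ * G₀
    G-0-c-1 = trans (G-swap₂₃ 0ℤ c 1ℤ) G-0-1-c

    G-0--1-[c-1] : G 0ℤ -1ℤ (c - 1ℤ) ≡ 1ℤ * G₀
    G-0--1-[c-1] = trans (sym (G-shift 1ℤ 0ℤ -1ℤ (c - 1ℤ))) (trans (cong (G 1ℤ 0ℤ) (lem c)) (trans (G-swap₁₂ 1ℤ 0ℤ c) G-0-1-c))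
      where lem : ∀ c → c - 1ℤ + 1ℤ ≡ c
            lem = solve-∀

    G-0-[c-1]--1 : G 0ℤ (c - 1ℤ) -1ℤ ≡ 1ℤ * G₀
    G-0-[c-1]--1 = trans (G-swap₂₃ 0ℤ (c - 1ℤ) -1ℤ) G-0--1-[c-1]

    G-negated : ∀ {a b a′ b′} → - a ≡ a′ → - b ≡ b′ → G 0ℤ a b ≡ 1ℤ * G₀ → G 0ℤ a′ b′ ≡ u * G₀
    G-negated {a} {b} refl refl e = trans (G-neg 0ℤ a b) (cong (_*_ u) (trans e (*-identityˡ G₀)))

    -[c-1] : - (c - 1ℤ) ≡ 1ℤ - c
    -[c-1] = lem c
      where lem : ∀ c → - (c - 1ℤ) ≡ 1ℤ - c
            lem = solve-∀

    G-0-1-[1-c] : G 0ℤ 1ℤ (1ℤ - c) ≡ u * G₀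
    G-0-1-[1-c] = G-negated refl -[c-1] G-0--1-[c-1]

    G-0--c--1 : G 0ℤ (- c) -1ℤ ≡ u * G₀
    G-0--c--1 = G-negated {c} {1ℤ} refl refl G-0-c-1

    G-0-[1-c]-1 : G 0ℤ (1ℤ - c) 1ℤ ≡ u * G₀
    G-0-[1-c]-1 = G-negated -[c-1] refl G-0-[c-1]--1

    G-0-c-[c-1] : G 0ℤ c (c - 1ℤ) ≡ u * G₀
    G-0-c-[c-1] = G-negated (ℤ.neg-involutive c) (lem c)
        (trans (sym (G-shift c 0ℤ (- c) (1ℤ - c))) (trans (cong₂ (λ x y → G x y (1ℤ - c + c)) (ℤ.+-identityˡ c) (ℤ.+-inverseˡ c))
          (trans (cong (G c 0ℤ) (lem′ c)) (trans (G-swap₁₂ c 0ℤ 1ℤ) G-0-c-1))))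
      where lem : ∀ c → - (1ℤ - c) ≡ c - 1ℤ
            lem = solve-∀
            lem′ : ∀ c → 1ℤ - c + c ≡ 1ℤ
            lem′ = solve-∀

    G-0-[c-1]-c : G 0ℤ (c - 1ℤ) c ≡ u * G₀
    G-0-[c-1]-c = trans (G-swap₂₃ 0ℤ (c - 1ℤ) c) G-0-c-[c-1]

  module N₄ = Normalise (+ 4)
  module N₉ = Normalise (+ 9)

  F[4] : Fmod16 (+ 4 ℚ./ 1) p ≡ + ((1ℤ * (1ℤ * γ₄ R u v w)) %ℕ 16)
  F[4] = F-explicit (+ 4 ℚ./ 1) 1ℤ 1ℤ 1≉0 χ1 N₄.G-0-1-c G₄

  F[-3] : Fmod16 (- + 3 ℚ./ 1) p ≡ + ((1ℤ * (u * γ₄ R u v w)) %ℕ 16)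
  F[-3] = F-explicit (- + 3 ℚ./ 1) 1ℤ u 1≉0 χ1 N₄.G-0-1-[1-c] G₄

  F[9] : Fmod16 (+ 9 ℚ./ 1) p ≡ + ((1ℤ * (1ℤ * γ₉ R u v w)) %ℕ 16)
  F[9] = F-explicit (+ 9 ℚ./ 1) 1ℤ 1ℤ 1≉0 χ1 N₉.G-0-1-c G₉

  F[-8] : Fmod16 (- + 8 ℚ./ 1) p ≡ + ((1ℤ * (u * γ₉ R u v w)) %ℕ 16)
  F[-8] = F-explicit (- + 8 ℚ./ 1) 1ℤ u 1≉0 χ1 N₉.G-0-1-[1-c] G₉

  F[1/4] : Fmod16 (+ 1 ℚ./ 4) p ≡ + ((1ℤ * (1ℤ * γ₄ R u v w)) %ℕ 16)
  F[1/4] = F-explicit (+ 1 ℚ./ 4) 1ℤ 1ℤ 4≉0 χ4 N₄.G-0-c-1 G₄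

  F[3/4] : Fmod16 (+ 3 ℚ./ 4) p ≡ + ((1ℤ * (u * γ₄ R u v w)) %ℕ 16)
  F[3/4] = F-explicit (+ 3 ℚ./ 4) 1ℤ u 4≉0 χ4 N₄.G-0-c-[c-1] G₄

  F[4/3] : Fmod16 (+ 4 ℚ./ 3) p ≡ + ((w * (u * γ₄ R u v w)) %ℕ 16)
  F[4/3] = F-explicit (+ 4 ℚ./ 3) w u 3≉0 refl N₄.G-0-[c-1]-c G₄

  F[-1/3] : Fmod16 (- + 1 ℚ./ 3) p ≡ + ((w * (1ℤ * γ₄ R u v w)) %ℕ 16)
  F[-1/3] = F-explicit (- + 1 ℚ./ 3) w 1ℤ 3≉0 refl N₄.G-0-[c-1]--1 G₄

  product-form₁ : formProduct form₁ p ≡ sign₁₆ (countE R u (1ℤ * γ₄ R u v w) 1ℤ w 1ℤ)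
  product-form₁ = product-explicit form₁ (+ 1) (+ 3) 1ℤ (symmetric-product form₁ (+ 1) (+ 3) 1≉0 3≉0 4≉0 lem) χ1 refl χ4 N₄.G-0--1-[c-1] G₄
    where lem : ∀ i j → + 4 * (i * i + i * j + j * j) ≡ + 1 * ((j - i) * (j - i)) + + 3 * ((j + i) * (j + i))
          lem = solve-∀

  product-form₂ : formProduct form₂ p ≡ sign₁₆ (countE R u (u * γ₄ R u v w) w 1ℤ 1ℤ)
  product-form₂ = product-explicit form₂ (+ 3) (+ 1) u (symmetric-product form₂ (+ 3) (+ 1) 3≉0 1≉0 4≉0 lem) refl χ1 χ4 N₄.G-0-[1-c]-1 G₄
    where lem : ∀ i j → + 4 * (i * i - i * j + j * j) ≡ + 3 * ((j - i) * (j - i)) + + 1 * ((j + i) * (j + i))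
          lem = solve-∀

  product-form₃ : formProduct form₃ p ≡ sign₁₆ (countE R u (1ℤ * γ₉ R u v w) u 1ℤ v)
  product-form₃ = product-explicit form₃ -1ℤ (+ 9) 1ℤ (symmetric-product form₃ -1ℤ (+ 9) -1≉0 9≉0 8≉0 lem) refl χ9 χ8 N₉.G-0-1-c G₉
    where lem : ∀ i j → + 4 * (+ 2 * i * i + + 5 * i * j + + 2 * j * j) ≡ -1ℤ * ((j - i) * (j - i)) + + 9 * ((j + i) * (j + i))
          lem = solve-∀

  product-form₄ : formProduct form₄ p ≡ sign₁₆ (countE R u (u * γ₉ R u v w) 1ℤ u v)
  product-form₄ = product-explicit form₄ (+ 9) -1ℤ u (symmetric-product form₄ (+ 9) -1ℤ 9≉0 -1≉0 8≉0 lem) χ9 refl χ8 N₉.G-0--c--1 G₉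
    where lem : ∀ i j → + 4 * (+ 2 * i * i - + 5 * i * j + + 2 * j * j) ≡ + 9 * ((j - i) * (j - i)) + -1ℤ * ((j + i) * (j + i))
          lem = solve-∀

  product-form₅ : formProduct form₅ p ≡ sign₁₆ (countE R u (u * γ₄ R u v w) 1ℤ u w)
  product-form₅ = product-explicit form₅ (+ 4) -1ℤ u (diagonal-product form₅ (+ 4) -1ℤ 4≉0 -1≉0 3≉0 lem) χ4 refl refl N₄.G-0--c--1 G₄
    where lem : ∀ i j → + 4 * i * i - j * j ≡ + 4 * (i * i) + -1ℤ * (j * j)
          lem = solve-∀

  -- The coefficients 9, -1 also belong to `form₄`, with other pairs (X, Y); the values agree
  -- because both families obey the same `MLaw`.
  product-form₆ : formProduct form₆ p ≡ sign₁₆ (countE R u (u * γ₉ R u v w) 1ℤ u v)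
  product-form₆ = product-explicit form₆ (+ 9) -1ℤ u (diagonal-product form₆ (+ 9) -1ℤ 9≉0 -1≉0 8≉0 lem) χ9 refl χ8 N₉.G-0--c--1 G₉
    where lem : ∀ i j → + 9 * i * i - j * j ≡ + 9 * (i * i) + -1ℤ * (j * j)
          lem = solve-∀

  -- In the same way, 3 and 1 are the coefficients of `form₂`.
  product-form₇ : formProduct form₇ p ≡ sign₁₆ (countE R u (u * γ₄ R u v w) w 1ℤ 1ℤ)
  product-form₇ = product-explicit form₇ (+ 3) (+ 1) u (diagonal-product form₇ (+ 3) (+ 1) 3≉0 1≉0 4≉0 lem) refl χ1 χ4 N₄.G-0-[1-c]-1 G₄
    where lem : ∀ i j → + 3 * i * i + j * j ≡ + 3 * (i * i) + + 1 * (j * j)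
          lem = solve-∀

  product-form₈ : formProduct form₈ p ≡ sign₁₆ (countE R u (u * γ₉ R u v w) v 1ℤ 1ℤ)
  product-form₈ = product-explicit form₈ (+ 8) (+ 1) u (diagonal-product form₈ (+ 8) (+ 1) 8≉0 1≉0 9≉0 lem) χ8 χ1 χ9 N₉.G-0-[1-c]-1 G₉
    where lem : ∀ i j → + 8 * i * i + j * j ≡ + 8 * (i * i) + + 1 * (j * j)
          lem = solve-∀

-- All primes p > 3 and the theorem

odd-prime : ∀ (A : ℕ → Set) → (∀ h → Prime (suc (h ℕ.+ h)) → 3 ℕ.< suc (h ℕ.+ h) → A (suc (h ℕ.+ h))) → ∀ p → PrimeGt3 p → A p
odd-prime A k p (pr , p>3) with half-split p
... | h , inj₂ refl = k h pr p>3
... | h , inj₁ refl with prime⇒irreducible pr (ℕ-divides h (trans (cong (h ℕ.+_) (sym (ℕ.+-identityʳ h))) (ℕ.*-comm 2 h)))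
...   | inj₂ 2≡p = contradiction (subst (3 ℕ.<_) (sym 2≡p) p>3) λ { (ℕ.s≤s (ℕ.s≤s ())) }

explicit : ∀ {g} Φ →
  (∀ h pr p>3 → let open OddPrime h pr p>3 in g p ≡ Φ R u v w) → Explicit g
explicit Φ e = Φ , odd-prime _ (λ h pr p>3 → OddPrime.explicit-at h pr p>3 Φ (e h pr p>3))

F-Explicit : ∀ n → n ∈ nList → Explicit (Fmod16 n)
F-Explicit _ (here refl) = explicit (λ r u v w → + ((1ℤ * (1ℤ * γ₄ r u v w)) %ℕ 16)) OddPrime.F[4]
F-Explicit _ (there (here refl)) = explicit (λ r u v w → + ((1ℤ * (u * γ₄ r u v w)) %ℕ 16)) OddPrime.F[-3]
F-Explicit _ (there (there (here refl))) = explicit (λ r u v w → + ((1ℤ * (1ℤ * γ₉ r u v w)) %ℕ 16)) OddPrime.F[9]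
F-Explicit _ (there (there (there (here refl)))) = explicit (λ r u v w → + ((1ℤ * (u * γ₉ r u v w)) %ℕ 16)) OddPrime.F[-8]
F-Explicit _ (there (there (there (there (here refl))))) = explicit (λ r u v w → + ((1ℤ * (1ℤ * γ₄ r u v w)) %ℕ 16)) OddPrime.F[1/4]
F-Explicit _ (there (there (there (there (there (here refl)))))) = explicit (λ r u v w → + ((1ℤ * (u * γ₄ r u v w)) %ℕ 16)) OddPrime.F[3/4]
F-Explicit _ (there (there (there (there (there (there (here refl))))))) = explicit (λ r u v w → + ((w * (u * γ₄ r u v w)) %ℕ 16)) OddPrime.F[4/3]
F-Explicit _ (there (there (there (there (there (there (there (here refl)))))))) = explicit (λ r u v w → + ((w * (1ℤ * γ₄ r u v w)) %ℕ 16)) OddPrime.F[-1/3]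

product-Explicit : ∀ f → f ∈ formList → Explicit (formProduct f)
product-Explicit _ (here refl) = explicit (λ r u v w → sign₁₆ (countE r u (1ℤ * γ₄ r u v w) 1ℤ w 1ℤ)) OddPrime.product-form₁
product-Explicit _ (there (here refl)) = explicit (λ r u v w → sign₁₆ (countE r u (u * γ₄ r u v w) w 1ℤ 1ℤ)) OddPrime.product-form₂
product-Explicit _ (there (there (here refl))) = explicit (λ r u v w → sign₁₆ (countE r u (1ℤ * γ₉ r u v w) u 1ℤ v)) OddPrime.product-form₃
product-Explicit _ (there (there (there (here refl)))) = explicit (λ r u v w → sign₁₆ (countE r u (u * γ₉ r u v w) 1ℤ u v)) OddPrime.product-form₄
product-Explicit _ (there (there (there (there (here refl))))) = explicit (λ r u v w → sign₁₆ (countE r u (u * γ₄ r u v w) 1ℤ u w)) OddPrime.product-form₅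
product-Explicit _ (there (there (there (there (there (here refl)))))) = explicit (λ r u v w → sign₁₆ (countE r u (u * γ₉ r u v w) 1ℤ u v)) OddPrime.product-form₆
product-Explicit _ (there (there (there (there (there (there (here refl))))))) = explicit (λ r u v w → sign₁₆ (countE r u (u * γ₄ r u v w) w 1ℤ 1ℤ)) OddPrime.product-form₇
product-Explicit _ (there (there (there (there (there (there (there (here refl)))))))) = explicit (λ r u v w → sign₁₆ (countE r u (u * γ₉ r u v w) v 1ℤ 1ℤ)) OddPrime.product-form₈

theorem3p4 : ((n₁ n₂ : ℚ) → n₁ ∈ nList → n₂ ∈ nList → Equivalent (Fmod16 n₁) (Fmod16 n₂))
    × ((f : ℤ → ℤ → ℤ) → f ∈ formList → Equivalent (Fmod16 four) (formProduct f))
    × (Periodic (Fmod16 four) × ((f : ℤ → ℤ → ℤ) → f ∈ formList → Periodic (formProduct f)))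
theorem3p4 =
    (λ n₁ n₂ n₁∈ n₂∈ → explicit⇒equivalent (F-Explicit n₁ n₁∈) (F-Explicit n₂ n₂∈))
  , (λ f f∈ → explicit⇒equivalent (F-Explicit four (here refl)) (product-Explicit f f∈))
  , explicit⇒periodic (F-Explicit four (here refl))
  , (λ f f∈ → explicit⇒periodic (product-Explicit f f∈))
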